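{- There exist sets $A\subseteq\{0,1\}^+$ that are $\mathbf P$-levelable but not $\mathbf{FPT}_{\mathrm{nu}}$-levelable.
   Context: A Turing machine $\Phi$ is a partial decision procedure for $A$ if $\Phi(x)=1\Rightarrow x\in A$ and $\Phi(x)=0\Rightarrow x\notin A$; $\mathrm{dom}(\Phi)=\{x:\Phi(x)\in\{0,1\}\}$. A $\mathbf P$-approximation (resp. $O(n^c)$-approximation) for $A$ is a partial decision procedure for $A$ halting on all inputs in polynomial time (resp. time $O(n^c)$); a $\mathbf P$-slice (resp. $O(n^c)$-slice) is the domain of such an approximation. A $\mathbf P$-slice $S$ for $A$ is maximal if $S'\setminus S$ is finite for every $\mathbf P$-slice $S'$ for $A$. $A$ is $\mathbf P$-levelable if it has no maximal $\mathbf P$-slice. A parameter space is a nonempty set $\Omega$ with a reflexive, transitive, directed relation $\preccurlyeq$ and an injective encoding into $\{0,1\}^+$; $|k|$ is the encoding length. A parameterization over $\Omega$ is $\eta\subseteq\{0,1\}^+\times\Omega$ such that for every $x$, $\{k:(x,k)\in\eta\}$ is nonempty and upward closed; $\eta_k=\{x:(x,k)\in\eta\}$. $\eta$ has imix if for every $k$ there is $k'$ with $\eta_{k'}\setminus\eta_k$ infinite. $\mu_\eta(x)=\min\{|k|:(x,k)\in\eta\}$; $\mathrm{gap}_{\eta_1,\eta_2}(n)=\max\{\mu_{\eta_1}(x):\mu_{\eta_2}(x)\le n\}\in\mathbb N\cup\{\infty\}$ (max of empty set is $0$); $\eta_1\preccurlyeq_{\mathrm{nu}}\eta_2$ if $\mathrm{gap}_{\eta_1,\eta_2}(n)<\infty$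 for all $n$. For a constant $c$, $(A,\eta)\in\mathbf{FPT}^c_{\mathrm{nu}}$ if every $\eta_k$ is an $O(n^c)$-slice for $A$. $A$ is $\mathbf{FPT}_{\mathrm{nu}}$-levelable if there is $c_0$ such that for all $c\ge c_0$ there is $\eta$ with $(A,\eta)\in\mathbf{FPT}^c_{\mathrm{nu}}$ such that every $\eta'\preccurlyeq_{\mathrm{nu}}\eta$ with $(A,\eta')\in\mathbf{FPT}^c_{\mathrm{nu}}$ has imix. -}

module Defs where

open import Level using (Level)
open import Data.Bool using (Bool)
open import Data.Nat using (ℕ; zero; suc; _*_; _^_; _≤_; _≥_)
open import Data.Fin using (Fin)
open import Data.List using (List; []; _∷_; map)
open import Data.List.NonEmpty using (List⁺; _∷_; length)
open import Data.List.Membership.Propositional using (_∈_)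
open import Data.Vec using (Vec; replicate; zipWith) renaming (map to vmap; _∷_ to _∷v_)
open import Data.Product using (Σ; ∃; ∃-syntax; _×_; _,_)
open import Data.Sum using (_⊎_; inj₁; inj₂)
open import Relation.Nullary using (¬_)
open import Relation.Binary.PropositionalEquality using (_≡_)
open import Function using (_∘_)

Str : Set
Str = List⁺ Bool

Pred : Set₁
Pred = Str → Set

-- Deterministic multi-tape Turing machines over {0,1} with a blank.
-- A machine has k = suc tapes tapes and suc states non-halting states
-- (start state = Fin.zero).  It halts by entering one of three halting
-- outputs: 0, 1, or "?" (an output not in {0,1}).

data Sym : Set where
  blank : Sym
  bit   : Bool → Sym

data Move : Set where
  left right stay : Move

data Out : Set where
  out0 out1 out? : Out

record Tape : Set where
  constructor tape
  field
    lft : List Sym   -- cells to the left of the head, nearest first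
    hd  : Sym
    rgt : List Sym   -- cells to the right of the head, nearest first

moveTape : Move → Tape → Tape
moveTape left  (tape []      h r) = tape [] blank (h ∷ r)
moveTape left  (tape (a ∷ l) h r) = tape l a (h ∷ r)
moveTape right (tape l h [])      = tape (h ∷ l) blank []
moveTape right (tape l h (a ∷ r)) = tape (h ∷ l) a r
moveTape stay  t                  = t

writeMove : Sym → Move → Tape → Tape
writeMove s m (tape l _ r) = moveTape m (tape l s r)

record TM : Set where
  field
    tapes  : ℕ
    states : ℕ
    δ      : Fin (suc states) → Vec Sym (suc tapes) →
             (Fin (suc states) ⊎ Out) × Vec Sym (suc tapes) × Vec Move (suc tapes)

module _ (M : TM) where
  open TM M

  data Status : Set where
    running : Fin (suc states) → Vec Tape (suc tapes) → Status
    halted  : Out → Status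

  step : Status → Status
  step (halted o) = halted o
  step (running q ts) with δ q (vmap Tape.hd ts)
  ... | q' , ws , ms =
    let ts' = zipWith (λ (w , m) t → writeMove w m t) (zipWith _,_ ws ms) ts in
    [ (λ q'' → running q'' ts') , halted ]′ q'
    where open import Data.Sum using ([_,_]′)

  iter : ℕ → Status → Status
  iter zero    s = s
  iter (suc t) s = iter t (step s)

  initTapes : Str → Vec Tape (suc tapes)
  initTapes (b ∷ bs) = tape [] (bit b) (map bit bs) ∷v replicate _ (tape [] blank [])

  run : Str → ℕ → Status
  run x t = iter t (running Fin.zero (initTapes x))
    where import Data.Fin as Fin

Outputs : TM → Str → Out → Set
Outputs M x o = ∃[ t ] run M x t ≡ halted o

HaltsWithin : TM → Str → ℕ → Set
HaltsWithin M x t = ∃[ o ] run M x t ≡ halted o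

Dom : TM → Pred
Dom M x = Outputs M x out0 ⊎ Outputs M x out1

IsPartialDecision : Pred → TM → Set
IsPartialDecision A M =
  ∀ x → (Outputs M x out1 → A x) × (Outputs M x out0 → ¬ A x)

RunsInTime : ℕ → TM → Set
RunsInTime c M = ∃[ d ] ∀ x → ∃[ t ] t ≤ d * (length x ^ c) × HaltsWithin M x t

IsApprox : ℕ → Pred → TM → Set
IsApprox c A M = IsPartialDecision A M × RunsInTime c M

IsPApprox : Pred → TM → Set
IsPApprox A M = ∃[ c ] IsApprox c A M

_≐_ : Pred → Pred → Set
S ≐ T = ∀ x → (S x → T x) × (T x → S x)

IsSlice : ℕ → Pred → Pred → Set
IsSlice c A S = ∃[ M ] IsApprox c A M × (S ≐ Dom M)

IsPSlice : Pred → Pred → Set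
IsPSlice A S = ∃[ M ] IsPApprox A M × (S ≐ Dom M)

Finite : Pred → Set
Finite S = ∃[ L ] ∀ x → S x → x ∈ L

Infinite : Pred → Set
Infinite S = ¬ Finite S

_∖_ : Pred → Pred → Pred
(S ∖ T) x = S x × ¬ T x

IsMaximalPSlice : Pred → Pred → Set₁
IsMaximalPSlice A S = IsPSlice A S × (∀ S' → IsPSlice A S' → Finite (S' ∖ S))

PLevelable : Pred → Set₁
PLevelable A = ¬ (∃[ S ] IsMaximalPSlice A S)

record ParamSpace : Set₁ where
  field
    Carrier   : Set
    _≼_       : Carrier → Carrier → Set
    ≼-refl    : ∀ k → k ≼ k
    ≼-trans   : ∀ {i j k} → i ≼ j → j ≼ k → i ≼ k
    directed  : ∀ i j → ∃[ k ] (i ≼ k × j ≼ k)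
    inhabited : Carrier
    enc       : Carrier → Str
    enc-inj   : ∀ {i j} → enc i ≡ enc j → i ≡ j

  ∣_∣ : Carrier → ℕ
  ∣ k ∣ = length (enc k)

record Parameterization (Ω : ParamSpace) : Set₁ where
  open ParamSpace Ω
  field
    rel      : Str → Carrier → Set
    nonempty : ∀ x → ∃[ k ] rel x k
    upward   : ∀ {x k k'} → rel x k → k ≼ k' → rel x k'

  slice : Carrier → Pred
  slice k x = rel x k

module _ {Ω : ParamSpace} where
  open ParamSpace Ω
  open Parameterization

  Imix : Parameterization Ω → Set
  Imix η = ∀ k → ∃[ k' ] Infinite (slice η k' ∖ slice η k)

  FPTnu : ℕ → Pred → Parameterization Ω → Set
  FPTnu c A η = ∀ k → IsSlice c A (slice η k)

  -- μ_η(x) ≤ n   (μ_η(x) = min{|k| : (x,k) ∈ η}, a nonempty set)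
  μ≤ : Parameterization Ω → Str → ℕ → Set
  μ≤ η x n = ∃[ k ] rel η x k × ∣ k ∣ ≤ n

-- gap_{η₁,η₂}(n) < ∞ : the set {μ_{η₁}(x) : μ_{η₂}(x) ≤ n} is bounded
GapFinite : {Ω₁ Ω₂ : ParamSpace} → Parameterization Ω₁ → Parameterization Ω₂ → ℕ → Set
GapFinite η₁ η₂ n = ∃[ m ] ∀ x → μ≤ η₂ x n → μ≤ η₁ x m

_≼nu_ : {Ω₁ Ω₂ : ParamSpace} → Parameterization Ω₁ → Parameterization Ω₂ → Set
η₁ ≼nu η₂ = ∀ n → GapFinite η₁ η₂ n

FPTnuLevelable : Pred → Set₁
FPTnuLevelable A =
  ∃[ c₀ ] ∀ c → c ≥ c₀ →
    Σ ParamSpace λ Ω → Σ (Parameterization Ω) λ η →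
      FPTnu c A η ×
      (∀ (Ω' : ParamSpace) (η' : Parameterization Ω') →
         η' ≼nu η → FPTnu c A η' → Imix η')

{-
A sequence of words x_n = 1^(n+1) is assigned levels such that every level occurs
infinitely often, and A is a subset of {x_n} defined by diagonalisation.  At stage n,
with level l, the first machine in an enumeration that is not yet refuted at a level
up to l and that answers on x_n within |x_n|^(c l) steps is refuted: A x_n is chosen
against its answer.  A machine refuted twice is refuted at ever lower levels, hence
finitely often, so a correct machine of time O(n^b) answers on only finitely many x_n
whose level l satisfies c l > b: otherwise it would itself be refuted.

Membership of the words of level below J depends only on the refutations at levels
below J, and so it is decided in time O(n^e) for some e = e(J) by universal simulation.
With c J = e(J) + 1, the domain of this decider is a maximal O(n^e)-slice, and adding
it to every slice of a parameterization destroys imix.  The decider for the next level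
shows that no P-slice is maximal.

The simulation is programmed with functions on binary trees: compositions and bounded
folds are polynomial-time, because a Turing machine can keep serialised trees on a
stack.
-}
module Submission where

open import Defs
open import Data.Bool using (Bool; true; false; if_then_else_)
open import Data.Empty using (⊥; ⊥-elim)
open import Data.Fin using (Fin; zero; suc; toℕ; _↑ˡ_; _↑ʳ_; splitAt; join)
open import Data.Fin.Patterns using (0F; 1F; 2F; 3F; 4F)
open import Data.Fin.Properties using (splitAt-join)
open import Data.List as List using (List; []; _∷_; [_]; map; length; upTo; foldl; foldr; _++_; _ʳ++_)
open import Data.List.Membership.Propositional using (_∈_)
open import Data.List.Membership.Propositional.Properties using (∈-map⁺; ∈-upTo⁺)
open import Data.List.NonEmpty as List⁺ using (_∷_)
open import Data.List.Properties using (++-assoc; ++-identityʳ; ++-ʳ++; length-++; length-replicate; length-ʳ++; reverse-foldl; ʳ++-ʳ++; ∷-injectiveˡ; ∷-injectiveʳ)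
open import Data.List.Relation.Unary.Any using (here; there)
open import Data.Maybe using (Maybe; just; nothing)
open import Data.Nat using (ℕ; zero; suc; _+_; _*_; _^_; _∸_; _≤_; _<_; z≤n; s≤s; s≤s⁻¹; NonZero)
open import Data.Nat.ListAction using (sum)
open import Data.Nat.ListAction.Properties using (sum-++)
open import Data.Nat.Properties
open import Data.Nat.Tactic.RingSolver using (solve-∀)
open import Data.Product using (∃-syntax; _×_; _,_; proj₁; proj₂; map₁)
open import Data.Sum using (_⊎_; inj₁; inj₂; [_,_]′) renaming (map to map⊎)
open import Data.Unit using (⊤; tt)
open import Data.Vec using (Vec; []; _∷_; lookup; replicate; updateAt; zipWith; _[_]≔_) renaming (map to vmap; _++_ to _++ᵛ_)
open import Data.Vec.Properties using (lookup-map; updateAt-updateAt-local)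
open import Function using (_∘_; id; const; flip; case_of_)
open import Relation.Binary.Definitions using (tri<; tri≈; tri>)
open import Relation.Binary.PropositionalEquality hiding ([_])
open import Relation.Nullary using (¬_; yes; no)

-- If a refutation silenced a machine at all levels, the words of low level would depend on
-- refutations at high levels, whose clocks no fixed polynomial bounds. Hence a refutation at level
-- t acts only at the levels t and above. A machine that can be refuted at t is alive at all lower
-- levels, and it remains so; stages of level at least J are therefore invisible below J, and the
-- decider for the levels below J skips them by giving them an empty clock.
--
-- The exponents are not circular: the degree of that decider involves only the clocks of the levels
-- below J. The clock of level J gets one more in the exponent to absorb the constant factor hidden
-- in O(n^e).
--
-- Nothing decides whether an entry will be refuted once more, so the finiteness of its refutations
-- is available only under a double negation. This suffices, because both halves of the theorem are
-- negations.

private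
  variable
    k r n : ℕ
    X Y Z : Set

-- Control fragments

-- States may form any type, so that composition is a disjoint sum. A retraction `state` of `index`
-- is enough: a machine starts at 0 and afterwards meets only numbers produced by `index`. Leaving
-- is itself a transition, which still writes and moves.
record Frag (k : ℕ) (X : Set) : Set₁ where
  no-eta-equality
  field
    Q           : Set
    entry       : Q
    δ           : Q → Vec Sym k → (Q ⊎ X) × Vec Sym k × Vec Move k
    #Q          : ℕ
    index       : Q → Fin (suc #Q)
    state       : Fin (suc #Q) → Q
    state-index : ∀ q → state (index q) ≡ q
    state-zero  : state zero ≡ entry

open Frag

act : Vec Sym k → Vec Move k → Vec Tape k → Vec Tape k
act ws ms ts = zipWith (λ (w , m) t → writeMove w m t) (zipWith _,_ ws ms) ts

heads : Vec Tape k → Vec Sym k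
heads = vmap Tape.hd

data Run (F : Frag k X) : Q F → Vec Tape k → X → Vec Tape k → ℕ → Set where
  exit : ∀ {q ts x ws ms} → δ F q (heads ts) ≡ (inj₂ x , ws , ms) →
         Run F q ts x (act ws ms ts) 1
  next : ∀ {q q' ts x ws ms ts' t} → δ F q (heads ts) ≡ (inj₁ q' , ws , ms) →
         Run F q' (act ws ms ts) x ts' t → Run F q ts x ts' (suc t)

atomᶠ : (Sym → X × Sym × Move) → Fin k → Frag k X
atomᶠ g i = record
  { Q = ⊤ ; entry = tt
  ; δ = λ _ v → let (x , w , m) = g (lookup v i) in
                inj₂ x , v [ i ]≔ w , replicate _ stay [ i ]≔ m
  ; #Q = 0 ; index = λ _ → zero ; state = λ _ → tt
  ; state-index = λ _ → refl ; state-zero = refl }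

redirect : {A B : Set} → (A → B) → B → (X → Y ⊎ ⊤) → A ⊎ X → B ⊎ Y
redirect f b h (inj₁ a) = inj₁ (f a)
redirect f b h (inj₂ x) = [ inj₂ , (λ _ → inj₁ b) ]′ (h x)

-- The fragment G is entered at the exits of F that h sends to inj₂.
bindᶠ : Frag k X → (X → Y ⊎ ⊤) → (Z → Y) → Frag k Z → Frag k Y
bindᶠ F h g G = record
  { Q = Q F ⊎ Q G ; entry = inj₁ (entry F)
  ; δ = λ { (inj₁ q) v → map₁ (redirect inj₁ (inj₂ (entry G)) h) (δ F q v)
          ; (inj₂ q) v → map₁ (map⊎ inj₂ g) (δ G q v) }
  ; #Q = #Q F + suc (#Q G)
  ; index = join (suc (#Q F)) (suc (#Q G)) ∘ map⊎ (index F) (index G)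
  ; state = map⊎ (state F) (state G) ∘ splitAt (suc (#Q F))
  ; state-index = si
  ; state-zero = cong inj₁ (state-zero F) }
  where
  si : ∀ q → map⊎ (state F) (state G) (splitAt (suc (#Q F)) (join (suc (#Q F)) (suc (#Q G)) (map⊎ (index F) (index G) q))) ≡ q
  si q rewrite splitAt-join (suc (#Q F)) (suc (#Q G)) (map⊎ (index F) (index G) q) with q
  ... | inj₁ p = cong inj₁ (state-index F p)
  ... | inj₂ p = cong inj₂ (state-index G p)

loopᶠ : Frag k X → (X → Y ⊎ ⊤) → Frag k Y
loopᶠ F h = record
  { Q = Q F ; entry = entry F
  ; δ = λ q v → map₁ (redirect id (entry F) h) (δ F q v)
  ; #Q = #Q F ; index = index F ; state = state F
  ; state-index = state-index F ; state-zero = state-zero F }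

module _ {F : Frag k X} {h : X → Y ⊎ ⊤} {g : Z → Y} {G : Frag k Z} where

  private
    ρ : Q F ⊎ X → (Q F ⊎ Q G) ⊎ Y
    ρ = redirect inj₁ (inj₂ (entry G)) h

  run-bindʳ : ∀ {q ts z ts' t} → Run G q ts z ts' t → Run (bindᶠ F h g G) (inj₂ q) ts (g z) ts' t
  run-bindʳ (exit e)   = exit (cong (map₁ (map⊎ inj₂ g)) e)
  run-bindʳ (next e r) = next (cong (map₁ (map⊎ inj₂ g)) e) (run-bindʳ r)

  run-bind-exit : ∀ {q ts x y ts' t} → Run F q ts x ts' t → h x ≡ inj₁ y →
                  Run (bindᶠ F h g G) (inj₁ q) ts y ts' t
  run-bind-exit (exit e)   hx =
    exit (trans (cong (map₁ ρ) e) (cong (λ z → [ inj₂ , (λ _ → inj₁ (inj₂ (entry G))) ]′ z , _) hx))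
  run-bind-exit (next e r) hx = next (cong (map₁ ρ) e) (run-bind-exit r hx)

  -- The exit transition of `F` becomes the transition into `G`, so joining costs no step of its own
  -- and the times add exactly.
  run-bind-next : ∀ {q ts x ts' t z ts'' t'} → Run F q ts x ts' t → h x ≡ inj₂ tt →
                  Run G (entry G) ts' z ts'' t' →
                  Run (bindᶠ F h g G) (inj₁ q) ts (g z) ts'' (t + t')
  run-bind-next (exit e)   hx s =
    next (trans (cong (map₁ ρ) e) (cong (λ z → [ inj₂ , (λ _ → inj₁ (inj₂ (entry G))) ]′ z , _) hx))
         (run-bindʳ s)
  run-bind-next (next e r) hx s = next (cong (map₁ ρ) e) (run-bind-next r hx s)

module _ {F : Frag k X} {h : X → Y ⊎ ⊤} where

  private
    ρ : Q F ⊎ X → Q F ⊎ Y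
    ρ = redirect id (entry F) h

  run-loop-exit : ∀ {q ts x y ts' t} → Run F q ts x ts' t → h x ≡ inj₁ y →
                  Run (loopᶠ F h) q ts y ts' t
  run-loop-exit (exit e)   hx =
    exit (trans (cong (map₁ ρ) e) (cong (λ z → [ inj₂ , (λ _ → inj₁ (entry F)) ]′ z , _) hx))
  run-loop-exit (next e r) hx = next (cong (map₁ ρ) e) (run-loop-exit r hx)

  run-loop-next : ∀ {q ts x ts' t y ts'' t'} → Run F q ts x ts' t → h x ≡ inj₂ tt →
                  Run (loopᶠ F h) (entry F) ts' y ts'' t' →
                  Run (loopᶠ F h) q ts y ts'' (t + t')
  run-loop-next (exit e)   hx s =
    next (trans (cong (map₁ ρ) e) (cong (λ z → [ inj₂ , (λ _ → inj₁ (entry F)) ]′ z , _) hx)) s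
  run-loop-next (next e r) hx s = next (cong (map₁ ρ) e) (run-loop-next r hx s)

act-stay : (ts : Vec Tape k) → act (heads ts) (replicate k stay) ts ≡ ts
act-stay []       = refl
act-stay (t ∷ ts) = cong (t ∷_) (act-stay ts)

act-at : ∀ (i : Fin k) w m ts →
         act (heads ts [ i ]≔ w) (replicate k stay [ i ]≔ m) ts ≡ updateAt ts i (writeMove w m)
act-at zero    w m (t ∷ ts) = cong (writeMove w m t ∷_) (act-stay ts)
act-at (suc i) w m (t ∷ ts) = cong (t ∷_) (act-at i w m ts)

run-atom : ∀ {g : Sym → X × Sym × Move} {i : Fin k} {x w m} ts →
           g (Tape.hd (lookup ts i)) ≡ (x , w , m) →
           Run (atomᶠ g i) tt ts x (updateAt ts i (writeMove w m)) 1
run-atom {g = g} {i} {x} {w} {m} ts e =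
  subst (λ ts' → Run (atomᶠ g i) tt ts x ts' 1) (act-at i w m ts)
    (exit (cong (λ (x , w , m) → inj₂ x , heads ts [ i ]≔ w , replicate _ stay [ i ]≔ m)
                (trans (cong g (lookup-map i Tape.hd ts)) e)))

-- Fragments as Turing machines

machine : Frag (suc k) Out → TM
machine {k} F = record
  { tapes = k ; states = #Q F ; δ = λ i v → map₁ (map⊎ (index F) id) (δ F (state F i) v) }

iter-machine : ∀ (F : Frag (suc k) Out) {q ts o ts' t} → Run F q ts o ts' t →
               ∀ i → state F i ≡ q → iter (machine F) t (running i ts) ≡ halted o
iter-machine F (exit e)          i refl rewrite e = refl
iter-machine F (next {q' = q'} e r) i refl rewrite e = iter-machine F r (index F q') (state-index F q')

run-machine : ∀ (F : Frag (suc k) Out) {x o ts' t} →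
              Run F (entry F) (initTapes (machine F) x) o ts' t → run (machine F) x t ≡ halted o
run-machine F r = iter-machine F r zero (state-zero F)

iter-halted : ∀ M t {o} → iter M t (halted o) ≡ halted o
iter-halted M zero    = refl
iter-halted M (suc t) = iter-halted M t

iter-+ : ∀ M s t {c o} → iter M s c ≡ halted o → iter M (s + t) c ≡ halted o
iter-+ M zero    t refl = iter-halted M t
iter-+ M (suc s) t e    = iter-+ M s t e

run-mono : ∀ M x {s t o} → s ≤ t → run M x s ≡ halted o → run M x t ≡ halted o
run-mono M x {s} {t} {o} s≤t e = subst (λ u → run M x u ≡ halted o) (m+[n∸m]≡n s≤t) (iter-+ M s (t ∸ s) e)

halted-injective : ∀ {M o o'} → halted {M} o ≡ halted o' → o ≡ o'
halted-injective refl = refl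

output-unique : ∀ M x {s t o o'} → run M x s ≡ halted o → run M x t ≡ halted o' → o ≡ o'
output-unique M x {s} {t} e e' = halted-injective
  (trans (sym (run-mono M x (m≤m+n s t) e)) (run-mono M x (m≤n+m t s) e'))

onLastTapes : ∀ {A : Set} → Vec Sym 5 → A × Vec Sym k × Vec Move k → A × Vec Sym (5 + k) × Vec Move (5 + k)
onLastTapes v (a , ws , ms) = a , v ++ᵛ ws , replicate 5 stay ++ᵛ ms

-- The first five tapes must survive the run of `M`: the input kept there is needed again when `M`
-- gives no answer.
embed : (M : TM) → Frag (5 + suc (TM.tapes M)) Out
embed M = record
  { Q = Fin (suc (TM.states M)) ; entry = zero
  ; δ = λ { q (a ∷ b ∷ c ∷ d ∷ e ∷ v) → onLastTapes (a ∷ b ∷ c ∷ d ∷ e ∷ []) (TM.δ M q v) }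
  ; #Q = TM.states M ; index = id ; state = id ; state-index = λ _ → refl ; state-zero = refl }

run-embed : ∀ (M : TM) {a b c d e o} t q ts → iter M t (running q ts) ≡ halted o →
            ∃[ ts' ] ∃[ s ] s ≤ t × Run (embed M) q (a ∷ b ∷ c ∷ d ∷ e ∷ ts) o (a ∷ b ∷ c ∷ d ∷ e ∷ ts') s
run-embed M {a} {b} {c} {d} {e} (suc t) q ts eq with TM.δ M q (heads ts) in δq
... | inj₂ o , ws , ms with refl ← trans (sym (iter-halted M t)) eq =
  act ws ms ts , 1 , s≤s z≤n , exit {ws = heads (a ∷ b ∷ c ∷ d ∷ e ∷ []) ++ᵛ ws} {ms = replicate 5 stay ++ᵛ ms}
    (cong (onLastTapes (heads (a ∷ b ∷ c ∷ d ∷ e ∷ []))) δq)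
... | inj₁ q' , ws , ms with run-embed M t q' (act ws ms ts) eq
...   | ts' , s , s≤t , r =
  ts' , suc s , s≤s s≤t , next {ws = heads (a ∷ b ∷ c ∷ d ∷ e ∷ []) ++ᵛ ws} {ms = replicate 5 stay ++ᵛ ms}
    (cong (onLastTapes (heads (a ∷ b ∷ c ∷ d ∷ e ∷ []))) δq) r

-- Stacks

data Cells : List Bool → List Sym → Set where
  []     : Cells [] []
  blank∷ : ∀ {r} → Cells [] r → Cells [] (blank ∷ r)
  bit∷   : ∀ {b s r} → Cells s r → Cells (b ∷ s) (bit b ∷ r)

-- The head stands on the top of the stack, everything else is blank.
Stack : List Bool → Tape → Set
Stack s (tape l h r) = Cells [] l × Cells s (h ∷ r)

-- The remaining tapes are tracked exactly and not up to blanks, because an arbitrary machine is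
-- started on them later.
Stacks : Vec (List Bool) n → Vec Tape r → Vec Tape (n + r) → Set
Stacks []       us ts       = ts ≡ us
Stacks (s ∷ ss) us (t ∷ ts) = Stack s t × Stacks ss us ts

stacks-lookup : ∀ {ss : Vec (List Bool) n} {us : Vec Tape r} {ts} i →
                Stacks ss us ts → Stack (lookup ss i) (lookup ts (i ↑ˡ r))
stacks-lookup {ss = s ∷ ss} {ts = t ∷ ts} zero    (p , ps) = p
stacks-lookup {ss = s ∷ ss} {ts = t ∷ ts} (suc i) (p , ps) = stacks-lookup i ps

stacks-update : ∀ {ss : Vec (List Bool) n} {us : Vec Tape r} {ts} {f g} i → Stacks ss us ts →
                Stack (f (lookup ss i)) (g (lookup ts (i ↑ˡ r))) →
                Stacks (updateAt ss i f) us (updateAt ts (i ↑ˡ r) g)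
stacks-update {ss = s ∷ ss} {ts = t ∷ ts} zero    (p , ps) q = q , ps
stacks-update {ss = s ∷ ss} {ts = t ∷ ts} (suc i) (p , ps) q = p , stacks-update i ps q

-- Programs on five stacks and their running times

data Prog (k : ℕ) : Set → Set₁ where
  atom : (Sym → X × Sym × Move) → Fin k → Prog k X
  bind : Prog k X → (X → Y ⊎ ⊤) → (Z → Y) → Prog k Z → Prog k Y
  loop : Prog k X → (X → Y ⊎ ⊤) → Prog k Y

⟦_⟧ : Prog k X → Frag k X
⟦ atom g i ⟧     = atomᶠ g i
⟦ bind F h g G ⟧ = bindᶠ ⟦ F ⟧ h g ⟦ G ⟧
⟦ loop F h ⟧     = loopᶠ ⟦ F ⟧ h

-- Only an upper bound `c` on the time is recorded. Ranging over all tapes that represent the stacks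
-- hides the blank padding left by earlier programs.
record Steps (F : Prog (5 + r) X) (us : Vec Tape r) (s : Vec (List Bool) 5) (x : X)
             (us' : Vec Tape r) (s' : Vec (List Bool) 5) (c : ℕ) : Set where
  no-eta-equality
  constructor steps
  field
    runs : ∀ ts → Stacks s us ts →
           ∃[ ts' ] ∃[ t ] t ≤ c × Run ⟦ F ⟧ (entry ⟦ F ⟧) ts x ts' t × Stacks s' us' ts'

open Steps

Exec : Prog (5 + r) X → Vec Tape r → Vec (List Bool) 5 → X → Vec (List Bool) 5 → ℕ → Set
Exec F us s x s' c = Steps F us s x us s' c

module _ {us us' : Vec Tape r} where

  weaken : ∀ {F : Prog (5 + r) X} {s x s' c d} → c ≤ d → Steps F us s x us' s' c → Steps F us s x us' s' d
  weaken c≤d e .runs ts p with e .runs ts p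
  ... | ts' , t , t≤c , run , p' = ts' , t , ≤-trans t≤c c≤d , run , p'

  landing : ∀ {F : Prog (5 + r) X} {s x s' s'' c} → s' ≡ s'' → Steps F us s x us' s' c → Steps F us s x us' s'' c
  landing refl e = e

  starting : ∀ {F : Prog (5 + r) X} {s s' x s'' c} → s ≡ s' → Steps F us s' x us' s'' c → Steps F us s x us' s'' c
  starting refl e = e

  exec-bind-exit : ∀ {F : Prog (5 + r) X} {h : X → Y ⊎ ⊤} {g : Z → Y} {G : Prog (5 + r) Z} {s x y s' c} →
                   Steps F us s x us' s' c → h x ≡ inj₁ y → Steps (bind F h g G) us s y us' s' c
  exec-bind-exit e hx .runs ts p with e .runs ts p
  ... | ts' , t , t≤c , run , p' = ts' , t , t≤c , run-bind-exit run hx , p'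

  exec-loop-exit : ∀ {F : Prog (5 + r) X} {h : X → Y ⊎ ⊤} {s x y s' c} →
                   Steps F us s x us' s' c → h x ≡ inj₁ y → Steps (loop F h) us s y us' s' c
  exec-loop-exit e hx .runs ts p with e .runs ts p
  ... | ts' , t , t≤c , run , p' = ts' , t , t≤c , run-loop-exit run hx , p'

module _ {us us' us'' : Vec Tape r} where

  module _ {F : Prog (5 + r) X} {h : X → Y ⊎ ⊤} {g : Z → Y} {G : Prog (5 + r) Z} where

    exec-bind-next : ∀ {s x s' c z s'' d} → Steps F us s x us' s' c → h x ≡ inj₂ tt →
                     Steps G us' s' z us'' s'' d → Steps (bind F h g G) us s (g z) us'' s'' (c + d)
    exec-bind-next e hx e' .runs ts p with e .runs ts p
    ... | ts' , t , t≤c , run , p' with e' .runs ts' p'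
    ...   | ts'' , t' , t'≤d , run' , p'' =
      ts'' , t + t' , +-mono-≤ t≤c t'≤d , run-bind-next run hx run' , p''

  module _ {F : Prog (5 + r) X} {h : X → Y ⊎ ⊤} where

    exec-loop-next : ∀ {s x s' c y s'' d} → Steps F us s x us' s' c → h x ≡ inj₂ tt →
                     Steps (loop F h) us' s' y us'' s'' d → Steps (loop F h) us s y us'' s'' (c + d)
    exec-loop-next e hx e' .runs ts p with e .runs ts p
    ... | ts' , t , t≤c , run , p' with e' .runs ts' p'
    ...   | ts'' , t' , t'≤d , run' , p'' =
      ts'' , t + t' , +-mono-≤ t≤c t'≤d , run-loop-next run hx run' , p''

infixr 4 _⨾_
_⨾_ : Prog k X → Prog k Y → Prog k Y
F ⨾ G = bind F (λ _ → inj₂ tt) id G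

firstArm : Y ⊎ Bool → (Y ⊎ ⊤) ⊎ ⊤
firstArm (inj₁ y)     = inj₁ (inj₁ y)
firstArm (inj₂ true)  = inj₂ tt
firstArm (inj₂ false) = inj₁ (inj₂ tt)

-- A `bind` has a single continuation, so two are nested: the inner one continues with `G` on
-- `true`, and on `false` it exits with `inj₂ tt`, which the outer one takes to `H`.
choose : Prog k X → (X → Y ⊎ Bool) → Prog k Y → Prog k Y → Prog k Y
choose F h G H = bind (bind F (firstArm ∘ h) inj₁ G) id id H

repeat : Prog k Bool → Prog k ⊤
repeat F = loop F λ b → if b then inj₂ tt else inj₁ tt

infixr 4 _⨟_
_⨟_ : ∀ {us us' us'' : Vec Tape r} {F : Prog (5 + r) X} {G : Prog (5 + r) Y} {s x s' c y s'' d} →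
      Steps F us s x us' s' c → Steps G us' s' y us'' s'' d → Steps (F ⨾ G) us s y us'' s'' (c + d)
e ⨟ e' = exec-bind-next e refl e'

exec-choose-exit : ∀ {us us' : Vec Tape r} {F : Prog (5 + r) X} {h : X → Y ⊎ Bool} {G H : Prog (5 + r) Y} {s x y s' c} →
                   Steps F us s x us' s' c → h x ≡ inj₁ y → Steps (choose F h G H) us s y us' s' c
exec-choose-exit e hx = exec-bind-exit (exec-bind-exit e (cong firstArm hx)) refl

module _ {us us' us'' : Vec Tape r} {F : Prog (5 + r) X} {h : X → Y ⊎ Bool} {G H : Prog (5 + r) Y} where

  exec-choose-true : ∀ {s x s' c y s'' d} → Steps F us s x us' s' c → h x ≡ inj₂ true →
                     Steps G us' s' y us'' s'' d → Steps (choose F h G H) us s y us'' s'' (c + d)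
  exec-choose-true e hx e' = exec-bind-exit (exec-bind-next e (cong firstArm hx) e') refl

  exec-choose-false : ∀ {s x s' c y s'' d} → Steps F us s x us' s' c → h x ≡ inj₂ false →
                      Steps H us' s' y us'' s'' d → Steps (choose F h G H) us s y us'' s'' (c + d)
  exec-choose-false e hx e' = exec-bind-next (exec-bind-exit e (cong firstArm hx)) refl e'

popAct : Sym → Maybe Bool × Sym × Move
popAct blank   = nothing , blank , stay
popAct (bit b) = just b , blank , right

pop : Fin 5 → Prog (5 + r) (Maybe Bool)
pop {r = r} i = atom popAct (i ↑ˡ r)

-- Pushing on an empty stack does not move the head.
makeRoom : Sym → ⊤ × Sym × Move
makeRoom blank   = tt , blank , stay
makeRoom (bit b) = tt , bit b , left

pushTape : Bool → Tape → Tape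
pushTape b t = let (_ , w , m) = makeRoom (Tape.hd t) in writeMove (bit b) stay (writeMove w m t)

pushAt : Bool → Fin k → Prog k ⊤
pushAt b i = atom makeRoom i ⨾ atom (λ _ → tt , bit b , stay) i

run-pushAt : ∀ b (i : Fin k) ts → Run ⟦ pushAt b i ⟧ (entry ⟦ pushAt b i ⟧) ts tt (updateAt ts i (pushTape b)) 2
run-pushAt b i ts = subst (λ ts' → Run ⟦ pushAt b i ⟧ (inj₁ tt) ts tt ts' 2)
  (updateAt-updateAt-local i ts refl)
  (run-bind-next {h = λ _ → inj₂ tt} {g = id} (run-atom {g = makeRoom} {i = i} ts refl) refl
                 (run-atom {g = λ _ → tt , bit b , stay} {i = i} _ refl))

push : Bool → Fin 5 → Prog (5 + r) ⊤
push {r = r} b i = pushAt b (i ↑ˡ r)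

pop-stack : ∀ {b s} t → Stack (b ∷ s) t →
            popAct (Tape.hd t) ≡ (just b , blank , right) × Stack s (writeMove blank right t)
pop-stack (tape l _ [])            (p , bit∷ [])         = refl , blank∷ p , blank∷ []
pop-stack (tape l _ (blank ∷ r))   (p , bit∷ (blank∷ q)) = refl , blank∷ p , blank∷ q
pop-stack (tape l _ (bit _ ∷ r))   (p , bit∷ (bit∷ q))   = refl , blank∷ p , bit∷ q

pop-empty : ∀ t → Stack [] t →
            popAct (Tape.hd t) ≡ (nothing , blank , stay) × Stack [] (writeMove blank stay t)
pop-empty (tape l _ r) (p , blank∷ q) = refl , p , blank∷ q

push-stack : ∀ {s} b t → Stack s t → Stack (b ∷ s) (pushTape b t)
push-stack b (tape l _ r)           (p , blank∷ q)        = p , bit∷ q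
push-stack b (tape [] _ r)          ([] , bit∷ q)         = [] , bit∷ (bit∷ q)
push-stack b (tape (blank ∷ l) _ r) (blank∷ p , bit∷ q)   = p , bit∷ (bit∷ q)

module _ {us : Vec Tape r} where

  exec-pop : ∀ (i : Fin 5) {s b l} → lookup s i ≡ b ∷ l → Exec (pop i) us s (just b) (s [ i ]≔ l) 1
  exec-pop i {s} {b} {l} e .runs ts p with pop-stack (lookup ts (i ↑ˡ r)) (subst (λ z → Stack z _) e (stacks-lookup i p))
  ... | eq , q = _ , 1 , ≤-refl , run-atom {g = popAct} ts eq , stacks-update i p q

  exec-pop-empty : ∀ (i : Fin 5) {s} → lookup s i ≡ [] → Exec (pop i) us s nothing (s [ i ]≔ []) 1
  exec-pop-empty i {s} e .runs ts p with pop-empty (lookup ts (i ↑ˡ r)) (subst (λ z → Stack z _) e (stacks-lookup i p))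
  ... | eq , q = _ , 1 , ≤-refl , run-atom {g = popAct} ts eq , stacks-update i p q

  exec-push : ∀ b (i : Fin 5) {s} → Exec (push b i) us s tt (updateAt s i (b ∷_)) 2
  exec-push b i {s} .runs ts p =
    _ , 2 , ≤-refl , run-pushAt b (i ↑ˡ r) ts , stacks-update i p (push-stack b _ (stacks-lookup i p))

stacks-extra : ∀ {ss : Vec (List Bool) n} {us : Vec Tape r} {ts g} j → Stacks ss us ts →
               Stacks ss (updateAt us j g) (updateAt ts (n ↑ʳ j) g)
stacks-extra {ss = []}                   j refl     = refl
stacks-extra {ss = s ∷ ss} {ts = t ∷ ts} j (p , ps) = p , stacks-extra j ps

exec-pushAt : ∀ b (j : Fin r) {us : Vec Tape r} {s} →
              Steps (pushAt b (5 ↑ʳ j)) us s tt (updateAt us j (pushTape b)) s 2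
exec-pushAt b j .runs ts p = _ , 2 , ≤-refl , run-pushAt b (5 ↑ʳ j) ts , stacks-extra j p

≤-slack : ∀ {m n} d → m + d ≡ n → m ≤ n
≤-slack {m} d refl = m≤m+n m d

-- Trees

infixr 5 _·_
data D : Set where
  leaf : D
  _·_  : D → D → D

hd tl : D → D
hd leaf    = leaf
hd (a · b) = a
tl leaf    = leaf
tl (a · b) = b

⌊_⌋ : D → ℕ
⌊ leaf ⌋  = 1
⌊ a · b ⌋ = suc (⌊ a ⌋ + ⌊ b ⌋)

ser : D → List Bool
ser leaf    = false ∷ []
ser (a · b) = true ∷ ser a ++ ser b

length-ser : ∀ t → length (ser t) ≡ ⌊ t ⌋
length-ser leaf    = refl
length-ser (a · b) = cong suc (trans (length-++ (ser a)) (cong₂ _+_ (length-ser a) (length-ser b)))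

length-reversed : ∀ t → length (ser t ʳ++ []) ≡ ⌊ t ⌋
length-reversed t = trans (length-ʳ++ (ser t)) (trans (+-identityʳ _) (length-ser t))

⌊⌋-pos : ∀ t → 1 ≤ ⌊ t ⌋
⌊⌋-pos leaf    = s≤s z≤n
⌊⌋-pos (a · b) = s≤s z≤n

ending : Maybe Bool → Bool ⊎ Bool
ending nothing  = inj₁ false
ending (just b) = inj₂ b

nonempty? : Maybe Bool → Bool ⊎ ⊤
nonempty? nothing  = inj₁ false
nonempty? (just _) = inj₂ tt

-- The loop never repeats; it only replaces the exit value.
return : X → Prog k Y → Prog k X
return x F = loop F (λ _ → inj₁ x)

drain : Fin 5 → (Bool → Prog (5 + r) ⊤) → Prog (5 + r) ⊤
drain i G = repeat (choose (pop i) ending (return true (G true)) (return true (G false)))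

module _ {S : Set} (υ : S → Vec Tape r) (σ : List Bool → S → Vec (List Bool) 5) (i : Fin 5)
         (get : ∀ l s → lookup (σ l s) i ≡ l) (set : ∀ l l' s → σ l s [ i ]≔ l' ≡ σ l' s) where

  -- The effect on the other tapes is a left fold over the popped bits: `S` is the accumulator,
  -- which `σ` and `υ` display on the stacks and on the extra tapes.
  exec-drain : ∀ {G f c} → (∀ b l s → Steps (G b) (υ s) (σ l s) tt (υ (f s b)) (σ l (f s b)) c) →
               ∀ l s → Steps (drain i G) (υ s) (σ l s) tt (υ (foldl f s l)) (σ [] (foldl f s l)) (suc (suc c * length l))
  exec-drain {G} {f} {c} e [] s = weaken (s≤s z≤n)
    (exec-loop-exit (exec-choose-exit (landing (set [] [] s) (exec-pop-empty i (get [] s))) refl) refl)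
  exec-drain {G} {f} {c} e (b ∷ l) s = weaken (≤-reflexive (lemma c (length l)))
    (exec-loop-next (body b) refl (exec-drain e l (f s b)))
    where
    top : ∀ b → Exec (pop i) (υ s) (σ (b ∷ l) s) (just b) (σ l s) 1
    top b = landing (set (b ∷ l) l s) (exec-pop i (get (b ∷ l) s))
    body : ∀ b → Steps (choose (pop i) ending (return true (G true)) (return true (G false))) (υ s)
                       (σ (b ∷ l) s) true (υ (f s b)) (σ l (f s b)) (suc c)
    body true  = exec-choose-true (top true) refl (exec-loop-exit (e true l s) refl)
    body false = exec-choose-false (top false) refl (exec-loop-exit (e false l s) refl)
    lemma : ∀ c n → suc c + suc (suc c * n) ≡ suc (suc c * suc n)
    lemma = solve-∀

-- Pouring reverses. Trees are taken off in reversed form, so that pouring them back restores the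
-- reading order.
pour : Fin 5 → Fin 5 → Prog (5 + r) ⊤
pour i j = drain i (λ b → push b j)

-- Tape 0 holds the operands, tape 1 counts in unary the subtrees still to be
-- read, and tapes 2, 3 and 4 are scratch space.
takeBody : Fin 3 → Prog (5 + r) Bool
takeBody j = bind (pop 1F) nonempty? id
  (choose (pop 0F) ending
    (return true (push true (suc (suc j)) ⨾ push true 1F ⨾ push true 1F))
    (return true (push false (suc (suc j)))))

take : Fin 3 → Prog (5 + r) ⊤
take j = push true 1F ⨾ repeat (takeBody j)

idle : List Bool → Vec (List Bool) 5
idle m = m ∷ [] ∷ [] ∷ [] ∷ [] ∷ []

untilEmpty : Maybe Bool → ⊤ ⊎ ⊤
untilEmpty nothing  = inj₁ tt
untilEmpty (just _) = inj₂ tt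

clear : Fin 5 → Prog (5 + r) ⊤
clear i = loop (pop i) untilEmpty

module _ {us : Vec Tape r} where

  module _ (j : Fin 3) (aux : List Bool → Vec (List Bool) 3)
           (upd : ∀ d f → updateAt (aux d) j f ≡ aux (f d)) where

    private
      takeBody-node : ∀ m d p → Exec (takeBody j) us ((true ∷ m) ∷ (true ∷ p) ∷ aux d) true
                                       (m ∷ (true ∷ true ∷ p) ∷ aux (true ∷ d)) 8
      takeBody-node m d p = landing
        (cong (λ v → m ∷ (true ∷ true ∷ p) ∷ v) (upd d (true ∷_)))
        (exec-bind-next (exec-pop 1F refl) refl (exec-choose-true (exec-pop 0F refl) refl
          (exec-loop-exit (exec-push true (suc (suc j)) ⨟ exec-push true 1F ⨟ exec-push true 1F) refl)))

      takeBody-leaf : ∀ m d p → Exec (takeBody j) us ((false ∷ m) ∷ (true ∷ p) ∷ aux d) true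
                                       (m ∷ p ∷ aux (false ∷ d)) 4
      takeBody-leaf m d p = landing
        (cong (λ v → m ∷ p ∷ v) (upd d (false ∷_)))
        (exec-bind-next (exec-pop 1F refl) refl (exec-choose-false (exec-pop 0F refl) refl
          (exec-loop-exit (exec-push false (suc (suc j))) refl)))

    -- The continuation-passing form lets the two subtrees be read one after the other.
    exec-takes : ∀ t {m d p s c} → Exec (repeat (takeBody j)) us (m ∷ p ∷ aux (ser t ʳ++ d)) tt s c →
                 Exec (repeat (takeBody j)) us ((ser t ++ m) ∷ (true ∷ p) ∷ aux d) tt s (8 * ⌊ t ⌋ + c)
    exec-takes leaf    {m} {d} {p} e = weaken (+-monoˡ-≤ _ (s≤s (s≤s (s≤s (s≤s z≤n)))))
      (exec-loop-next (takeBody-leaf m d p) refl e)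
    exec-takes (a · b) {m} {d} {p} {s} {c} e = subst
      (λ l → Exec (repeat (takeBody j)) us ((true ∷ l) ∷ (true ∷ p) ∷ aux d) tt s (8 * ⌊ a · b ⌋ + c))
      (sym (++-assoc (ser a) (ser b) m))
      (weaken (≤-reflexive (lemma ⌊ a ⌋ ⌊ b ⌋ c))
        (exec-loop-next (takeBody-node _ d p) refl
          (exec-takes a (exec-takes b
            (subst (λ l → Exec (repeat (takeBody j)) us (m ∷ p ∷ aux l) tt s c) (++-ʳ++ (ser a) {ser b}) e)))))
      where
      lemma : ∀ a b c → 8 + (8 * a + (8 * b + c)) ≡ 8 * suc (a + b) + c
      lemma = solve-∀

    exec-take : ∀ t m d → Exec (take j) us ((ser t ++ m) ∷ [] ∷ aux d) tt
                               (m ∷ [] ∷ aux (ser t ʳ++ d)) (2 + (8 * ⌊ t ⌋ + 1))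
    exec-take t m d = exec-push true 1F ⨟ exec-takes t
      (exec-loop-exit (exec-bind-exit (exec-pop-empty 1F refl) refl) refl)

  exec-clear : ∀ (i : Fin 5) (σ : List Bool → Vec (List Bool) 5) → (∀ l → lookup (σ l) i ≡ l) →
               (∀ l l' → σ l [ i ]≔ l' ≡ σ l') → ∀ l → Exec (clear i) us (σ l) tt (σ []) (suc (length l))
  exec-clear i σ get set [] = exec-loop-exit {h = untilEmpty}
    (landing (set [] []) (exec-pop-empty i (get []))) refl
  exec-clear i σ get set (b ∷ l) = exec-loop-next {h = untilEmpty}
    (landing (set (b ∷ l) l) (exec-pop i (get (b ∷ l))))
    refl (exec-clear i σ get set l)

  exec-untake : ∀ (i : Fin 3) (aux : List Bool → Vec (List Bool) 3) → (∀ l → lookup (aux l) i ≡ l) →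
                (∀ l l' → aux l [ i ]≔ l' ≡ aux l') → ∀ t m →
                Exec (pour (suc (suc i)) 0F) us (m ∷ [] ∷ aux (ser t ʳ++ [])) tt
                     ((ser t ++ m) ∷ [] ∷ aux []) (suc (3 * ⌊ t ⌋))
  exec-untake i aux get set t m = subst₂
    (λ l c → Exec (pour (suc (suc i)) 0F) us (m ∷ [] ∷ aux (ser t ʳ++ [])) tt (l ∷ [] ∷ aux []) (suc (3 * c)))
    (ʳ++-ʳ++ (ser t)) (length-reversed t)
    (exec-drain (λ _ → us) (λ l m → m ∷ [] ∷ aux l) (suc (suc i)) (λ l _ → get l)
      (λ l l' m → cong (λ v → m ∷ [] ∷ v) (set l l')) (λ b l m → exec-push b 0F) (ser t ʳ++ []) m)

-- Operations on the trees on top of tape 0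

discard : Prog (5 + r) ⊤
discard = take 1F ⨾ clear 3F

-- The copy on tape 3 is in reading order and would come back reversed, hence the detour over tape
-- 4.
dup : Prog (5 + r) ⊤
dup = take 0F ⨾ drain 2F (λ b → push b 0F ⨾ push b 3F) ⨾ pour 3F 4F ⨾ pour 4F 0F

swap : Prog (5 + r) ⊤
swap = take 0F ⨾ take 1F ⨾ pour 2F 0F ⨾ pour 3F 0F

swap₂₃ : Prog (5 + r) ⊤
swap₂₃ = take 2F ⨾ swap ⨾ pour 4F 0F

module _ {us : Vec Tape r} where

  exec-discard : ∀ t m a → Exec discard us ((ser t ++ m) ∷ [] ∷ a ∷ [] ∷ [] ∷ []) tt
                                           (m ∷ [] ∷ a ∷ [] ∷ [] ∷ []) (9 * ⌊ t ⌋ + 4)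
  exec-discard t m a = weaken (≤-reflexive (lemma ⌊ t ⌋ (length-reversed t)))
    (exec-take 1F (λ d → a ∷ d ∷ [] ∷ []) (λ _ _ → refl) t m [] ⨟
     exec-clear 3F (λ l → m ∷ [] ∷ a ∷ l ∷ [] ∷ []) (λ _ → refl) (λ _ _ → refl) (ser t ʳ++ []))
    where
    lemma : ∀ n {i} → i ≡ n → 2 + (8 * n + 1) + suc i ≡ 9 * n + 4
    lemma n refl = identity n
      where
      identity : ∀ n → 2 + (8 * n + 1) + suc n ≡ 9 * n + 4
      identity = solve-∀

  exec-dup : ∀ t m → Exec dup us (idle (ser t ++ m)) tt (idle (ser t ++ ser t ++ m)) (19 * ⌊ t ⌋ + 6)
  exec-dup t m = weaken (≤-reflexive (lemma ⌊ t ⌋ (length-reversed t) (length-ser t)))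
    (exec-take 0F (λ d → d ∷ [] ∷ [] ∷ []) (λ _ _ → refl) t m [] ⨟ copy ⨟
     exec-drain (λ _ → us) (λ l c → (ser t ++ m) ∷ [] ∷ [] ∷ l ∷ c ∷ []) 3F (λ _ _ → refl) (λ _ _ _ → refl)
       (λ b l c → exec-push b 4F) (ser t) [] ⨟
     exec-untake 2F (λ d → [] ∷ [] ∷ d ∷ []) (λ _ → refl) (λ _ _ → refl) t (ser t ++ m))
    where
    both : List Bool × List Bool → Bool → List Bool × List Bool
    both (u , v) b = b ∷ u , b ∷ v
    both-fold : ∀ l u v → foldl both (u , v) l ≡ (l ʳ++ u , l ʳ++ v)
    both-fold []      u v = refl
    both-fold (b ∷ l) u v = both-fold l (b ∷ u) (b ∷ v)
    σ : List Bool → List Bool × List Bool → Vec (List Bool) 5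
    σ l (u , v) = u ∷ [] ∷ l ∷ v ∷ [] ∷ []
    copied : σ [] (foldl both (m , []) (ser t ʳ++ [])) ≡ (ser t ++ m) ∷ [] ∷ [] ∷ ser t ∷ [] ∷ []
    copied rewrite both-fold (ser t ʳ++ []) m [] | ʳ++-ʳ++ (ser t) {[]} {m} | ʳ++-ʳ++ (ser t) {[]} {[]} | ++-identityʳ (ser t) = refl
    copy : Exec (drain 2F (λ b → push b 0F ⨾ push b 3F)) us (m ∷ [] ∷ (ser t ʳ++ []) ∷ [] ∷ [] ∷ []) tt
                ((ser t ++ m) ∷ [] ∷ [] ∷ ser t ∷ [] ∷ []) (suc (5 * length (ser t ʳ++ [])))
    copy = landing copied
      (exec-drain (λ _ → us) σ 2F (λ _ _ → refl) (λ _ _ _ → refl)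
        (λ b l s → exec-push b 0F ⨟ exec-push b 3F) (ser t ʳ++ []) (m , []))
    lemma : ∀ n {i j} → i ≡ n → j ≡ n →
            2 + (8 * n + 1) + (suc (5 * i) + (suc (3 * j) + suc (3 * n))) ≡ 19 * n + 6
    lemma n refl refl = identity n
      where
      identity : ∀ n → 2 + (8 * n + 1) + (suc (5 * n) + (suc (3 * n) + suc (3 * n))) ≡ 19 * n + 6
      identity = solve-∀

  exec-swap : ∀ a b m c → Exec swap us ((ser a ++ ser b ++ m) ∷ [] ∷ [] ∷ [] ∷ c ∷ []) tt
                                       ((ser b ++ ser a ++ m) ∷ [] ∷ [] ∷ [] ∷ c ∷ []) (11 * (⌊ a ⌋ + ⌊ b ⌋) + 8)
  exec-swap a b m c = weaken (≤-reflexive (identity ⌊ a ⌋ ⌊ b ⌋))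
    (exec-take 0F (λ d → d ∷ [] ∷ c ∷ []) (λ _ _ → refl) a (ser b ++ m) [] ⨟
     exec-take 1F (λ d → (ser a ʳ++ []) ∷ d ∷ c ∷ []) (λ _ _ → refl) b m [] ⨟
     exec-untake 0F (λ d → d ∷ (ser b ʳ++ []) ∷ c ∷ []) (λ _ → refl) (λ _ _ → refl) a m ⨟
     exec-untake 1F (λ d → [] ∷ d ∷ c ∷ []) (λ _ → refl) (λ _ _ → refl) b (ser a ++ m))
    where
    identity : ∀ a b → 2 + (8 * a + 1) + (2 + (8 * b + 1) + (suc (3 * a) + suc (3 * b))) ≡ 11 * (a + b) + 8
    identity = solve-∀

  exec-swap₂₃ : ∀ a b c m → Exec swap₂₃ us (idle (ser a ++ ser b ++ ser c ++ m)) tt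
                                           (idle (ser a ++ ser c ++ ser b ++ m)) (11 * (⌊ a ⌋ + ⌊ b ⌋ + ⌊ c ⌋) + 12)
  exec-swap₂₃ a b c m = weaken (≤-reflexive (identity ⌊ a ⌋ ⌊ b ⌋ ⌊ c ⌋))
    (exec-take 2F (λ d → [] ∷ [] ∷ d ∷ []) (λ _ _ → refl) a (ser b ++ ser c ++ m) [] ⨟
     exec-swap b c m (ser a ʳ++ []) ⨟
     exec-untake 2F (λ d → [] ∷ [] ∷ d ∷ []) (λ _ → refl) (λ _ _ → refl) a (ser c ++ ser b ++ m))
    where
    identity : ∀ a b c → 2 + (8 * a + 1) + (11 * (b + c) + 8 + suc (3 * a)) ≡ 11 * (a + b + c) + 12
    identity = solve-∀

-- Polynomial bounds

infixl 6 _⊕_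
infixl 7 _⊗_
data Poly : Set where
  var     : Poly
  con     : ℕ → Poly
  _⊕_ _⊗_ : Poly → Poly → Poly

eval : Poly → ℕ → ℕ
eval var     n = n
eval (con k) n = k
eval (p ⊕ q) n = eval p n + eval q n
eval (p ⊗ q) n = eval p n * eval q n

eval-mono : ∀ p {m n} → m ≤ n → eval p m ≤ eval p n
eval-mono var     m≤n = m≤n
eval-mono (con k) m≤n = ≤-refl
eval-mono (p ⊕ q) m≤n = +-mono-≤ (eval-mono p m≤n) (eval-mono q m≤n)
eval-mono (p ⊗ q) m≤n = *-mono-≤ (eval-mono p m≤n) (eval-mono q m≤n)

_⟨_⟩ : Poly → Poly → Poly
var     ⟨ r ⟩ = r
con k   ⟨ r ⟩ = con k
(p ⊕ q) ⟨ r ⟩ = p ⟨ r ⟩ ⊕ q ⟨ r ⟩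
(p ⊗ q) ⟨ r ⟩ = p ⟨ r ⟩ ⊗ q ⟨ r ⟩

eval-⟨⟩ : ∀ p r n → eval (p ⟨ r ⟩) n ≡ eval p (eval r n)
eval-⟨⟩ var     r n = refl
eval-⟨⟩ (con k) r n = refl
eval-⟨⟩ (p ⊕ q) r n = cong₂ _+_ (eval-⟨⟩ p r n) (eval-⟨⟩ q r n)
eval-⟨⟩ (p ⊗ q) r n = cong₂ _*_ (eval-⟨⟩ p r n) (eval-⟨⟩ q r n)

eval-at : ∀ p r {m n} → m ≤ eval r n → eval p m ≤ eval (p ⟨ r ⟩) n
eval-at p r {m} {n} m≤ = ≤-trans (eval-mono p m≤) (≤-reflexive (sym (eval-⟨⟩ p r n)))

-- Crude on purpose: degrees are added even in a sum, which avoids maxima. Only the existence of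
-- some exponent matters.
coeff degree : Poly → ℕ
coeff var      = 1
coeff (con k)  = k
coeff (p ⊕ q)  = coeff p + coeff q
coeff (p ⊗ q)  = coeff p * coeff q
degree var     = 1
degree (con k) = 0
degree (p ⊕ q) = degree p + degree q
degree (p ⊗ q) = degree p + degree q

eval-≤ : ∀ p n → 1 ≤ n → eval p n ≤ coeff p * n ^ degree p
eval-≤ var     n@(suc _) _ = ≤-reflexive (sym (trans (+-identityʳ _) (*-identityʳ n)))
eval-≤ (con k) n@(suc _) _ = ≤-reflexive (sym (*-identityʳ k))
eval-≤ (p ⊕ q) n@(suc _) h = begin
  eval p n + eval q n
    ≤⟨ +-mono-≤ (eval-≤ p n h) (eval-≤ q n h) ⟩
  coeff p * n ^ degree p + coeff q * n ^ degree q
    ≤⟨ +-mono-≤ (*-monoʳ-≤ (coeff p) (^-monoʳ-≤ n (m≤m+n (degree p) (degree q))))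
                (*-monoʳ-≤ (coeff q) (^-monoʳ-≤ n (m≤n+m (degree q) (degree p)))) ⟩
  coeff p * n ^ (degree p + degree q) + coeff q * n ^ (degree p + degree q)
    ≡⟨ *-distribʳ-+ (n ^ (degree p + degree q)) (coeff p) (coeff q) ⟨
  (coeff p + coeff q) * n ^ (degree p + degree q) ∎
  where open ≤-Reasoning
eval-≤ (p ⊗ q) n h = begin
  eval p n * eval q n
    ≤⟨ *-mono-≤ (eval-≤ p n h) (eval-≤ q n h) ⟩
  coeff p * n ^ degree p * (coeff q * n ^ degree q)
    ≡⟨ interchange (coeff p) (n ^ degree p) (coeff q) (n ^ degree q) ⟩
  coeff p * coeff q * (n ^ degree p * n ^ degree q)
    ≡⟨ cong (coeff p * coeff q *_) (^-distribˡ-+-* n (degree p) (degree q)) ⟨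
  coeff p * coeff q * n ^ (degree p + degree q) ∎
  where
  open ≤-Reasoning
  interchange : ∀ a b c d → a * b * (c * d) ≡ a * c * (b * d)
  interchange = solve-∀

-- Polynomial-time functions on trees

-- The word `m` below the argument is arbitrary, so that other trees can wait on the same stack. The
-- bound `growth` on the size of the result is what makes time bounds compose.
record PT (f : D → D) : Set₁ where
  no-eta-equality
  field
    prog        : ∀ {r} → Prog (5 + r) ⊤
    time growth : Poly
    execs       : ∀ {r} {us : Vec Tape r} t m →
                  Exec prog us (idle (ser t ++ m)) tt (idle (ser (f t) ++ m)) (eval time ⌊ t ⌋)
    bounded     : ∀ t → ⌊ f t ⌋ ≤ eval growth ⌊ t ⌋

open PT

private
  variable
    f g h : D → D

⌊hd⌋ : ∀ t → ⌊ hd t ⌋ ≤ ⌊ t ⌋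
⌊hd⌋ leaf    = ≤-refl
⌊hd⌋ (a · b) = m≤n⇒m≤1+n (m≤m+n ⌊ a ⌋ ⌊ b ⌋)

⌊tl⌋ : ∀ t → ⌊ tl t ⌋ ≤ ⌊ t ⌋
⌊tl⌋ leaf    = ≤-refl
⌊tl⌋ (a · b) = m≤n⇒m≤1+n (m≤n+m ⌊ b ⌋ ⌊ a ⌋)

isNode : Maybe Bool → Y ⊎ Bool
isNode (just b) = inj₂ b
isNode nothing  = inj₂ false

-- Every program takes at least one step, so the identity pushes a bit and removes it.
idP : PT id
idP = record
  { prog = return tt (push false 0F ⨾ pop 0F) ; time = con 3 ; growth = var
  ; execs = λ t m → exec-loop-exit (exec-push false 0F ⨟ exec-pop 0F refl) refl
  ; bounded = λ t → ≤-refl }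

leafP : PT (const leaf)
leafP = record
  { prog = discard ⨾ push false 0F ; time = con 9 ⊗ var ⊕ con 4 ⊕ con 2 ; growth = con 1
  ; execs = λ t m → exec-discard t m [] ⨟ exec-push false 0F
  ; bounded = λ t → ≤-refl }

tlP : PT tl
tlP = record
  { prog = choose (pop 0F) isNode discard (push false 0F)
  ; time = con 1 ⊕ (con 9 ⊗ var ⊕ con 4)
  ; growth = var ; execs = go ; bounded = ⌊tl⌋ }
  where
  go : ∀ {us : Vec Tape r} t m → Exec _ us (idle (ser t ++ m)) tt (idle (ser (tl t) ++ m)) (1 + (9 * ⌊ t ⌋ + 4))
  go leaf    m = weaken (s≤s (s≤s (s≤s z≤n))) (exec-choose-false (exec-pop 0F refl) refl (exec-push false 0F))
  go (a · b) m = weaken (s≤s (+-monoˡ-≤ 4 (*-monoʳ-≤ 9 (⌊hd⌋ (a · b)))))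
    (exec-choose-true (exec-pop 0F refl) refl
      (starting (cong idle (++-assoc (ser a) (ser b) m)) (exec-discard a (ser b ++ m) [])))

hdP : PT hd
hdP = record
  { prog = choose (pop 0F) isNode (take 0F ⨾ discard ⨾ pour 2F 0F) (push false 0F)
  ; time = con 1 ⊕ (con 11 ⊗ var ⊕ con 8)
  ; growth = var ; execs = go ; bounded = ⌊hd⌋ }
  where
  cost : ∀ a b → 2 + (8 * a + 1) + (9 * b + 4 + suc (3 * a)) ≤ 11 * suc (a + b) + 8
  cost a b = ≤-slack (2 * b + 11) (identity a b)
    where
    identity : ∀ a b → 2 + (8 * a + 1) + (9 * b + 4 + suc (3 * a)) + (2 * b + 11) ≡ 11 * suc (a + b) + 8
    identity = solve-∀
  go : ∀ {us : Vec Tape r} t m → Exec _ us (idle (ser t ++ m)) tt (idle (ser (hd t) ++ m)) (1 + (11 * ⌊ t ⌋ + 8))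
  go leaf    m = weaken (s≤s (s≤s (s≤s z≤n))) (exec-choose-false (exec-pop 0F refl) refl (exec-push false 0F))
  go (a · b) m = weaken (s≤s (cost ⌊ a ⌋ ⌊ b ⌋))
    (exec-choose-true (exec-pop 0F refl) refl
      (starting (cong idle (++-assoc (ser a) (ser b) m))
        (exec-take 0F (λ d → d ∷ [] ∷ [] ∷ []) (λ _ _ → refl) a (ser b ++ m) [] ⨟
         exec-discard b m (ser a ʳ++ []) ⨟
         exec-untake 0F (λ d → d ∷ [] ∷ [] ∷ []) (λ _ → refl) (λ _ _ → refl) a m)))

infixr 9 _∘P_
_∘P_ : PT g → PT f → PT (g ∘ f)
_∘P_ {f = f} G F = record
  { prog = F .prog ⨾ G .prog
  ; time = F .time ⊕ G .time ⟨ F .growth ⟩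
  ; growth = G .growth ⟨ F .growth ⟩
  ; execs = λ t m → weaken (+-monoʳ-≤ _ (eval-at (G .time) (F .growth) (F .bounded t)))
                           (F .execs t m ⨟ G .execs (f t) m)
  ; bounded = λ t → ≤-trans (G .bounded (f t)) (eval-at (G .growth) (F .growth) (F .bounded t)) }

infixr 5 _·P_
_·P_ : PT f → PT g → PT (λ t → f t · g t)
_·P_ {f = f} {g = g} F G = record
  { prog = dup ⨾ F .prog ⨾ swap ⨾ G .prog ⨾ swap ⨾ push true 0F
  ; time = con 19 ⊗ var ⊕ con 6 ⊕ (F .time ⊕ (con 11 ⊗ (F .growth ⊕ var) ⊕ con 8 ⊕
           (G .time ⊕ (con 11 ⊗ (G .growth ⊕ F .growth) ⊕ con 8 ⊕ con 2))))
  ; growth = con 1 ⊕ (F .growth ⊕ G .growth)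
  ; execs = λ t m → weaken
      (+-monoʳ-≤ (19 * ⌊ t ⌋ + 6) (+-monoʳ-≤ (eval (F .time) ⌊ t ⌋)
        (+-mono-≤ (+-monoˡ-≤ 8 (*-monoʳ-≤ 11 (+-monoˡ-≤ ⌊ t ⌋ (F .bounded t))))
          (+-monoʳ-≤ (eval (G .time) ⌊ t ⌋)
            (+-monoˡ-≤ 2 (+-monoˡ-≤ 8 (*-monoʳ-≤ 11 (+-mono-≤ (G .bounded t) (F .bounded t)))))))))
      (landing (cong (λ l → idle (true ∷ l)) (sym (++-assoc (ser (f t)) (ser (g t)) m)))
        (exec-dup t m ⨟ F .execs t (ser t ++ m) ⨟ exec-swap (f t) t m [] ⨟
         G .execs t (ser (f t) ++ m) ⨟ exec-swap (g t) (f t) m [] ⨟ exec-push true 0F))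
  ; bounded = λ t → s≤s (+-mono-≤ (F .bounded t) (G .bounded t)) }

cond : {A : Set} → D → A → A → A
cond leaf    x y = y
cond (_ · _) x y = x

-- The first bit of the test value decides. If it announces a node, the two subtrees that remain on
-- the stack have to be discarded.
condP : PT h → PT f → PT g → PT (λ t → cond (h t) (f t) (g t))
condP {h = h} {f = f} {g = g} C F G = record
  { prog = dup ⨾ C .prog ⨾ choose (pop 0F) isNode (discard ⨾ discard ⨾ F .prog) (G .prog)
  ; time = con 19 ⊗ var ⊕ con 6 ⊕ (C .time ⊕ (con 1 ⊕ (con 9 ⊗ C .growth ⊕ con 8 ⊕ (F .time ⊕ G .time))))
  ; growth = F .growth ⊕ G .growth
  ; execs = λ t m → exec-dup t m ⨟ C .execs t (ser t ++ m) ⨟ branches t m (h t) (C .bounded t)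
  ; bounded = λ t → bound t (h t) }
  where
  bound : ∀ t u → ⌊ cond u (f t) (g t) ⌋ ≤ eval (F .growth) ⌊ t ⌋ + eval (G .growth) ⌊ t ⌋
  bound t leaf    = ≤-trans (G .bounded t) (m≤n+m _ _)
  bound t (_ · _) = ≤-trans (F .bounded t) (m≤m+n _ _)
  cost : ∀ a b c x y → suc (a + b) ≤ c → 9 * a + 4 + (9 * b + 4 + x) ≤ 9 * c + 8 + (x + y)
  cost a b c x y a+b<c = ≤-trans (≤-slack (9 + y) (identity a b x y)) (+-monoˡ-≤ (x + y) (+-monoˡ-≤ 8 (*-monoʳ-≤ 9 a+b<c)))
    where
    identity : ∀ a b x y → 9 * a + 4 + (9 * b + 4 + x) + (9 + y) ≡ 9 * suc (a + b) + 8 + (x + y)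
    identity = solve-∀
  branches : ∀ {us : Vec Tape r} t m u → ⌊ u ⌋ ≤ eval (C .growth) ⌊ t ⌋ →
             Exec (choose (pop 0F) isNode (discard ⨾ discard ⨾ F .prog) (G .prog)) us
                  (idle (ser u ++ ser t ++ m)) tt (idle (ser (cond u (f t) (g t)) ++ m))
                  (1 + (9 * eval (C .growth) ⌊ t ⌋ + 8 + (eval (F .time) ⌊ t ⌋ + eval (G .time) ⌊ t ⌋)))
  branches t m leaf    u≤ = weaken (s≤s (≤-trans (m≤n+m _ (eval (F .time) ⌊ t ⌋)) (m≤n+m _ (9 * eval (C .growth) ⌊ t ⌋ + 8))))
    (exec-choose-false (exec-pop 0F refl) refl (G .execs t m))
  branches t m (a · b) u≤ = weaken (s≤s (cost ⌊ a ⌋ ⌊ b ⌋ _ _ _ u≤))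
    (exec-choose-true (exec-pop 0F refl) refl
      (starting (cong idle (++-assoc (ser a) (ser b) (ser t ++ m)))
        (exec-discard a (ser b ++ ser t ++ m) [] ⨟ exec-discard b (ser t ++ m) [] ⨟ F .execs t m)))

-- Bounded folds

foldD : (D → D) → D → D → D
foldD f leaf    s = s
foldD f (a · l) s = foldD f l (f (a · s))

-- Iterating a polynomial-time function can blow up sizes. As in Cobham's bounded recursion, one
-- bound has to hold for every intermediate state.
Bounded : (D → D) → ℕ → D → D → Set
Bounded f B leaf    s = ⌊ s ⌋ ≤ B
Bounded f B (a · l) s = ⌊ s ⌋ ≤ B × Bounded f B l (f (a · s))

bounded-now : ∀ B l s → Bounded f B l s → ⌊ s ⌋ ≤ B
bounded-now B leaf    s b       = b
bounded-now B (a · l) s (b , _) = b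

bounded-end : ∀ B l s → Bounded f B l s → ⌊ foldD f l s ⌋ ≤ B
bounded-end B leaf    s b       = b
bounded-end B (a · l) s (_ , b) = bounded-end B l _ b

moreItems : Maybe Bool → Bool ⊎ ⊤
moreItems (just true) = inj₂ tt
moreItems _           = inj₁ false

module _ (F : PT f) (G : PT g) (H : PT h) (q : Poly)
         (small : ∀ t → Bounded f (eval q ⌊ t ⌋) (g t) (h t)) where

  private
    -- The stack passes from `a`, `l`, `s` through `a · s`, `l` and `f (a · s)`, `l` to `l`,
    -- `f (a · s)`, ready for the next round.
    foldBody : Prog (5 + r) Bool
    foldBody = bind (pop 0F) moreItems (λ _ → true) (swap₂₃ ⨾ push true 0F ⨾ F .prog ⨾ swap)

    body-cost : ℕ → ℕ → ℕ
    body-cost N B = 1 + (11 * (N + N + B) + 12 + (2 + (eval (F .time) (1 + (N + B)) + (11 * (B + N) + 8))))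

    exec-foldBody : ∀ {us : Vec Tape r} {N B} a l s m → ⌊ a ⌋ ≤ N → ⌊ l ⌋ ≤ N → ⌊ s ⌋ ≤ B → ⌊ f (a · s) ⌋ ≤ B →
                    Exec foldBody us (idle (ser (a · l) ++ ser s ++ m)) true
                         (idle (ser l ++ ser (f (a · s)) ++ m)) (body-cost N B)
    exec-foldBody a l s m a≤ l≤ s≤ fs≤ = weaken
      (s≤s (+-mono-≤ (+-monoˡ-≤ 12 (*-monoʳ-≤ 11 (+-mono-≤ (+-mono-≤ a≤ l≤) s≤)))
        (s≤s (s≤s (+-mono-≤ (eval-mono (F .time) (s≤s (+-mono-≤ a≤ s≤)))
          (+-monoˡ-≤ 8 (*-monoʳ-≤ 11 (+-mono-≤ fs≤ l≤))))))))
      (exec-bind-next (exec-pop 0F refl) refl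
        (starting (cong idle (++-assoc (ser a) (ser l) (ser s ++ m)))
          (exec-swap₂₃ a l s m ⨟ exec-push true 0F ⨟
           starting (cong (λ l → idle (true ∷ l)) (sym (++-assoc (ser a) (ser s) (ser l ++ m))))
             (F .execs (a · s) (ser l ++ m)) ⨟
           exec-swap (f (a · s)) l m [])))

    exec-foldLoop : ∀ {us : Vec Tape r} {N B} l s m → ⌊ l ⌋ ≤ N → Bounded f B l s →
                    Exec (repeat foldBody) us (idle (ser l ++ ser s ++ m)) tt
                         (idle (ser (foldD f l s) ++ m)) (⌊ l ⌋ * body-cost N B + 1)
    exec-foldLoop {N = N} {B} leaf s m l≤ b = weaken (m≤n+m 1 (1 * body-cost N B)) (exec-loop-exit (exec-bind-exit (exec-pop 0F refl) refl) refl)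
    exec-foldLoop {N = N} {B} (a · l) s m al≤ (s≤ , b) = weaken (cost (body-cost N B) ⌊ a ⌋ ⌊ l ⌋)
      (exec-loop-next
        (exec-foldBody a l s m (≤-trans (⌊hd⌋ (a · l)) al≤) l≤ s≤ (bounded-now B l _ b)) refl
        (exec-foldLoop l (f (a · s)) m l≤ b))
      where
      l≤ : ⌊ l ⌋ ≤ N
      l≤ = ≤-trans (⌊tl⌋ (a · l)) al≤
      cost : ∀ K a l → K + (l * K + 1) ≤ suc (a + l) * K + 1
      cost K a l = ≤-slack (a * K) (identity K a l)
        where
        identity : ∀ K a l → K + (l * K + 1) + a * K ≡ suc (a + l) * K + 1
        identity = solve-∀

    costP : Poly
    costP = con 1 ⊕ (con 11 ⊗ (G .growth ⊕ G .growth ⊕ q) ⊕ con 12 ⊕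
              (con 2 ⊕ (F .time ⟨ con 1 ⊕ (G .growth ⊕ q) ⟩ ⊕ (con 11 ⊗ (q ⊕ G .growth) ⊕ con 8))))

    costP-eval : ∀ n → body-cost (eval (G .growth) n) (eval q n) ≡ eval costP n
    costP-eval n = cong (λ z → 1 + (11 * (N + N + B) + 12 + (2 + (z + (11 * (B + N) + 8)))))
                        (sym (eval-⟨⟩ (F .time) (con 1 ⊕ (G .growth ⊕ q)) n))
      where
      N B : ℕ
      N = eval (G .growth) n
      B = eval q n

  foldP : PT (λ t → foldD f (g t) (h t))
  foldP = record
    { prog = (G ·P H) .prog ⨾ pop 0F ⨾ repeat foldBody
    ; time = (G ·P H) .time ⊕ (con 1 ⊕ (G .growth ⊗ costP ⊕ con 1))
    ; growth = q
    ; execs = λ t m → weaken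
        (+-monoʳ-≤ (eval ((G ·P H) .time) ⌊ t ⌋)
          (s≤s (+-monoˡ-≤ 1 (*-mono-≤ (G .bounded t) (≤-reflexive (costP-eval ⌊ t ⌋))))))
        ((G ·P H) .execs t m ⨟ exec-pop 0F refl ⨟
         starting (cong idle (++-assoc (ser (g t)) (ser (h t)) m))
           (exec-foldLoop (g t) (h t) m (G .bounded t) (small t)))
    ; bounded = λ t → bounded-end _ (g t) (h t) (small t) }

-- Folds whose state grows additively

module _ (C : ℕ) (inv : D → ℕ)
         (inv-step : ∀ a s → inv (f (a · s)) ≤ inv s)
         (step-growth : ∀ a s → ⌊ f (a · s) ⌋ ≤ ⌊ s ⌋ + C * (⌊ a ⌋ + inv s)) where

  -- A step adds at most `C` times the size of its item plus `inv`, and `inv` never increases, so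
  -- the additions sum up to a polynomial. In the uses `inv` is 0 or the size of a component that
  -- the step leaves unchanged, such as the transition table.
  additive-bounded : ∀ l s {B} → ⌊ s ⌋ + C * (⌊ l ⌋ + ⌊ l ⌋ * inv s) ≤ B → Bounded f B l s
  additive-bounded leaf    s h = ≤-trans (m≤m+n _ _) h
  additive-bounded (a · l) s h = ≤-trans (m≤m+n _ _) h , additive-bounded l (f (a · s)) (≤-trans (begin
    ⌊ f (a · s) ⌋ + C * (⌊ l ⌋ + ⌊ l ⌋ * inv (f (a · s)))
      ≤⟨ +-mono-≤ (step-growth a s) (*-monoʳ-≤ C (+-monoʳ-≤ ⌊ l ⌋ (*-monoʳ-≤ ⌊ l ⌋ (inv-step a s)))) ⟩
    ⌊ s ⌋ + C * (⌊ a ⌋ + inv s) + C * (⌊ l ⌋ + ⌊ l ⌋ * inv s)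
      ≤⟨ ≤-slack (C * (1 + ⌊ a ⌋ * inv s)) (identity ⌊ s ⌋ C ⌊ a ⌋ ⌊ l ⌋ (inv s)) ⟩
    ⌊ s ⌋ + C * (⌊ a · l ⌋ + ⌊ a · l ⌋ * inv s) ∎) h)
    where
    open ≤-Reasoning
    identity : ∀ s C a l i → s + C * (a + i) + C * (l + l * i) + C * (1 + a * i) ≡ s + C * (suc (a + l) + suc (a + l) * i)
    identity = solve-∀

  additiveP : (∀ s → inv s ≤ ⌊ s ⌋) → PT f → PT g → PT h → PT (λ t → foldD f (g t) (h t))
  additiveP {g = g} {h = h} inv-≤ F G H =
    foldP F G H (H .growth ⊕ con C ⊗ (G .growth ⊕ G .growth ⊗ H .growth)) λ t →
      additive-bounded (g t) (h t) (+-mono-≤ (H .bounded t)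
        (*-monoʳ-≤ C (+-mono-≤ (G .bounded t) (*-mono-≤ (G .bounded t) (≤-trans (inv-≤ (h t)) (H .bounded t))))))

module _ (C : ℕ) (step-growth : ∀ a s → ⌊ f (a · s) ⌋ ≤ ⌊ s ⌋ + C * ⌊ a ⌋) where

  private
    step-growth₀ : ∀ a s → ⌊ f (a · s) ⌋ ≤ ⌊ s ⌋ + C * (⌊ a ⌋ + 0)
    step-growth₀ a s = subst (λ n → ⌊ f (a · s) ⌋ ≤ ⌊ s ⌋ + C * n) (sym (+-identityʳ ⌊ a ⌋)) (step-growth a s)

  linearP : PT f → PT g → PT h → PT (λ t → foldD f (g t) (h t))
  linearP = additiveP C (λ _ → 0) (λ _ _ → z≤n) step-growth₀ (λ _ → z≤n)

  linear-growth : ∀ l s → ⌊ foldD f l s ⌋ ≤ ⌊ s ⌋ + C * ⌊ l ⌋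
  linear-growth l s = bounded-end _ l s (additive-bounded C (λ _ → 0) (λ _ _ → z≤n) step-growth₀ l s
    (≤-reflexive (cong (λ n → ⌊ s ⌋ + C * n) (trans (cong (⌊ l ⌋ +_) (*-zeroʳ ⌊ l ⌋)) (+-identityʳ ⌊ l ⌋)))))

-- Universal simulation

rev : D → D
rev l = foldD id l leaf

-- The fold hands over an item together with the state: the first `tl` discards the item, the second
-- drops an element of the state.
dropD : D → D → D
dropD u d = foldD (tl ∘ tl) u d

nth : D → D → D
nth d u = hd (dropD u d)

-- A node of a decision tree is b · z · o, with the subtrees to be followed on
-- a blank, a 0 and a 1.
select : D → D
select t = let h = hd (tl (hd t)) ; node = tl t in
  cond h (cond (tl h) (tl (tl node)) (hd (tl node))) (hd node)

-- The argument is (w · m) · tapes · output, where a tape is l · h · r.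
applyAct : D → D
applyAct t =
  let w = hd (hd t) ; m = tl (hd t) ; tapes = hd (tl t) ; out = tl (tl t)
      l = hd (hd tapes) ; r = tl (tl (hd tapes)) in
  tl tapes ·
  cond m (cond (tl m) ((w · l) · (hd r · tl r)) (tl l · (hd l · (w · r)))) (l · (w · r)) · out

transition : D → D
transition t = foldD select (tl (tl t)) (nth (hd t) (hd (tl t)))

-- The argument is `table · row · tapes`. Folding over the acts moves the tapes one by one to an
-- output list, which is in reverse order at the end.
stepD : D → D
stepD t = let lf = transition t in
  hd t · (hd lf · rev (tl (foldD applyAct (tl lf) (tl (tl t) · leaf))))

-- Rows 0, 1 and 2 of a table belong to the three outputs, so the start state has row 3. Both tags
-- differ from `leaf`, which is left for the blank, for staying put and for the missing answer.
tag₀ tag₁ start : D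
tag₀ = leaf · leaf
tag₁ = leaf · leaf · leaf
start = leaf · leaf · leaf · leaf

verdict : D → D
verdict u = cond u (cond (tl u) leaf tag₁) tag₀

simD : D → D
simD t = let e = hd t ; xs = hd (tl t) ; clock = tl (tl t) in
  -- `leaf · xs` is already the encoded input tape, since a nonempty word consists of the head cell
  -- and the cells to its right. The other, blank tapes are `hd e`.
  verdict (hd (tl (foldD (stepD ∘ tl) clock (tl e · start · (leaf · xs) · hd e))))

-- Programs and growth bounds for the simulator

constP : ∀ d → PT (const d)
constP leaf    = leafP
constP (a · b) = constP a ·P constP b

cond-≤ : ∀ {n x y} c → ⌊ x ⌋ ≤ n → ⌊ y ⌋ ≤ n → ⌊ cond c x y ⌋ ≤ n
cond-≤ leaf    x≤ y≤ = y≤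
cond-≤ (_ · _) x≤ y≤ = x≤

⌊hd⌋+⌊tl⌋ : ∀ t → ⌊ hd t ⌋ + ⌊ tl t ⌋ ≤ suc ⌊ t ⌋
⌊hd⌋+⌊tl⌋ leaf    = ≤-refl
⌊hd⌋+⌊tl⌋ (a · b) = m≤n⇒m≤1+n (n≤1+n _)

⌊rev⌋ : ∀ l s → ⌊ foldD id l s ⌋ ≤ ⌊ l ⌋ + ⌊ s ⌋
⌊rev⌋ leaf    s = n≤1+n _
⌊rev⌋ (a · l) s = ≤-trans (⌊rev⌋ l (a · s)) (≤-reflexive (identity ⌊ a ⌋ ⌊ l ⌋ ⌊ s ⌋))
  where
  identity : ∀ a l s → l + suc (a + s) ≡ suc (a + l) + s
  identity = solve-∀

tl-growth : ∀ a s → ⌊ tl (tl (a · s)) ⌋ ≤ ⌊ s ⌋ + 0 * ⌊ a ⌋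
tl-growth a s = ≤-trans (⌊tl⌋ s) (m≤m+n _ _)

revP : PT rev
revP = linearP {f = id} 2 (λ a s → ≤-slack (⌊ a ⌋ ∸ 1) (lemma ⌊ a ⌋ ⌊ s ⌋ (⌊⌋-pos a))) idP idP leafP
  where
  lemma : ∀ a s → 1 ≤ a → suc (a + s) + (a ∸ 1) ≡ s + 2 * a
  lemma (suc a) s _ = identity a s
    where
    identity : ∀ a s → suc (suc a + s) + a ≡ s + 2 * suc a
    identity = solve-∀

nthP : PT (λ t → nth (hd t) (tl t))
nthP = hdP ∘P linearP {f = tl ∘ tl} 0 tl-growth (tlP ∘P tlP) tlP hdP

select-growth : ∀ a s → ⌊ select (a · s) ⌋ ≤ ⌊ s ⌋ + 0 * ⌊ a ⌋
select-growth a s = ≤-trans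
  (cond-≤ (hd (tl a)) (cond-≤ (tl (hd (tl a))) (≤-trans (⌊tl⌋ (tl s)) (⌊tl⌋ s)) (≤-trans (⌊hd⌋ (tl s)) (⌊tl⌋ s))) (⌊hd⌋ s))
  (m≤m+n _ _)

selectP : PT select
selectP = condP H (condP (tlP ∘P H) (tlP ∘P tlP ∘P tlP) (hdP ∘P tlP ∘P tlP)) (hdP ∘P tlP)
  where
  H : PT (λ t → hd (tl (hd t)))
  H = hdP ∘P tlP ∘P hdP

transitionP : PT transition
transitionP = linearP {f = select} 0 select-growth selectP
  (tlP ∘P tlP) (nthP ∘P (hdP ·P hdP ∘P tlP))

applyActP : PT applyAct
applyActP = (tlP ∘P tapes) ·P
  condP m (condP (tlP ∘P m) ((w ·P lft) ·P (hdP ∘P rgt ·P tlP ∘P rgt)) (tlP ∘P lft ·P (hdP ∘P lft ·P (w ·P rgt)))) (lft ·P (w ·P rgt)) ·P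
  (tlP ∘P tlP)
  where
  w : PT (λ t → hd (hd t))
  w = hdP ∘P hdP
  m : PT (λ t → tl (hd t))
  m = tlP ∘P hdP
  tapes : PT (λ t → hd (tl t))
  tapes = hdP ∘P tlP
  lft : PT (λ t → hd (hd (hd (tl t))))
  lft = hdP ∘P hdP ∘P tapes
  rgt : PT (λ t → tl (tl (hd (hd (tl t)))))
  rgt = tlP ∘P tlP ∘P hdP ∘P tapes

moved-growth : ∀ m w t → let l = hd t ; r = tl (tl t) in
  ⌊ cond m (cond (tl m) ((w · l) · (hd r · tl r)) (tl l · (hd l · (w · r)))) (l · (w · r)) ⌋ ≤ 5 + ⌊ w ⌋ + ⌊ t ⌋
moved-growth m w t = cond-≤ m (cond-≤ (tl m)
    (≤-trans (+-monoʳ-≤ (2 + (⌊ w ⌋ + ⌊ l ⌋)) (s≤s (⌊hd⌋+⌊tl⌋ rgt))) (≤-trans (≤-reflexive (rearrange₁ ⌊ w ⌋ ⌊ l ⌋ ⌊ rgt ⌋)) bound))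
    (≤-trans (≤-reflexive (rearrange₂ ⌊ tl l ⌋ ⌊ hd l ⌋ ⌊ w ⌋ ⌊ rgt ⌋))
      (≤-trans (+-monoˡ-≤ (3 + ⌊ w ⌋ + ⌊ rgt ⌋) (⌊hd⌋+⌊tl⌋ l)) (≤-trans (≤-reflexive (rearrange₃ ⌊ w ⌋ ⌊ l ⌋ ⌊ rgt ⌋)) bound))))
    (≤-trans (≤-slack 2 (rearrange₄ ⌊ w ⌋ ⌊ l ⌋ ⌊ rgt ⌋)) bound)
  where
  l rgt : D
  l = hd t
  rgt = tl (tl t)
  bound : 4 + ⌊ w ⌋ + (⌊ l ⌋ + ⌊ rgt ⌋) ≤ 5 + ⌊ w ⌋ + ⌊ t ⌋
  bound = ≤-trans (+-monoʳ-≤ (4 + ⌊ w ⌋) (≤-trans (+-monoʳ-≤ ⌊ l ⌋ (⌊tl⌋ (tl t))) (⌊hd⌋+⌊tl⌋ t))) (≤-reflexive (+-suc (4 + ⌊ w ⌋) ⌊ t ⌋))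
  rearrange₁ : ∀ w l r → 2 + (w + l) + suc (suc r) ≡ 4 + w + (l + r)
  rearrange₁ = solve-∀
  rearrange₂ : ∀ l' l w r → suc (l' + suc (l + suc (w + r))) ≡ l + l' + (3 + w + r)
  rearrange₂ = solve-∀
  rearrange₃ : ∀ w l r → suc l + (3 + w + r) ≡ 4 + w + (l + r)
  rearrange₃ = solve-∀
  rearrange₄ : ∀ w l r → suc (l + suc (w + r)) + 2 ≡ 4 + w + (l + r)
  rearrange₄ = solve-∀

applyAct-growth : ∀ a s → ⌊ applyAct (a · s) ⌋ ≤ ⌊ s ⌋ + 10 * ⌊ a ⌋
applyAct-growth a s = begin
  suc (⌊ tl tapes ⌋ + suc (⌊ new ⌋ + ⌊ tl s ⌋))
    ≤⟨ s≤s (+-monoʳ-≤ ⌊ tl tapes ⌋ (s≤s (+-monoˡ-≤ ⌊ tl s ⌋ (moved-growth (tl a) (hd a) (hd tapes))))) ⟩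
  suc (⌊ tl tapes ⌋ + suc (5 + ⌊ hd a ⌋ + ⌊ hd tapes ⌋ + ⌊ tl s ⌋))
    ≡⟨ rearrange₁ ⌊ tl tapes ⌋ ⌊ hd a ⌋ ⌊ hd tapes ⌋ ⌊ tl s ⌋ ⟩
  ⌊ hd tapes ⌋ + ⌊ tl tapes ⌋ + (7 + ⌊ hd a ⌋ + ⌊ tl s ⌋)
    ≤⟨ +-monoˡ-≤ (7 + ⌊ hd a ⌋ + ⌊ tl s ⌋) (⌊hd⌋+⌊tl⌋ tapes) ⟩
  suc ⌊ tapes ⌋ + (7 + ⌊ hd a ⌋ + ⌊ tl s ⌋)
    ≡⟨ rearrange₂ ⌊ tapes ⌋ ⌊ hd a ⌋ ⌊ tl s ⌋ ⟩
  ⌊ tapes ⌋ + ⌊ tl s ⌋ + (8 + ⌊ hd a ⌋)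
    ≤⟨ +-mono-≤ (⌊hd⌋+⌊tl⌋ s) (+-monoʳ-≤ 8 (⌊hd⌋ a)) ⟩
  suc ⌊ s ⌋ + (8 + ⌊ a ⌋)
    ≤⟨ +-monoʳ-≤ (suc ⌊ s ⌋) (+-monoˡ-≤ ⌊ a ⌋ (*-monoʳ-≤ 8 (⌊⌋-pos a))) ⟩
  suc ⌊ s ⌋ + (8 * ⌊ a ⌋ + ⌊ a ⌋)
    ≤⟨ lemma ⌊ s ⌋ ⌊ a ⌋ (⌊⌋-pos a) ⟩
  ⌊ s ⌋ + 10 * ⌊ a ⌋ ∎
  where
  open ≤-Reasoning
  tapes new : D
  tapes = hd s
  new = let w = hd a ; m = tl a ; l = hd (hd tapes) ; r = tl (tl (hd tapes)) in
    cond m (cond (tl m) ((w · l) · (hd r · tl r)) (tl l · (hd l · (w · r)))) (l · (w · r))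
  rearrange₁ : ∀ a b c d → suc (a + suc (5 + b + c + d)) ≡ c + a + (7 + b + d)
  rearrange₁ = solve-∀
  rearrange₂ : ∀ a b c → suc a + (7 + b + c) ≡ a + c + (8 + b)
  rearrange₂ = solve-∀
  lemma : ∀ s a → 1 ≤ a → suc s + (8 * a + a) ≤ s + 10 * a
  lemma s a 1≤a = ≤-trans (≤-reflexive (rearrange₃ s a)) (≤-trans (+-monoʳ-≤ (s + 9 * a) 1≤a) (≤-reflexive (rearrange₄ s a)))
    where
    rearrange₃ : ∀ s a → suc s + (8 * a + a) ≡ s + 9 * a + 1
    rearrange₃ = solve-∀
    rearrange₄ : ∀ s a → s + 9 * a + a ≡ s + 10 * a
    rearrange₄ = solve-∀

⌊transition⌋ : ∀ t → ⌊ transition t ⌋ ≤ ⌊ hd t ⌋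
⌊transition⌋ t = begin
  ⌊ transition t ⌋                  ≤⟨ linear-growth {f = select} 0 select-growth (tl (tl t)) _ ⟩
  ⌊ nth (hd t) (hd (tl t)) ⌋ + 0    ≡⟨ +-identityʳ _ ⟩
  ⌊ nth (hd t) (hd (tl t)) ⌋        ≤⟨ ⌊hd⌋ (dropD (hd (tl t)) (hd t)) ⟩
  ⌊ dropD (hd (tl t)) (hd t) ⌋      ≤⟨ linear-growth {f = tl ∘ tl} 0 tl-growth (hd (tl t)) (hd t) ⟩
  ⌊ hd t ⌋ + 0                      ≡⟨ +-identityʳ _ ⟩
  ⌊ hd t ⌋                          ∎
  where open ≤-Reasoning

-- The acts come from one leaf of the table, so the table bounds them whatever the tapes contain.
-- This is additive growth with the size of the table as invariant.
stepD-growth : ∀ a s → ⌊ stepD s ⌋ ≤ ⌊ s ⌋ + 12 * (⌊ a ⌋ + ⌊ hd s ⌋)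
stepD-growth a s = begin
  suc (T + suc (⌊ hd lf ⌋ + ⌊ rev (tl F) ⌋))
    ≤⟨ s≤s (+-monoʳ-≤ T (s≤s (+-mono-≤ (≤-trans (⌊hd⌋ lf) (⌊transition⌋ s)) (≤-trans (⌊rev⌋ (tl F) leaf) (+-monoˡ-≤ 1 (⌊tl⌋ F)))))) ⟩
  suc (T + suc (T + (⌊ F ⌋ + 1)))
    ≤⟨ s≤s (+-monoʳ-≤ T (s≤s (+-monoʳ-≤ T (+-monoˡ-≤ 1 F≤)))) ⟩
  suc (T + suc (T + (suc (⌊ s ⌋ + 1) + 10 * T + 1)))
    ≡⟨ rearrange₁ T ⌊ s ⌋ ⟩
  ⌊ s ⌋ + (5 + 12 * T)
    ≤⟨ +-monoʳ-≤ ⌊ s ⌋ (+-monoˡ-≤ (12 * T) 5≤12a) ⟩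
  ⌊ s ⌋ + (12 * ⌊ a ⌋ + 12 * T)
    ≡⟨ cong (⌊ s ⌋ +_) (*-distribˡ-+ 12 ⌊ a ⌋ T) ⟨
  ⌊ s ⌋ + 12 * (⌊ a ⌋ + T) ∎
  where
  open ≤-Reasoning
  T : ℕ
  T = ⌊ hd s ⌋
  5≤12a : 5 ≤ 12 * ⌊ a ⌋
  5≤12a = ≤-trans (≤-slack {5} {12} 7 refl) (*-monoʳ-≤ 12 (⌊⌋-pos a))
  lf F : D
  lf = transition s
  F = foldD applyAct (tl lf) (tl (tl s) · leaf)
  F≤ : ⌊ F ⌋ ≤ suc (⌊ s ⌋ + 1) + 10 * T
  F≤ = ≤-trans (linear-growth {f = applyAct} 10 applyAct-growth (tl lf) (tl (tl s) · leaf))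
    (+-mono-≤ (s≤s (+-monoˡ-≤ 1 (≤-trans (⌊tl⌋ (tl s)) (⌊tl⌋ s)))) (*-monoʳ-≤ 10 (≤-trans (⌊tl⌋ lf) (⌊transition⌋ s))))
  rearrange₁ : ∀ T s → suc (T + suc (T + (suc (s + 1) + 10 * T + 1))) ≡ s + (5 + 12 * T)
  rearrange₁ = solve-∀

stepP : PT stepD
stepP = hdP ·P (hdP ∘P transitionP ·P revP ∘P tlP ∘P
  linearP {f = applyAct} 10 applyAct-growth applyActP (tlP ∘P transitionP) ((tlP ∘P tlP) ·P leafP))

verdictP : PT verdict
verdictP = condP idP (condP tlP leafP (constP tag₁)) (constP tag₀)

simP : PT simD
simP = verdictP ∘P hdP ∘P tlP ∘P
  additiveP {f = stepD ∘ tl} 12 (⌊_⌋ ∘ hd) (λ _ _ → ≤-refl) stepD-growth ⌊hd⌋ (stepP ∘P tlP)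
    (tlP ∘P tlP) (tlP ∘P hdP ·P (constP start ·P ((leafP ·P hdP ∘P tlP) ·P hdP ∘P hdP)))

-- Codes of Turing machines

encSym : Sym → D
encSym blank       = leaf
encSym (bit false) = tag₀
encSym (bit true)  = tag₁

encMove : Move → D
encMove stay  = leaf
encMove left  = tag₀
encMove right = tag₁

encCells : List Sym → D
encCells []      = leaf
encCells (a ∷ l) = encSym a · encCells l

encTape : Tape → D
encTape (tape l h r) = encCells l · encSym h · encCells r

encVec : ∀ {A : Set} {k} → (A → D) → Vec A k → D
encVec f []       = leaf
encVec f (a ∷ as) = f a · encVec f as

encTapes : ∀ {k} → Vec Tape k → D
encTapes = encVec encTape

encActs : ∀ {k} → Vec Sym k → Vec Move k → D
encActs ws ms = encVec (λ (w , m) → encSym w · encMove m) (zipWith _,_ ws ms)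

encStr : Str → D
encStr (b ∷ bs) = encCells (map bit (b ∷ bs))

unary : ℕ → D
unary zero    = leaf
unary (suc n) = leaf · unary n

tabulateD : ∀ n → (Fin n → D) → D
tabulateD zero    f = leaf
tabulateD (suc n) f = f zero · tabulateD n (f ∘ suc)

-- One level of branching per tape, so that folding `select` over the tapes descends to the entry
-- for the symbols under the heads.
decision : ∀ k → (Vec Sym k → D) → D
decision zero    f = f []
decision (suc k) f =
  decision k (f ∘ (blank ∷_)) · decision k (f ∘ (bit false ∷_)) · decision k (f ∘ (bit true ∷_))

outIndex : Out → ℕ
outIndex out0 = 0
outIndex out1 = 1
outIndex out? = 2

nth-tabulate : ∀ {n} (f : Fin n → D) i → nth (tabulateD n f) (unary (toℕ i)) ≡ f i
nth-tabulate f zero    = refl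
nth-tabulate f (suc i) = nth-tabulate (f ∘ suc) i

walk-decision : ∀ {k} (f : Vec Sym k → D) ts → foldD select (encTapes ts) (decision k f) ≡ f (heads ts)
walk-decision f []       = refl
walk-decision f (tape l blank       r ∷ ts) = walk-decision (f ∘ (blank ∷_)) ts
walk-decision f (tape l (bit false) r ∷ ts) = walk-decision (f ∘ (bit false ∷_)) ts
walk-decision f (tape l (bit true)  r ∷ ts) = walk-decision (f ∘ (bit true ∷_)) ts

-- `leaf` encodes both the empty list of cells and the blank, and it is its own `hd` and `tl`.
-- Moving past the end of the stored cells thus produces a blank without a case distinction.
applyAct-writeMove : ∀ w m t ts out → applyAct ((encSym w · encMove m) · ((encTape t · ts) · out)) ≡
                                      ts · (encTape (writeMove w m t) · out)
applyAct-writeMove w left  (tape []      h r)       ts out = refl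
applyAct-writeMove w left  (tape (a ∷ l) h r)       ts out = refl
applyAct-writeMove w right (tape l       h [])      ts out = refl
applyAct-writeMove w right (tape l       h (a ∷ r)) ts out = refl
applyAct-writeMove w stay  (tape l       h r)       ts out = refl

fold-applyAct : ∀ {k} (ws : Vec Sym k) ms ts out →
                foldD applyAct (encActs ws ms) (encTapes ts · out) ≡ leaf · foldD id (encTapes (act ws ms ts)) out
fold-applyAct []       []       []       out = refl
fold-applyAct (w ∷ ws) (m ∷ ms) (t ∷ ts) out =
  trans (cong (foldD applyAct (encActs ws ms)) (applyAct-writeMove w m t (encTapes ts) out))
        (fold-applyAct ws ms ts (encTape (writeMove w m t) · out))

rev-foldD : ∀ l a → rev (foldD id l a) ≡ foldD id a l
rev-foldD leaf    a = refl
rev-foldD (x · l) a = rev-foldD l (x · a)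

lenD : D → ℕ
lenD leaf    = 0
lenD (_ · l) = suc (lenD l)

module _ (M : TM) where
  open TM M using (tapes; states)

  encResult : (Fin (suc states) ⊎ Out) × Vec Sym (suc tapes) × Vec Move (suc tapes) → D
  encResult (inj₁ q , ws , ms) = unary (3 + toℕ q) · encActs ws ms
  encResult (inj₂ o , ws , ms) = unary (outIndex o) · leaf

  table : D
  table = (unary 0 · leaf) · (unary 1 · leaf) · (unary 2 · leaf) ·
          tabulateD (suc states) (λ q → decision (suc tapes) (encResult ∘ TM.δ M q))

  -- The simulator treats all machines alike, so the blank work tapes are supplied by the code.
  code : D
  code = encTapes (replicate tapes (tape [] blank [])) · table

  -- A halted machine has no tapes, and its row of the table has depth 0.
  encStatus : Status M → D
  encStatus (running q ts) = unary (3 + toℕ q) · encTapes ts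
  encStatus (halted o)     = unary (outIndex o) · leaf

  transition-running : ∀ q ts → transition (table · encStatus (running q ts)) ≡ encResult (TM.δ M q (heads ts))
  transition-running q ts = trans
    (cong (foldD select (encTapes ts)) (nth-tabulate (λ q → decision (suc tapes) (encResult ∘ TM.δ M q)) q))
    (walk-decision (encResult ∘ TM.δ M q) ts)

  stepD-status : ∀ c → stepD (table · encStatus c) ≡ table · encStatus (step M c)
  stepD-status (halted out0) = refl
  stepD-status (halted out1) = refl
  stepD-status (halted out?) = refl
  stepD-status (running q ts) = cong (table ·_) (trans
    (cong (λ lf → hd lf · rev (tl (foldD applyAct (tl lf) (encTapes ts · leaf)))) (transition-running q ts)) rest)
    where
    rest : (let lf = encResult (TM.δ M q (heads ts)) in hd lf · rev (tl (foldD applyAct (tl lf) (encTapes ts · leaf))))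
           ≡ encStatus (step M (running q ts))
    rest with TM.δ M q (heads ts)
    ... | inj₂ o , ws , ms = refl
    ... | inj₁ q' , ws , ms = cong (unary (3 + toℕ q') ·_)
      (trans (cong (rev ∘ tl) (fold-applyAct ws ms ts leaf)) (rev-foldD (encTapes (act ws ms ts)) leaf))

  iterate-stepD : ∀ clock c → foldD (stepD ∘ tl) clock (table · encStatus c) ≡ table · encStatus (iter M (lenD clock) c)
  iterate-stepD leaf    c = refl
  iterate-stepD (_ · l) c = trans (cong (foldD (stepD ∘ tl) l) (stepD-status c)) (iterate-stepD l (step M c))

  answer : Status M → D
  answer (running _ _) = leaf
  answer (halted out0) = tag₀
  answer (halted out1) = tag₁
  answer (halted out?) = leaf

  verdict-status : ∀ c → verdict (hd (encStatus c)) ≡ answer c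
  verdict-status (running q ts) = refl
  verdict-status (halted out0)  = refl
  verdict-status (halted out1)  = refl
  verdict-status (halted out?)  = refl

  simD-code : ∀ x clock → simD (code · encStr x · clock) ≡ answer (run M x (lenD clock))
  simD-code (b ∷ bs) clock = trans
    (cong (verdict ∘ hd ∘ tl) (iterate-stepD clock (running zero (initTapes M (b ∷ bs)))))
    (verdict-status (run M (b ∷ bs) (lenD clock)))

-- Clocks

addLeaf : D → D
addLeaf t = leaf · tl t

-- The state is `b · acc`; a step adds the length of `b` to that of `acc`.
mulStep : D → D
mulStep t = hd (tl t) · foldD addLeaf (hd (tl t)) (tl (tl t))

mulD : D → D → D
mulD a b = tl (foldD mulStep a (b · leaf))

clock : ℕ → D → D
clock zero    xs = tag₀
clock (suc c) xs = mulD xs (clock c xs)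

addLeaf-growth : ∀ a s → ⌊ addLeaf (a · s) ⌋ ≤ ⌊ s ⌋ + 2 * ⌊ a ⌋
addLeaf-growth a s = ≤-trans (≤-reflexive (+-comm 2 ⌊ s ⌋)) (+-monoʳ-≤ ⌊ s ⌋ (*-monoʳ-≤ 2 (⌊⌋-pos a)))

addLeafP : PT addLeaf
addLeafP = leafP ·P tlP

mulStep-growth : ∀ a s → ⌊ mulStep (a · s) ⌋ ≤ ⌊ s ⌋ + 2 * (⌊ a ⌋ + ⌊ hd s ⌋)
mulStep-growth a s = begin
  suc (⌊ hd s ⌋ + ⌊ foldD addLeaf (hd s) (tl s) ⌋)
    ≤⟨ s≤s (+-monoʳ-≤ ⌊ hd s ⌋ (linear-growth {f = addLeaf} 2 addLeaf-growth (hd s) (tl s))) ⟩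
  suc (⌊ hd s ⌋ + (⌊ tl s ⌋ + 2 * ⌊ hd s ⌋))
    ≡⟨ rearrange₁ ⌊ hd s ⌋ ⌊ tl s ⌋ ⟩
  ⌊ hd s ⌋ + ⌊ tl s ⌋ + (1 + 2 * ⌊ hd s ⌋)
    ≤⟨ +-monoˡ-≤ (1 + 2 * ⌊ hd s ⌋) (⌊hd⌋+⌊tl⌋ s) ⟩
  suc ⌊ s ⌋ + (1 + 2 * ⌊ hd s ⌋)
    ≡⟨ rearrange₂ ⌊ s ⌋ ⌊ hd s ⌋ ⟩
  ⌊ s ⌋ + 2 * (1 + ⌊ hd s ⌋)
    ≤⟨ +-monoʳ-≤ ⌊ s ⌋ (*-monoʳ-≤ 2 (+-monoˡ-≤ ⌊ hd s ⌋ (⌊⌋-pos a))) ⟩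
  ⌊ s ⌋ + 2 * (⌊ a ⌋ + ⌊ hd s ⌋) ∎
  where
  open ≤-Reasoning
  rearrange₁ : ∀ b c → suc (b + (c + 2 * b)) ≡ b + c + (1 + 2 * b)
  rearrange₁ = solve-∀
  rearrange₂ : ∀ s b → suc s + (1 + 2 * b) ≡ s + 2 * (1 + b)
  rearrange₂ = solve-∀

mulStepP : PT mulStep
mulStepP = hdP ∘P tlP ·P linearP {f = addLeaf} 2 addLeaf-growth addLeafP (hdP ∘P tlP) (tlP ∘P tlP)

mulP : ∀ {f g} → PT f → PT g → PT (λ t → mulD (f t) (g t))
mulP F G = tlP ∘P additiveP {f = mulStep} 2 (⌊_⌋ ∘ hd) (λ _ _ → ≤-refl) mulStep-growth ⌊hd⌋ mulStepP F (G ·P leafP)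

clockP : ∀ c → PT (clock c)
clockP zero    = constP tag₀
clockP (suc c) = mulP idP (clockP c)

lenD-add : ∀ a s → lenD (foldD addLeaf a s) ≡ lenD a + lenD s
lenD-add leaf    s = refl
lenD-add (_ · a) s = trans (lenD-add a (leaf · s)) (+-suc (lenD a) (lenD s))

lenD-mul : ∀ a b → lenD (mulD a b) ≡ lenD a * lenD b
lenD-mul a b = trans (go a leaf) (+-identityʳ _)
  where
  go : ∀ a s → lenD (tl (foldD mulStep a (b · s))) ≡ lenD a * lenD b + lenD s
  go leaf    s = refl
  go (_ · a) s = trans (go a (foldD addLeaf b s)) (trans (cong (lenD a * lenD b +_) (lenD-add b s))
    (identity (lenD a * lenD b) (lenD b) (lenD s)))
    where
    identity : ∀ x b s → x + (b + s) ≡ b + x + s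
    identity = solve-∀

lenD-clock : ∀ c xs → lenD (clock c xs) ≡ lenD xs ^ c
lenD-clock zero    xs = refl
lenD-clock (suc c) xs = trans (lenD-mul xs (clock c xs)) (cong (lenD xs *_) (lenD-clock c xs))

-- The argument is level · input; levels beyond the list get an empty clock.
dispatch : List ℕ → D → D
dispatch []       t = leaf
dispatch (c ∷ cs) t = cond (hd t) (dispatch cs (tl (hd t) · tl t)) (clock c (tl t))

dispatchP : ∀ cs → PT (dispatch cs)
dispatchP []       = leafP
dispatchP (c ∷ cs) = condP hdP (dispatchP cs ∘P (tlP ∘P hdP ·P tlP)) (clockP c ∘P tlP)

-- The diagonalisation step

-- The tag of an entry is leaf, or leaf · t after it was last refuted at level t;
-- it is then dead at the level t and above.
dead : D → D → D
dead tag l = cond tag (cond (dropD l (tl tag)) leaf tag₀) leaf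

-- The argument is entry · (level · input · clock) · found · processed entries.
probe : D → D
probe t =
  let a = hd t ; env = hd (tl t) ; found = hd (tl (tl t)) ; out = tl (tl (tl t))
      answer = simD (tl a · tl env) ; keep = env · found · a · out in
  cond found keep (cond (dead (hd a) (hd env)) keep
    (cond answer (env · answer · ((leaf · hd env) · tl a) · out) keep))

deadP : ∀ {f g} → PT f → PT g → PT (λ t → dead (f t) (g t))
deadP F G = condP F (condP (linearP {f = tl ∘ tl} 0 tl-growth (tlP ∘P tlP) G (tlP ∘P F)) leafP (constP tag₀)) leafP

probeP : PT probe
probeP = condP found keep (condP (deadP (hdP ∘P a) (hdP ∘P env)) keep
    (condP answerP (env ·P answerP ·P ((leafP ·P hdP ∘P env) ·P tlP ∘P a) ·P out) keep))
  where
  a : PT hd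
  a = hdP
  env : PT (λ t → hd (tl t))
  env = hdP ∘P tlP
  found : PT (λ t → hd (tl (tl t)))
  found = hdP ∘P tlP ∘P tlP
  out : PT (λ t → tl (tl (tl t)))
  out = tlP ∘P tlP ∘P tlP
  answerP : PT (λ t → simD (tl (hd t) · tl (hd (tl t))))
  answerP = simP ∘P (tlP ∘P a ·P tlP ∘P env)
  keep : PT (λ t → hd (tl t) · hd (tl (tl t)) · hd t · tl (tl (tl t)))
  keep = env ·P found ·P a ·P out

⌊simD⌋ : ∀ t → ⌊ simD t ⌋ ≤ 5
⌊simD⌋ t = ⌊verdict⌋ (hd (tl (foldD (stepD ∘ tl) (tl (tl t)) (tl (hd t) · start · (leaf · hd (tl t)) · hd (hd t)))))
  where
  ⌊verdict⌋ : ∀ u → ⌊ verdict u ⌋ ≤ 5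
  ⌊verdict⌋ leaf            = s≤s (s≤s (s≤s z≤n))
  ⌊verdict⌋ (_ · leaf)      = ≤-refl
  ⌊verdict⌋ (_ · (_ · _))   = s≤s z≤n

-- The environment is the unchanging component that bounds the growth of a scan.
probe-hd : ∀ a s → hd (probe (a · s)) ≡ hd s
probe-hd a s with hd (tl s)
... | _ · _ = refl
... | leaf with dead (hd a) (hd (hd s))
...   | _ · _ = refl
...   | leaf with simD (tl a · tl (hd s))
...     | _ · _ = refl
...     | leaf = refl

probe-growth : ∀ a s → ⌊ probe (a · s) ⌋ ≤ ⌊ s ⌋ + 13 * (⌊ a ⌋ + ⌊ hd s ⌋)
probe-growth a s = cond-≤ (hd (tl s)) keep≤ (cond-≤ (dead (hd a) (hd (hd s))) keep≤
    (cond-≤ (simD (tl a · tl (hd s))) kill≤ keep≤))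
  where
  open ≤-Reasoning
  e i o x : ℕ
  e = ⌊ hd s ⌋
  i = ⌊ hd (tl s) ⌋
  o = ⌊ tl (tl s) ⌋
  x = ⌊ a ⌋
  total : e + (i + o) ≤ 2 + ⌊ s ⌋
  total = ≤-trans (+-monoʳ-≤ e (⌊hd⌋+⌊tl⌋ (tl s))) (≤-trans (≤-reflexive (+-suc e _)) (s≤s (⌊hd⌋+⌊tl⌋ s)))
  final : ∀ {n} → n ≤ 12 + x + e + ⌊ s ⌋ → n ≤ ⌊ s ⌋ + 13 * (x + e)
  final {n} h = begin
    n                                    ≤⟨ h ⟩
    12 + x + e + ⌊ s ⌋                   ≤⟨ +-monoˡ-≤ ⌊ s ⌋ (+-monoˡ-≤ e (+-monoˡ-≤ x (*-monoʳ-≤ 12 (⌊⌋-pos a)))) ⟩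
    12 * x + x + e + ⌊ s ⌋               ≤⟨ ≤-slack (12 * e) (identity x e ⌊ s ⌋) ⟩
    ⌊ s ⌋ + 13 * (x + e)                 ∎
    where
    identity : ∀ x e s → 12 * x + x + e + s + 12 * e ≡ s + 13 * (x + e)
    identity = solve-∀
  keep≤ : ⌊ hd s · hd (tl s) · a · tl (tl s) ⌋ ≤ ⌊ s ⌋ + 13 * (x + e)
  keep≤ = final (begin
    suc (e + suc (i + suc (x + o)))      ≡⟨ identity e i x o ⟩
    e + (i + o) + (3 + x)                ≤⟨ +-monoˡ-≤ (3 + x) total ⟩
    2 + ⌊ s ⌋ + (3 + x)                  ≤⟨ ≤-slack (7 + e) (identity′ ⌊ s ⌋ x e) ⟩
    12 + x + e + ⌊ s ⌋                   ∎)
    where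
    identity : ∀ e i x o → suc (e + suc (i + suc (x + o))) ≡ e + (i + o) + (3 + x)
    identity = solve-∀
    identity′ : ∀ s x e → 2 + s + (3 + x) + (7 + e) ≡ 12 + x + e + s
    identity′ = solve-∀
  kill≤ : ⌊ hd s · simD (tl a · tl (hd s)) · ((leaf · hd (hd s)) · tl a) · tl (tl s) ⌋ ≤ ⌊ s ⌋ + 13 * (x + e)
  kill≤ = final (begin
    suc (e + suc (⌊ simD (tl a · tl (hd s)) ⌋ + suc (suc (2 + ⌊ hd (hd s) ⌋ + ⌊ tl a ⌋) + o)))
      ≤⟨ s≤s (+-monoʳ-≤ e (s≤s (+-mono-≤ (⌊simD⌋ (tl a · tl (hd s))) (s≤s (+-monoˡ-≤ o (s≤s (+-mono-≤ (+-monoʳ-≤ 2 (⌊hd⌋ (hd s))) (⌊tl⌋ a)))))))) ⟩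
    suc (e + suc (5 + suc (suc (2 + e + x) + o)))
      ≡⟨ identity e x o ⟩
    e + (1 + o) + (10 + x + e)
      ≤⟨ +-monoˡ-≤ (10 + x + e) (≤-trans (+-monoʳ-≤ e (+-monoˡ-≤ o (⌊⌋-pos (hd (tl s))))) total) ⟩
    2 + ⌊ s ⌋ + (10 + x + e)
      ≡⟨ identity′ ⌊ s ⌋ x e ⟩
    12 + x + e + ⌊ s ⌋ ∎)
    where
    identity : ∀ e x o → suc (e + suc (5 + suc (suc (2 + e + x) + o))) ≡ e + (1 + o) + (10 + x + e)
    identity = solve-∀
    identity′ : ∀ s x e → 2 + s + (10 + x + e) ≡ 12 + x + e + s
    identity′ = solve-∀

-- Level walk, input prefix and breadth-first enumeration of all trees

-- The argument is a level together with the number of steps left in the current run. The runs 0; 0,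
-- 1; 0, 1, 2; and so on make every level recur.
nextLevel : D → D
nextLevel t = cond (tl t) ((leaf · hd t) · tl (tl t)) (leaf · leaf · hd t)

-- A tree is a list of trees, and every list arises from the empty one by
-- pushing a leaf and by joining the first two elements.
joinTop : D → D
joinTop p = (hd p · hd (tl p)) · tl (tl p)

-- The queue is a front list and a back list, which takes the place of an exhausted front. One tree
-- is served per stage and its two successors are larger by at most 4, so the queue stays polynomial
-- in the number of stages.
nextQueue : D → D
nextQueue t = let p = hd (hd t) in
  cond (hd t) (tl (hd t) · (leaf · p) · joinTop p · tl t) (tl t · leaf)

nextControl : D → D
nextControl t = nextLevel (hd t) · (tag₁ · hd (tl t)) · nextQueue (tl (tl t))

-- The clock `τ` is a parameter so that one definition covers the full diagonalisation and its
-- truncations. A new entry goes to the end of the list, whose order is the order of priority.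
stageWith : (D → D) → D → D
stageWith τ s =
  let c = hd s ; l = hd (hd c) ; xs = hd (tl c) ; p = hd (hd (tl (tl c))) ; T = τ (l · xs)
      scanned = tl (foldD probe (hd (tl s)) ((l · xs · T) · leaf · leaf)) in
  nextControl c · rev ((leaf · p) · tl scanned) ·
  -- The answer found is inverted; if no entry answers, the word stays outside the set. An empty
  -- clock marks a level on which the truncation has no opinion.
  cond T (cond (hd scanned) (cond (tl (hd scanned)) tag₀ tag₁) tag₀) leaf

nextLevelP : PT nextLevel
nextLevelP = condP tlP ((leafP ·P hdP) ·P tlP ∘P tlP) (leafP ·P leafP ·P hdP)

joinTopP : PT joinTop
joinTopP = (hdP ·P hdP ∘P tlP) ·P tlP ∘P tlP

nextQueueP : PT nextQueue
nextQueueP = condP hdP (tlP ∘P hdP ·P (leafP ·P hdP ∘P hdP) ·P joinTopP ∘P hdP ∘P hdP ·P tlP) (tlP ·P leafP)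

nextControlP : PT nextControl
nextControlP = nextLevelP ∘P hdP ·P (constP tag₁ ·P hdP ∘P tlP) ·P nextQueueP ∘P tlP ∘P tlP

stageP : ∀ {τ} → PT τ → PT (stageWith τ)
stageP {τ} Τ = nextControlP ∘P hdP ·P revP ∘P ((leafP ·P p) ·P tlP ∘P scanned) ·P
  condP T (condP (hdP ∘P scanned) (condP (tlP ∘P hdP ∘P scanned) (constP tag₀) (constP tag₁)) (constP tag₀)) leafP
  where
  l : PT (λ s → hd (hd (hd s)))
  l = hdP ∘P hdP ∘P hdP
  xs : PT (λ s → hd (tl (hd s)))
  xs = hdP ∘P tlP ∘P hdP
  p : PT (λ s → hd (hd (tl (tl (hd s)))))
  p = hdP ∘P hdP ∘P tlP ∘P tlP ∘P hdP
  T : PT (λ s → τ (hd (hd (hd s)) · hd (tl (hd s))))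
  T = Τ ∘P (l ·P xs)
  scanned : PT (λ s → tl (foldD probe (hd (tl s))
              ((hd (hd (hd s)) · hd (tl (hd s)) · τ (hd (hd (hd s)) · hd (tl (hd s)))) · leaf · leaf)))
  scanned = tlP ∘P additiveP {f = probe} 13 (⌊_⌋ ∘ hd) (λ a s → ≤-reflexive (cong ⌊_⌋ (probe-hd a s))) probe-growth ⌊hd⌋
    probeP (hdP ∘P tlP) ((l ·P xs ·P T) ·P leafP ·P leafP)

-- Stages

-- One pass over the entries without the accumulator of the fold. There is at most one `kill`, and
-- what follows it is left untouched.
data Scan (env : D) : D → D → D → Set where
  nil  : Scan env leaf leaf leaf
  skip : ∀ {a Z r Z'} → dead (hd a) (hd env) ≢ leaf ⊎ simD (tl a · tl env) ≡ leaf →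
         Scan env Z r Z' → Scan env (a · Z) r (a · Z')
  kill : ∀ {a Z} → dead (hd a) (hd env) ≡ leaf → simD (tl a · tl env) ≢ leaf →
         Scan env (a · Z) (simD (tl a · tl env)) (((leaf · hd env) · tl a) · Z)

fold-probe-found : ∀ env x y Z acc → foldD probe Z (env · (x · y) · acc) ≡ env · (x · y) · foldD id Z acc
fold-probe-found env x y leaf    acc = refl
fold-probe-found env x y (a · Z) acc = fold-probe-found env x y Z (a · acc)

probe-next : ∀ env a acc → let d = dead (hd a) (hd env) ; v = simD (tl a · tl env) in
             probe (a · env · leaf · acc) ≡
             cond d (env · leaf · a · acc) (cond v (env · v · ((leaf · hd env) · tl a) · acc) (env · leaf · a · acc))
probe-next env a acc = refl

fold-probe : ∀ env Z → ∃[ r ] ∃[ Z' ] Scan env Z r Z' ×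
             (∀ acc → foldD probe Z (env · leaf · acc) ≡ env · r · foldD id Z' acc)
fold-probe env leaf    = leaf , leaf , nil , λ acc → refl
fold-probe env (a · Z) = go (fold-probe env Z) (dead (hd a) (hd env)) refl (simD (tl a · tl env)) refl
  where
  go : ∃[ r ] ∃[ Z' ] Scan env Z r Z' × (∀ acc → foldD probe Z (env · leaf · acc) ≡ env · r · foldD id Z' acc) →
       ∀ d → dead (hd a) (hd env) ≡ d → ∀ v → simD (tl a · tl env) ≡ v →
       ∃[ r ] ∃[ Z' ] Scan env (a · Z) r Z' × (∀ acc → foldD probe (a · Z) (env · leaf · acc) ≡ env · r · foldD id Z' acc)
  unfold : ∀ acc {d v} → dead (hd a) (hd env) ≡ d → simD (tl a · tl env) ≡ v →
         foldD probe (a · Z) (env · leaf · acc) ≡ foldD probe Z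
           (cond d (env · leaf · a · acc) (cond v (env · v · ((leaf · hd env) · tl a) · acc) (env · leaf · a · acc)))
  unfold acc refl refl = cong (foldD probe Z) (probe-next env a acc)
  go (r , Z' , s , e) (x · y) eq v eq' = r , a · Z' , skip (inj₁ λ z → case trans (sym eq) z of λ ()) s ,
    λ acc → trans (unfold acc eq eq') (e (a · acc))
  go (r , Z' , s , e) leaf eq leaf eq' = r , a · Z' , skip (inj₂ eq') s ,
    λ acc → trans (unfold acc eq eq') (e (a · acc))
  go _ leaf eq (x · y) eq' = simD (tl a · tl env) , ((leaf · hd env) · tl a) · Z ,
    kill eq (λ z → case trans (sym eq') z of λ ()) ,
    λ acc → trans (unfold acc eq eq') (trans (fold-probe-found env x y Z (((leaf · hd env) · tl a) · acc))
      (cong (λ v → env · v · foldD id Z (((leaf · hd env) · tl a) · acc)) (sym eq')))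

appD : D → D → D
appD leaf    b = b
appD (x · a) b = x · appD a b

foldD-id-rev : ∀ l a b → foldD id (foldD id l a) b ≡ foldD id a (appD l b)
foldD-id-rev leaf    a b = refl
foldD-id-rev (x · l) a b = foldD-id-rev l (x · a) b

⌊appD⌋ : ∀ a b → ⌊ appD a b ⌋ ≤ ⌊ a ⌋ + ⌊ b ⌋
⌊appD⌋ leaf    b = n≤1+n _
⌊appD⌋ (x · a) b = s≤s (≤-trans (+-monoʳ-≤ ⌊ x ⌋ (⌊appD⌋ a b)) (≤-reflexive (sym (+-assoc ⌊ x ⌋ ⌊ a ⌋ ⌊ b ⌋))))

control : ℕ → D
control zero    = (leaf · leaf) · (tag₁ · leaf) · (leaf · leaf) · leaf
control (suc n) = nextControl (control n)

level input newCode : ℕ → D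
level n   = hd (hd (control n))
input n   = hd (tl (control n))
newCode n = hd (hd (tl (tl (control n))))

module Stages (τ : D → D) where

  env : ℕ → D
  env n = level n · input n · τ (level n · input n)

  entries : ℕ → D
  entries zero    = leaf
  entries (suc n) = appD (fold-probe (env n) (entries n) .proj₂ .proj₁) ((leaf · newCode n) · leaf)

  response : ℕ → D
  response n = fold-probe (env n) (entries n) .proj₁

  scanning : ∀ n → ∃[ Z ] Scan (env n) (entries n) (response n) Z × entries (suc n) ≡ appD Z ((leaf · newCode n) · leaf)
  scanning n = let (_ , Z , s , _) = fold-probe (env n) (entries n) in Z , s , refl

  outcome : ℕ → D
  outcome n = cond (τ (level n · input n)) (cond (response n) (cond (tl (response n)) tag₀ tag₁) tag₀) leaf

  stage-step : ∀ n x → stageWith τ (control n · entries n · x) ≡ control (suc n) · entries (suc n) · outcome n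
  stage-step n x with fold-probe (env n) (entries n)
  ... | r , Z , s , e rewrite e leaf = cong (λ z → control (suc n) · z ·
        cond (τ (level n · input n)) (cond r (cond (tl r) tag₀ tag₁) tag₀) leaf)
        (foldD-id-rev Z leaf ((leaf · newCode n) · leaf))

open Stages

-- The size of the state

⌊nextLevel⌋ : ∀ t → ⌊ nextLevel t ⌋ ≤ 4 + ⌊ t ⌋
⌊nextLevel⌋ leaf                = ≤-refl
⌊nextLevel⌋ (l · leaf)          = ≤-slack 2 (identity ⌊ l ⌋)
  where
  identity : ∀ l → suc (1 + suc (1 + l)) + 2 ≡ 4 + suc (l + 1)
  identity = solve-∀
⌊nextLevel⌋ (l · (a · m))       = ≤-slack (3 + ⌊ a ⌋) (identity ⌊ l ⌋ ⌊ a ⌋ ⌊ m ⌋)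
  where
  identity : ∀ l a m → suc (suc (1 + l) + m) + (3 + a) ≡ 4 + suc (l + suc (a + m))
  identity = solve-∀

⌊walk⌋ : ∀ n → ⌊ hd (control n) ⌋ ≤ 3 + 4 * n
⌊walk⌋ zero    = ≤-refl
⌊walk⌋ (suc n) = ≤-trans (⌊nextLevel⌋ (hd (control n))) (≤-trans (+-monoʳ-≤ 4 (⌊walk⌋ n)) (≤-reflexive (identity n)))
  where
  identity : ∀ n → 4 + (3 + 4 * n) ≡ 3 + 4 * suc n
  identity = solve-∀

⌊input⌋ : ∀ n → ⌊ input n ⌋ ≤ 7 + 6 * n
⌊input⌋ zero    = ≤-refl
⌊input⌋ (suc n) = ≤-trans (+-monoʳ-≤ 6 (⌊input⌋ n)) (≤-reflexive (identity n))
  where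
  identity : ∀ n → 6 + (7 + 6 * n) ≡ 7 + 6 * suc n
  identity = solve-∀

Small : ℕ → D → Set
Small b leaf    = ⊤
Small b (p · d) = ⌊ p ⌋ ≤ b × Small b d

Small-mono : ∀ {b c} d → b ≤ c → Small b d → Small c d
Small-mono leaf    b≤c s       = tt
Small-mono (p · d) b≤c (h , s) = ≤-trans h b≤c , Small-mono d b≤c s

Small-⌊⌋ : ∀ b d → Small b d → ⌊ d ⌋ ≤ 1 + lenD d * (1 + b)
Small-⌊⌋ b leaf    s       = ≤-refl
Small-⌊⌋ b (p · d) (h , s) = s≤s (≤-trans (+-mono-≤ h (Small-⌊⌋ b d s)) (≤-reflexive (+-suc b _)))

⌊joinTop⌋ : ∀ p → ⌊ joinTop p ⌋ ≤ 4 + ⌊ p ⌋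
⌊joinTop⌋ p = begin
  suc (suc (⌊ hd p ⌋ + ⌊ hd (tl p) ⌋) + ⌊ tl (tl p) ⌋)
    ≡⟨ cong (2 +_) (+-assoc ⌊ hd p ⌋ ⌊ hd (tl p) ⌋ ⌊ tl (tl p) ⌋) ⟩
  2 + (⌊ hd p ⌋ + (⌊ hd (tl p) ⌋ + ⌊ tl (tl p) ⌋))
    ≤⟨ +-monoʳ-≤ 2 (+-monoʳ-≤ ⌊ hd p ⌋ (⌊hd⌋+⌊tl⌋ (tl p))) ⟩
  2 + (⌊ hd p ⌋ + suc ⌊ tl p ⌋)
    ≡⟨ cong (2 +_) (+-suc ⌊ hd p ⌋ ⌊ tl p ⌋) ⟩
  3 + (⌊ hd p ⌋ + ⌊ tl p ⌋)
    ≤⟨ +-monoʳ-≤ 3 (⌊hd⌋+⌊tl⌋ p) ⟩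
  4 + ⌊ p ⌋ ∎
  where open ≤-Reasoning

queue : ℕ → D
queue n = tl (tl (control n))

queue-small : ∀ n → Small (1 + 4 * n) (hd (queue n)) × Small (1 + 4 * n) (tl (queue n)) ×
                    lenD (hd (queue n)) + lenD (tl (queue n)) ≤ 1 + 2 * n
queue-small zero    = (≤-refl , tt) , tt , ≤-refl
queue-small (suc n) = go (hd (queue n)) (tl (queue n)) (queue-small n)
  where
  grow : 1 + 4 * n ≤ 1 + 4 * suc n
  grow = s≤s (*-monoʳ-≤ 4 (n≤1+n n))
  grow₄ : 4 + (1 + 4 * n) ≤ 1 + 4 * suc n
  grow₄ = ≤-reflexive (identity n)
    where
    identity : ∀ n → 4 + (1 + 4 * n) ≡ 1 + 4 * suc n
    identity = solve-∀
  longer : 1 + (1 + 2 * n) ≤ 1 + 2 * suc n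
  longer = ≤-slack 1 (identity n)
    where
    identity : ∀ n → 1 + (1 + 2 * n) + 1 ≡ 1 + 2 * suc n
    identity = solve-∀
  go : ∀ G H → Small (1 + 4 * n) G × Small (1 + 4 * n) H × lenD G + lenD H ≤ 1 + 2 * n →
       let q = cond G (tl G · (leaf · hd G) · joinTop (hd G) · H) (H · leaf) in
       Small (1 + 4 * suc n) (hd q) × Small (1 + 4 * suc n) (tl q) × lenD (hd q) + lenD (tl q) ≤ 1 + 2 * suc n
  go leaf    H (_ , sH , len) = Small-mono H grow sH , tt ,
    ≤-trans (≤-reflexive (+-identityʳ _)) (≤-trans len (≤-trans (n≤1+n _) longer))
  go (p · G) H ((hp , sG) , sH , len) = Small-mono G grow sG ,
    (≤-trans (+-monoʳ-≤ 2 hp) (≤-trans (m≤n+m _ 2) grow₄) ,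
     ≤-trans (⌊joinTop⌋ p) (≤-trans (+-monoʳ-≤ 4 hp) grow₄) , Small-mono H grow sH) ,
    ≤-trans (≤-reflexive (trans (+-suc (lenD G) _) (cong suc (+-suc (lenD G) _)))) (≤-trans (s≤s len) longer)

⌊queue⌋ : ∀ n → ⌊ hd (queue n) · tl (queue n) ⌋ ≤ 3 + (1 + 2 * n) * (2 + 4 * n)
⌊queue⌋ n with queue-small n
... | sG , sH , len = begin
  suc (⌊ hd (queue n) ⌋ + ⌊ tl (queue n) ⌋)
    ≤⟨ s≤s (+-mono-≤ (Small-⌊⌋ _ (hd (queue n)) sG) (Small-⌊⌋ _ (tl (queue n)) sH)) ⟩
  suc (1 + lenD (hd (queue n)) * (2 + 4 * n) + (1 + lenD (tl (queue n)) * (2 + 4 * n)))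
    ≡⟨ identity (lenD (hd (queue n))) (lenD (tl (queue n))) (2 + 4 * n) ⟩
  3 + (lenD (hd (queue n)) + lenD (tl (queue n))) * (2 + 4 * n)
    ≤⟨ +-monoʳ-≤ 3 (*-monoˡ-≤ (2 + 4 * n) len) ⟩
  3 + (1 + 2 * n) * (2 + 4 * n) ∎
  where
  open ≤-Reasoning
  identity : ∀ a b c → suc (1 + a * c + (1 + b * c)) ≡ 3 + (a + b) * c
  identity = solve-∀

⌊newCode⌋ : ∀ n → ⌊ newCode n ⌋ ≤ 1 + 4 * n
⌊newCode⌋ n = go (hd (queue n)) (queue-small n .proj₁)
  where
  go : ∀ G → Small (1 + 4 * n) G → ⌊ hd G ⌋ ≤ 1 + 4 * n
  go leaf    _       = s≤s z≤n
  go (p · G) (h , _) = h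

control-η : ∀ n → control n ≡ hd (control n) · input n · hd (queue n) · tl (queue n)
control-η zero    = refl
control-η (suc n) = cong (λ q → nextLevel (hd (control n)) · (tag₁ · input n) · q) (go (hd (queue n)) _ _)
  where
  go : ∀ c x y {a b} → cond c (a · x) (b · y) ≡ hd (cond c (a · x) (b · y)) · tl (cond c (a · x) (b · y))
  go leaf    x y = refl
  go (_ · _) x y = refl

-- In `entriesBound`, stage n contributes at most 6 + 4n for a new tag, which replaces the old one,
-- and 5 + 4n for the appended entry.
controlBound entriesBound stateBound : Poly
controlBound = con 2 ⊕ ((con 3 ⊕ con 4 ⊗ var) ⊕ ((con 7 ⊕ con 6 ⊗ var) ⊕
               (con 3 ⊕ (con 1 ⊕ con 2 ⊗ var) ⊗ (con 2 ⊕ con 4 ⊗ var))))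
entriesBound = con 1 ⊕ var ⊗ (con 11 ⊕ con 8 ⊗ var)
stateBound   = con 2 ⊕ (controlBound ⊕ (entriesBound ⊕ con 5))

⌊control⌋ : ∀ n → ⌊ control n ⌋ ≤ eval controlBound n
⌊control⌋ n = begin
  ⌊ control n ⌋
    ≡⟨ cong ⌊_⌋ (control-η n) ⟩
  suc (⌊ hd (control n) ⌋ + suc (⌊ input n ⌋ + ⌊ hd (queue n) · tl (queue n) ⌋))
    ≡⟨ cong suc (+-suc ⌊ hd (control n) ⌋ _) ⟩
  2 + (⌊ hd (control n) ⌋ + (⌊ input n ⌋ + ⌊ hd (queue n) · tl (queue n) ⌋))
    ≤⟨ +-monoʳ-≤ 2 (+-mono-≤ (⌊walk⌋ n) (+-mono-≤ (⌊input⌋ n) (⌊queue⌋ n))) ⟩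
  eval controlBound n ∎
  where open ≤-Reasoning

⌊Scan⌋ : ∀ {e Z r Z'} → Scan e Z r Z' → ⌊ Z' ⌋ ≤ ⌊ Z ⌋ + (3 + ⌊ hd e ⌋)
⌊Scan⌋ nil = m≤m+n _ _
⌊Scan⌋ (skip {a = a} {Z} _ s) = s≤s (≤-trans (+-monoʳ-≤ ⌊ a ⌋ (⌊Scan⌋ s)) (≤-reflexive (sym (+-assoc ⌊ a ⌋ ⌊ Z ⌋ _))))
⌊Scan⌋ {e} (kill {a} {Z} _ _) = s≤s (≤-trans (+-monoˡ-≤ ⌊ Z ⌋ (+-monoʳ-≤ (3 + ⌊ hd e ⌋) (⌊tl⌋ a)))
  (≤-reflexive (identity ⌊ hd e ⌋ ⌊ a ⌋ ⌊ Z ⌋)))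
  where
  identity : ∀ e a z → 3 + e + a + z ≡ a + z + (3 + e)
  identity = solve-∀

module _ (τ : D → D) where

  ⌊entries⌋ : ∀ n → ⌊ entries τ n ⌋ ≤ eval entriesBound n
  ⌊entries⌋ zero    = ≤-refl
  ⌊entries⌋ (suc n) with scanning τ n
  ... | Z , s , eq = begin
    ⌊ entries τ (suc n) ⌋
      ≡⟨ cong ⌊_⌋ eq ⟩
    ⌊ appD Z ((leaf · newCode n) · leaf) ⌋
      ≤⟨ ⌊appD⌋ Z ((leaf · newCode n) · leaf) ⟩
    ⌊ Z ⌋ + suc (2 + ⌊ newCode n ⌋ + 1)
      ≤⟨ +-mono-≤ (⌊Scan⌋ s) (s≤s (+-monoˡ-≤ 1 (+-monoʳ-≤ 2 (⌊newCode⌋ n)))) ⟩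
    ⌊ entries τ n ⌋ + (3 + ⌊ level n ⌋) + suc (2 + (1 + 4 * n) + 1)
      ≤⟨ +-monoˡ-≤ _ (+-mono-≤ (⌊entries⌋ n) (+-monoʳ-≤ 3 (≤-trans (⌊hd⌋ (hd (control n))) (⌊walk⌋ n)))) ⟩
    1 + n * (11 + 8 * n) + (3 + (3 + 4 * n)) + suc (2 + (1 + 4 * n) + 1)
      ≤⟨ ≤-slack (8 + 8 * n) (identity n) ⟩
    1 + suc n * (11 + 8 * suc n) ∎
    where
    open ≤-Reasoning
    identity : ∀ n → 1 + n * (11 + 8 * n) + (3 + (3 + 4 * n)) + suc (2 + (1 + 4 * n) + 1) + (8 + 8 * n)
                     ≡ 1 + suc n * (11 + 8 * suc n)
    identity = solve-∀

  latest : ℕ → D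
  latest zero    = leaf
  latest (suc n) = outcome τ n

  ⌊latest⌋ : ∀ n → ⌊ latest n ⌋ ≤ 5
  ⌊latest⌋ zero    = s≤s z≤n
  ⌊latest⌋ (suc n) = cond-≤ (τ (level n · input n))
    (cond-≤ (response τ n) (cond-≤ {x = tag₀} {tag₁} (tl (response τ n)) 3≤5 ≤-refl) 3≤5) (s≤s z≤n)
    where
    3≤5 : 3 ≤ 5
    3≤5 = s≤s (s≤s (s≤s z≤n))

  stateAt : ℕ → D
  stateAt n = control n · entries τ n · latest n

  ⌊stateAt⌋ : ∀ n → ⌊ stateAt n ⌋ ≤ eval stateBound n
  ⌊stateAt⌋ n = ≤-trans (≤-reflexive (cong suc (+-suc ⌊ control n ⌋ _)))
    (+-monoʳ-≤ 2 (+-mono-≤ (⌊control⌋ n) (+-mono-≤ (⌊entries⌋ n) (⌊latest⌋ n))))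

  fold-stages : ∀ l n → foldD (stageWith τ ∘ tl) l (stateAt n) ≡ stateAt (lenD l + n)
  fold-stages leaf    n = refl
  fold-stages (_ · l) n = trans (cong (foldD (stageWith τ ∘ tl) l) (stage-step τ n (latest n)))
    (trans (fold-stages l (suc n)) (cong stateAt (+-suc (lenD l) n)))

  stages-bounded : ∀ l n {B} → eval stateBound (lenD l + n) ≤ B → Bounded (stageWith τ ∘ tl) B l (stateAt n)
  stages-bounded leaf    n h = ≤-trans (⌊stateAt⌋ n) h
  stages-bounded (a · l) n {B} h =
    ≤-trans (⌊stateAt⌋ n) (≤-trans (eval-mono stateBound (m≤n+m n (suc (lenD l)))) h) ,
    subst (Bounded (stageWith τ ∘ tl) B l) (sym (stage-step τ n (latest n)))
      (stages-bounded l (suc n) (≤-trans (eval-mono stateBound (≤-reflexive (+-suc (lenD l) n))) h))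

lenD≤⌊⌋ : ∀ d → lenD d ≤ ⌊ d ⌋
lenD≤⌊⌋ leaf    = z≤n
lenD≤⌊⌋ (a · d) = s≤s (≤-trans (lenD≤⌊⌋ d) (m≤n+m ⌊ d ⌋ ⌊ a ⌋))

-- Deciding the diagonal set

allTrueStep : D → D
allTrueStep t = cond (tl (hd t)) (tl t) leaf

allTrue : D → D
allTrue xs = foldD allTrueStep xs tag₀

-- The word doubles as the counter of stages: `ones n` has n + 1 letters and drives the stages 0 to
-- n, so the state ends with the outcome of stage n.
decide : (D → D) → D → D
decide τ t = cond (allTrue t) (tl (tl (foldD (stageWith τ ∘ tl) t (stateAt τ 0)))) tag₀

decideP : ∀ {τ} → PT τ → PT (decide τ)
decideP {τ} Τ = condP
  (linearP {f = allTrueStep} 0 (λ a s → cond-≤ (tl a) (m≤m+n _ _) (≤-trans (⌊⌋-pos s) (m≤m+n _ _)))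
    (condP (tlP ∘P hdP) tlP leafP) idP (constP tag₀))
  (tlP ∘P tlP ∘P foldP (stageP Τ ∘P tlP) idP (constP (stateAt τ 0)) stateBound
    (λ t → stages-bounded τ t 0 (eval-mono stateBound (≤-trans (≤-reflexive (+-identityʳ _)) (lenD≤⌊⌋ t)))))
  (constP tag₀)

len : Str → ℕ
len = List⁺.length

ones : ℕ → Str
ones n = true ∷ List.replicate n true

encStr-ones : ∀ n → encStr (ones n) ≡ input n
encStr-ones zero    = refl
encStr-ones (suc n) = cong (tag₁ ·_) (encStr-ones n)

lenD-input : ∀ n → lenD (input n) ≡ suc n
lenD-input zero    = refl
lenD-input (suc n) = cong suc (lenD-input n)

decide-ones : ∀ τ n → decide τ (encStr (ones n)) ≡ outcome τ n
decide-ones τ n = trans (cong (decide τ) (encStr-ones n))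
  (trans (cong (λ c → cond c (tl (tl (foldD (stageWith τ ∘ tl) (input n) (stateAt τ 0)))) tag₀) (all n))
    (trans (cong (tl ∘ tl) (fold-stages τ (input n) 0))
      (cong (latest τ) (trans (+-identityʳ _) (lenD-input n)))))
  where
  all : ∀ n → allTrue (input n) ≡ tag₀
  all zero    = refl
  all (suc n) = all n

allTrue-cases : ∀ bs → bs ≡ List.replicate (length bs) true ⊎ foldD allTrueStep (encCells (map bit bs)) tag₀ ≡ leaf
allTrue-cases []           = inj₁ refl
allTrue-cases (true ∷ bs)  = map⊎ (cong (true ∷_)) id (allTrue-cases bs)
allTrue-cases (false ∷ bs) = inj₂ (stuck bs)
  where
  stuck : ∀ bs → foldD allTrueStep (encCells (map bit bs)) leaf ≡ leaf
  stuck []           = refl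
  stuck (false ∷ bs) = stuck bs
  stuck (true ∷ bs)  = stuck bs

decide-other : ∀ τ x → (∃[ n ] x ≡ ones n) ⊎ decide τ (encStr x) ≡ tag₀
decide-other τ (b ∷ bs) with allTrue-cases (b ∷ bs)
... | inj₁ e    = inj₁ (length bs , cong₂ _∷_ (∷-injectiveˡ e) (∷-injectiveʳ e))
... | inj₂ e    = inj₂ (cong (λ c → cond c (tl (tl (foldD (stageWith τ ∘ tl) (encStr (b ∷ bs)) (stateAt τ 0)))) tag₀) e)

-- The enumerations

level-unary : ∀ n k j → hd (control n) ≡ unary k · unary j → ∀ i → i ≤ j →
              hd (control (i + n)) ≡ unary (i + k) · unary (j ∸ i)
level-unary n k j e zero    _   = e
level-unary n k j e (suc i) i<j with j ∸ i | m+[n∸m]≡n (<⇒≤ i<j) | level-unary n k j e i (<⇒≤ i<j)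
... | suc d | eq | ih = trans (cong nextLevel ih) (cong (λ m → (leaf · unary (i + k)) · unary m)
                          (sym (trans (cong (_∸ suc i) (trans (sym eq) (+-suc i d))) (m+n∸m≡n i d))))
... | zero  | eq | _ = ⊥-elim (<-irrefl (trans (sym (+-identityʳ i)) eq) i<j)

walk-restarts : ∀ k → ∃[ n ] k ≤ n × hd (control n) ≡ leaf · unary k
walk-restarts zero    = 0 , z≤n , refl
walk-restarts (suc k) with walk-restarts k
... | n , k≤n , e = suc (k + n) , s≤s (m≤m+n k n) ,
  trans (cong nextLevel (level-unary n 0 k e k ≤-refl))
    (trans (cong (λ m → nextLevel (unary (k + 0) · unary m)) (n∸n≡0 k)) (cong (λ m → leaf · leaf · unary m) (+-identityʳ k)))

lenD-unary : ∀ n → lenD (unary n) ≡ n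
lenD-unary zero    = refl
lenD-unary (suc n) = cong suc (lenD-unary n)

level-recurs : ∀ J N → ∃[ n ] N ≤ n × lenD (level n) ≡ J
level-recurs J N with walk-restarts (J + N)
... | n , k≤n , e = J + n , ≤-trans (≤-trans (m≤n+m N J) k≤n) (m≤n+m n J) ,
  trans (cong (lenD ∘ hd) (level-unary n 0 (J + N) e J (m≤m+n J N))) (trans (lenD-unary (J + 0)) (+-identityʳ J))

data _∈D_ (d : D) : D → Set where
  here  : ∀ {Z} → d ∈D (d · Z)
  there : ∀ {a Z} → d ∈D Z → d ∈D (a · Z)

queue-step : ∀ n p G → hd (queue n) ≡ p · G →
             newCode n ≡ p × hd (queue (suc n)) ≡ G × tl (queue (suc n)) ≡ (leaf · p) · joinTop p · tl (queue n)
queue-step n p G e = cong hd e ,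
  cong (λ c → hd (cond c (tl c · (leaf · hd c) · joinTop (hd c) · tl (queue n)) (tl (queue n) · leaf))) e ,
  cong (λ c → tl (cond c (tl c · (leaf · hd c) · joinTop (hd c) · tl (queue n)) (tl (queue n) · leaf))) e

queue-swap : ∀ n → hd (queue n) ≡ leaf → hd (queue (suc n)) ≡ tl (queue n)
queue-swap n e = cong (λ c → hd (cond c (tl c · (leaf · hd c) · joinTop (hd c) · tl (queue n)) (tl (queue n) · leaf))) e

Queued : D → Set
Queued d = ∃[ n ] ∃[ G ] hd (queue n) ≡ d · G

front-queued : ∀ {d} G n → hd (queue n) ≡ G → d ∈D G → Queued d
front-queued (p · G) n e here        = n , G , e
front-queued (p · G) n e (there d∈G) = front-queued G (suc n) (queue-step n p G e .proj₂ .proj₁) d∈G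

-- The back list grows only at its head, so a waiting tree stays in it until the front is used up.
back-queued : ∀ {d} G n → hd (queue n) ≡ G → d ∈D tl (queue n) → Queued d
back-queued leaf    n e d∈H = front-queued _ (suc n) refl (subst (_ ∈D_) (sym (queue-swap n e)) d∈H)
back-queued (p · G) n e d∈H with queue-step n p G e
... | _ , e₁ , e₂ = back-queued G (suc n) e₁ (subst (_ ∈D_) (sym e₂) (there (there d∈H)))

queued-leaf· : ∀ {d} → Queued d → Queued (leaf · d)
queued-leaf· {d} (n , G , e) with queue-step n d G e
... | _ , e₁ , e₂ = back-queued G (suc n) e₁ (subst (_ ∈D_) (sym e₂) here)

queued-joinTop : ∀ {d} → Queued d → Queued (joinTop d)
queued-joinTop {d} (n , G , e) with queue-step n d G e
... | _ , e₁ , e₂ = back-queued G (suc n) e₁ (subst (_ ∈D_) (sym e₂) (there here))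

-- `(a · b) · d` arises from `a · b · d` by joining the first two elements, so induction on the
-- first component is enough.
queued-· : ∀ a {d} → Queued d → Queued (a · d)
queued-· leaf    h = queued-leaf· h
queued-· (a · b) h = queued-joinTop (queued-· a (queued-· b h))

queued : ∀ d → Queued d
queued leaf    = 0 , leaf , refl
queued (a · d) = queued-· a (queued d)

code-listed : ∀ d → ∃[ n ] newCode n ≡ d
code-listed d with queued d
... | n , G , e = n , cong hd e

-- Dead entries

dropD-leaf : ∀ l → dropD l leaf ≡ leaf
dropD-leaf leaf    = refl
dropD-leaf (_ · l) = dropD-leaf l

dropD-≤ : ∀ l t → lenD t ≤ lenD l → dropD l t ≡ leaf
dropD-≤ leaf    leaf    h       = refl
dropD-≤ (_ · l) leaf    h       = dropD-leaf l
dropD-≤ (_ · l) (_ · t) (s≤s h) = dropD-≤ l t h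

dead-long : ∀ a t l → lenD l < lenD t → dead (a · t) l ≡ leaf
dead-long a t l h = go l t h
  where
  go : ∀ l t → lenD l < lenD t → cond (dropD l t) leaf tag₀ ≡ leaf
  go leaf    (_ · t) h       = refl
  go (_ · l) (_ · t) (s≤s h) = go l t h

alive-long : ∀ a t l → dead (a · t) l ≡ leaf → lenD l < lenD t
alive-long a t l e with lenD l <? lenD t
... | yes h = h
... | no ¬h with () ← trans (sym e) (cong (λ u → cond u leaf tag₀) (dropD-≤ l t (≮⇒≥ ¬h)))

alive-mono : ∀ tag l l' → lenD l' ≤ lenD l → dead tag l ≡ leaf → dead tag l' ≡ leaf
alive-mono leaf    l l' h e = refl
alive-mono (a · t) l l' h e = dead-long a t l' (≤-<-trans h (alive-long a t l e))

-- Positions in the list of entries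

at : ℕ → D → D
at zero    Z = hd Z
at (suc q) Z = at q (tl Z)

at-append : ∀ q Z b → q < lenD Z → at q (appD Z b) ≡ at q Z
at-append zero    (a · Z) b h       = refl
at-append (suc q) (a · Z) b (s≤s h) = at-append q Z b h

at-end : ∀ Z a → at (lenD Z) (appD Z (a · leaf)) ≡ a
at-end leaf    a = refl
at-end (_ · Z) a = at-end Z a

lenD-append : ∀ Z a → lenD (appD Z (a · leaf)) ≡ suc (lenD Z)
lenD-append leaf    a = refl
lenD-append (_ · Z) a = cong suc (lenD-append Z a)

scan-length : ∀ {e Z r Z'} → Scan e Z r Z' → lenD Z' ≡ lenD Z
scan-length nil        = refl
scan-length (skip _ s) = cong suc (scan-length s)
scan-length (kill _ _) = refl

scan-code : ∀ {e Z r Z'} → Scan e Z r Z' → ∀ q → tl (at q Z') ≡ tl (at q Z)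
scan-code nil        q       = refl
scan-code (skip _ s) zero    = refl
scan-code (skip _ s) (suc q) = scan-code s q
scan-code (kill _ _) zero    = refl
scan-code (kill _ _) (suc q) = refl

Passive : D → D → Set
Passive e a = dead (hd a) (hd e) ≢ leaf ⊎ simD (tl a · tl e) ≡ leaf

record Hit (e Z r Z' : D) (q : ℕ) : Set where
  field
    inside : q < lenD Z
    alive  : dead (hd (at q Z)) (hd e) ≡ leaf
    reply  : r ≡ simD (tl (at q Z) · tl e)
    reply≢ : r ≢ leaf
    tagged : hd (at q Z') ≡ leaf · hd e
    others : ∀ q' → q' ≢ q → at q' Z' ≡ at q' Z
    before : ∀ q' → q' < q → Passive e (at q' Z)

open Hit

scan-event : ∀ {e Z r Z'} → Scan e Z r Z' →
             (r ≡ leaf × Z' ≡ Z × ∀ q → q < lenD Z → Passive e (at q Z)) ⊎ ∃[ q ] Hit e Z r Z' q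
scan-event nil = inj₁ (refl , refl , λ q ())
scan-event (skip p s) with scan-event s
... | inj₁ (r≡ , refl , ps) = inj₁ (r≡ , refl , λ { zero _ → p ; (suc q) (s≤s h) → ps q h })
... | inj₂ (q , hit) = inj₂ (suc q , record
  { inside = s≤s (hit .inside) ; alive = hit .alive ; reply = hit .reply ; reply≢ = hit .reply≢
  ; tagged = hit .tagged
  ; others = λ { zero _ → refl ; (suc q') ne → hit .others q' (ne ∘ cong suc) }
  ; before = λ { zero _ → p ; (suc q') (s≤s h) → hit .before q' h } })
scan-event (kill al an) = inj₂ (0 , record
  { inside = s≤s z≤n ; alive = al ; reply = refl ; reply≢ = an ; tagged = refl
  ; others = λ { zero ne → ⊥-elim (ne refl) ; (suc q') _ → refl } ; before = λ _ () })

-- Finiteness of the refutations of an entry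

module Entries (τ : D → D) where

  private
    Z⁺ : ℕ → D
    Z⁺ n = scanning τ n .proj₁

  record HitAt (q n : ℕ) : Set where
    constructor hitAt
    field
      hit : Hit (env τ n) (entries τ n) (response τ n) (scanning τ n .proj₁) q

  tag : ℕ → ℕ → D
  tag q n = hd (at q (entries τ n))

  entries-length : ∀ n → lenD (entries τ n) ≡ n
  entries-length zero    = refl
  entries-length (suc n) = trans (lenD-append (Z⁺ n) _)
    (cong suc (trans (scan-length (scanning τ n .proj₂ .proj₁)) (entries-length n)))

  scanned-length : ∀ n → lenD (Z⁺ n) ≡ n
  scanned-length n = trans (scan-length (scanning τ n .proj₂ .proj₁)) (entries-length n)

  at-suc : ∀ {q n} → q < n → at q (entries τ (suc n)) ≡ at q (Z⁺ n)
  at-suc {q} {n} q<n = at-append q (Z⁺ n) _ (subst (q <_) (sym (scanned-length n)) q<n)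

  at-new : ∀ n → at n (entries τ (suc n)) ≡ leaf · newCode n
  at-new n = trans (cong (λ k → at k (entries τ (suc n))) (sym (scanned-length n))) (at-end (Z⁺ n) _)

  code-at : ∀ {q n} → q < n → tl (at q (entries τ n)) ≡ newCode q
  code-at {q} {suc n} (s≤s q≤n) with m≤n⇒m<n∨m≡n q≤n
  ... | inj₁ q<n  = trans (cong tl (at-suc q<n)) (trans (scan-code (scanning τ n .proj₂ .proj₁) q) (code-at q<n))
  ... | inj₂ refl = cong tl (at-new q)

  tag-step : ∀ {q n} → q < n → HitAt q n ⊎ tag q (suc n) ≡ tag q n
  tag-step {q} {n} q<n with scan-event (scanning τ n .proj₂ .proj₁)
  ... | inj₁ (_ , e , _) = inj₂ (trans (cong hd (at-suc q<n)) (cong (hd ∘ at q) e))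
  ... | inj₂ (p , hit) with q ≟ p
  ...   | yes refl = inj₁ (hitAt hit)
  ...   | no q≢p   = inj₂ (trans (cong hd (at-suc q<n)) (cong hd (hit .others q q≢p)))

  hit-inside : ∀ {q n} → HitAt q n → q < n
  hit-inside {n = n} (hitAt hit) = subst (_ <_) (entries-length n) (hit .inside)

  hit-tag : ∀ {q n} → HitAt q n → tag q (suc n) ≡ leaf · level n
  hit-tag h@(hitAt hit) = trans (cong hd (at-suc (hit-inside h))) (hit .tagged)

  TagBelow : ℕ → ℕ → ℕ → Set
  TagBelow m q n = ∃[ a ] ∃[ t ] tag q n ≡ a · t × lenD t < m

  -- An entry is hit only while alive, that is at a level below its tag, and that level becomes the
  -- tag.
  hit-decreases : ∀ {m q n} → TagBelow (suc m) q n → HitAt q n → TagBelow m q (suc n)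
  hit-decreases {n = n} (a , t , e , s≤s t≤m) h@(hitAt hit) = leaf , level n , hit-tag h ,
    ≤-trans (alive-long a t (level n) (subst (λ g → dead g (level n) ≡ leaf) e (hit .alive))) t≤m

  tagBelow-step : ∀ {m q n} → q < n → TagBelow m q n → TagBelow m q (suc n)
  tagBelow-step {m} {q} {n} q<n b@(a , t , e , t<m) with tag-step q<n
  ... | inj₂ e' = a , t , trans e' e , t<m
  ... | inj₁ h@(hitAt hit) = leaf , level n , hit-tag h ,
    <-trans (alive-long a t (level n) (subst (λ g → dead g (level n) ≡ leaf) e (hit .alive))) t<m

  tagBelow-later : ∀ {m q n} k → q < n → TagBelow m q n → TagBelow m q (k + n)
  tagBelow-later zero    q<n b = b
  tagBelow-later {n = n} (suc k) q<n b = tagBelow-step (≤-trans q<n (m≤n+m n k)) (tagBelow-later k q<n b)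

  Settled : (ℕ → Set) → Set
  Settled P = ∃[ N ] ∀ n → N ≤ n → ¬ P n

  -- The present stage serves as the bound: a later hit would lower the tag, which reduces the claim
  -- to a smaller `m`. No test tells whether such a hit occurs, hence the double negation.
  settle-below : ∀ m q n → q < n → TagBelow m q n → ¬ ¬ Settled (HitAt q)
  settle-below zero    q n q<n (_ , _ , _ , ()) ¬s
  settle-below (suc m) q n q<n b ¬s = ¬s (n , λ n' n≤n' hit →
    settle-below m q (suc n') (m≤n⇒m≤1+n (≤-trans q<n n≤n'))
      (hit-decreases (subst (TagBelow (suc m) q) (m∸n+n≡m n≤n') (tagBelow-later (n' ∸ n) q<n b)) hit) ¬s)

  settle : ∀ q → ¬ ¬ Settled (HitAt q)
  settle q ¬s = ¬s (0 , λ n _ hit →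
    settle-below (suc (lenD (level n))) q (suc n) (m≤n⇒m≤1+n (hit-inside hit)) (leaf , level n , hit-tag hit , ≤-refl) ¬s)

  -- A hit strictly shortens the tag, so each entry is hit finitely often.
  settle-all : ∀ p → ¬ ¬ (∃[ N ] ∀ n q → N ≤ n → q < p → ¬ HitAt q n)
  settle-all zero    ¬s = ¬s (0 , λ _ _ _ ())
  settle-all (suc p) ¬s = settle-all p λ (N , f) → settle p λ (N' , g) → ¬s (N + N' , λ n q h q≤p hit →
    [ (λ q<p → f n q (≤-trans (m≤m+n N N') h) q<p hit)
    , (λ { refl → g n (≤-trans (m≤n+m N' N) h) hit }) ]′ (m≤n⇒m<n∨m≡n (s≤s⁻¹ q≤p)))

open Entries

-- Truncated clocks

dispatch-beyond : ∀ cs l xs → length cs ≤ lenD l → dispatch cs (l · xs) ≡ leaf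
dispatch-beyond []       l       xs h       = refl
dispatch-beyond (c ∷ cs) (_ · l) xs (s≤s h) = dispatch-beyond cs l xs h

dispatch-++ : ∀ cs ds l xs → lenD l < length cs → dispatch (cs ++ ds) (l · xs) ≡ dispatch cs (l · xs)
dispatch-++ (c ∷ cs) ds leaf    xs h       = refl
dispatch-++ (c ∷ cs) ds (_ · l) xs (s≤s h) = dispatch-++ cs ds l xs h

dispatch-last : ∀ cs c l xs → lenD l ≡ length cs → dispatch (cs ++ [ c ]) (l · xs) ≡ clock c xs
dispatch-last []       c leaf    xs h = refl
dispatch-last (d ∷ cs) c (_ · l) xs h = dispatch-last cs c l xs (suc-injective h)

-- This is what a stage of level below `J` can observe of the entries. The tags themselves may
-- differ, since the truncated construction misses the refutations at higher levels.
data Alike (J : ℕ) : D → D → Set where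
  nil  : Alike J leaf leaf
  cons : ∀ {a b Z Z'} → tl a ≡ tl b → (∀ l → lenD l < J → dead (hd a) l ≡ dead (hd b) l) →
         Alike J Z Z' → Alike J (a · Z) (b · Z')

alike-append : ∀ {J Z Z'} a → Alike J Z Z' → Alike J (appD Z (a · leaf)) (appD Z' (a · leaf))
alike-append a nil          = cons refl (λ _ _ → refl) nil
alike-append a (cons c d s) = cons c d (alike-append a s)

alike-scan : ∀ {J e Z₁ Z₂ r₁ r₂ Z₁' Z₂'} → lenD (hd e) < J → Alike J Z₁ Z₂ →
             Scan e Z₁ r₁ Z₁' → Scan e Z₂ r₂ Z₂' → r₁ ≡ r₂ × Alike J Z₁' Z₂'
alike-scan h nil nil nil = refl , nil
alike-scan h (cons c d al) (skip _ s) (skip _ s') with alike-scan h al s s'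
... | r≡ , al' = r≡ , cons c d al'
alike-scan {e = e} h (cons c d al) (skip (inj₁ p) s) (kill q _) = ⊥-elim (p (trans (d (hd e) h) q))
alike-scan {e = e} h (cons c d al) (skip (inj₂ p) s) (kill _ q) = ⊥-elim (q (trans (cong (λ k → simD (k · tl e)) (sym c)) p))
alike-scan {e = e} h (cons c d al) (kill q _) (skip (inj₁ p) s) = ⊥-elim (p (trans (sym (d (hd e) h)) q))
alike-scan {e = e} h (cons c d al) (kill _ q) (skip (inj₂ p) s) = ⊥-elim (q (trans (cong (λ k → simD (k · tl e)) c) p))
alike-scan {e = e} h (cons c d al) (kill _ _) (kill _ _) = cong (λ k → simD (k · tl e)) c , cons c (λ _ _ → refl) al

scan-unclocked : ∀ {l xs Z r Z'} → Scan (l · xs · leaf) Z r Z' → r ≡ leaf × Z' ≡ Z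
scan-unclocked nil        = refl , refl
scan-unclocked (skip {a = a} _ s) = let (r≡ , e) = scan-unclocked s in r≡ , cong (a ·_) e
-- A simulation of no steps is still in the start state, whose verdict is `leaf`.
scan-unclocked (kill _ q) = ⊥-elim (q refl)

-- The refuted entry was alive at a level of at least `J`, hence at all levels below. Its new tag is
-- that level and keeps it alive there.
alike-kill : ∀ {J e Z Z₂ r Z₂'} → J ≤ lenD (hd e) → Alike J Z Z₂ → Scan e Z₂ r Z₂' → Alike J Z Z₂'
alike-kill J≤ nil           nil        = nil
alike-kill J≤ (cons c d al) (skip _ s) = cons c d (alike-kill J≤ al s)
alike-kill {J} {e} J≤ (cons {a = a} {b = b} c d al) (kill q _) = cons c alive-below al
  where
  alive-below : ∀ l → lenD l < J → dead (hd a) l ≡ dead (leaf · hd e) l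
  alive-below l l<J = trans (d l l<J) (trans
    (alive-mono (hd b) (hd e) l (≤-trans (<⇒≤ l<J) J≤) q) (sym (dead-long leaf (hd e) l (≤-trans l<J J≤))))

-- Needed because an empty clock is the sign of an unknown level; a true clock must never be
-- mistaken for it.
lenD-clock-pos : ∀ c n → clock c (input n) ≢ leaf
lenD-clock-pos c n e = <⇒≢ (^-pos (suc n) c) (sym (trans (cong (_^ c) (sym (lenD-input n)))
    (trans (sym (lenD-clock c (input n))) (cong lenD e))))
  where
  ^-pos : ∀ n c .{{_ : NonZero n}} → 0 < n ^ c
  ^-pos n c = m^n>0 n c

length-ones : ∀ n → len (ones n) ≡ suc n
length-ones n = cong suc (length-replicate n)

ones-injective : ∀ {m n} → ones m ≡ ones n → m ≡ n
ones-injective {m} {n} e = suc-injective (trans (sym (length-ones m)) (trans (cong len e) (length-ones n)))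

decision-of : D → D
decision-of r = cond r (cond (tl r) tag₀ tag₁) tag₀

-- The diagonal set and the machines that are correct for it

module Diagonal (c : ℕ → ℕ) where

  exponents : ℕ → List ℕ
  exponents zero    = []
  exponents (suc J) = exponents J ++ [ c J ]

  length-exponents : ∀ J → length (exponents J) ≡ J
  length-exponents zero    = refl
  length-exponents (suc J) = trans (length-++ (exponents J)) (trans (+-comm _ 1) (cong suc (length-exponents J)))

  -- The exponent varies with the level, so no polynomial time bound is claimed for it. It defines
  -- the set, while the functions `truncated J` are the ones that get computed.
  full : D → D
  full t = clock (c (lenD (hd t))) (tl t)

  truncated : ℕ → D → D
  truncated J = dispatch (exponents J)

  truncated-below : ∀ J l xs → lenD l < J → truncated J (l · xs) ≡ full (l · xs)
  truncated-below (suc J) l xs (s≤s h) with m≤n⇒m<n∨m≡n h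
  ... | inj₁ l<J = trans (dispatch-++ (exponents J) _ l xs (subst (lenD l <_) (sym (length-exponents J)) l<J))
                         (truncated-below J l xs l<J)
  ... | inj₂ e   = trans (dispatch-last (exponents J) (c J) l xs (trans e (sym (length-exponents J))))
                         (cong (λ k → clock (c k) xs) (sym e))

  truncated-above : ∀ J l xs → J ≤ lenD l → truncated J (l · xs) ≡ leaf
  truncated-above J l xs h = dispatch-beyond (exponents J) l xs (subst (_≤ lenD l) (sym (length-exponents J)) h)

  entries-alike : ∀ J n → Alike J (entries (truncated J) n) (entries full n)

  stage-alike : ∀ J n → lenD (level n) < J →
                response (truncated J) n ≡ response full n ×
                Alike J (scanning (truncated J) n .proj₁) (scanning full n .proj₁)
  stage-alike J n h = alike-scan h (entries-alike J n)
    (subst (λ T → Scan (level n · input n · T) (entries (truncated J) n) (response (truncated J) n) (scanning (truncated J) n .proj₁))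
           (truncated-below J (level n) (input n) h) (scanning (truncated J) n .proj₂ .proj₁))
    (scanning full n .proj₂ .proj₁)

  stage-idle : ∀ J n → J ≤ lenD (level n) → scanning (truncated J) n .proj₁ ≡ entries (truncated J) n
  stage-idle J n h = scan-unclocked
    (subst (λ T → Scan (level n · input n · T) (entries (truncated J) n) (response (truncated J) n) (scanning (truncated J) n .proj₁))
           (truncated-above J (level n) (input n) h) (scanning (truncated J) n .proj₂ .proj₁)) .proj₂

  entries-alike J zero    = nil
  entries-alike J (suc n) with lenD (level n) <? J
  ... | yes h = alike-append _ (stage-alike J n h .proj₂)
  ... | no ¬h = alike-append _ (subst (λ Z → Alike J Z (scanning full n .proj₁)) (sym (stage-idle J n (≮⇒≥ ¬h)))
                  (alike-kill (≮⇒≥ ¬h) (entries-alike J n) (scanning full n .proj₂ .proj₁)))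

  answered : ℕ → D
  answered n = decision-of (response full n)

  outcome-below : ∀ J n → lenD (level n) < J → outcome (truncated J) n ≡ answered n
  outcome-below J n h = trans (cong₂ (λ T r → cond T (decision-of r) leaf)
      (truncated-below J (level n) (input n) h) (stage-alike J n h .proj₁))
    (clocked (full (level n · input n)) (lenD-clock-pos (c (lenD (level n))) n))
    where
    clocked : ∀ T → T ≢ leaf → cond T (answered n) leaf ≡ answered n
    clocked leaf    ne = ⊥-elim (ne refl)
    clocked (_ · _) ne = refl

  outcome-above : ∀ J n → J ≤ lenD (level n) → outcome (truncated J) n ≡ leaf
  outcome-above J n h = cong (λ T → cond T (decision-of (response (truncated J) n)) leaf)
    (truncated-above J (level n) (input n) h)

  A : Pred
  A x = ∃[ n ] x ≡ ones n × answered n ≡ tag₁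

  module _ (M : TM) (correct : IsPartialDecision A M) (p : ℕ) (listed : newCode p ≡ code M) where

    private
      budget : ℕ → ℕ
      budget n = lenD (full (level n · input n))

    sim-M : ∀ n → simD (code M · tl (env full n)) ≡ answer M (run M (ones n) (budget n))
    sim-M n = trans (cong (λ xs → simD (code M · xs · full (level n · input n))) (sym (encStr-ones n)))
                    (simD-code M (ones n) (full (level n · input n)))

    refuted : ∀ n s → run M (ones n) (budget n) ≡ s → answer M s ≢ leaf → response full n ≡ answer M s → ⊥
    refuted n (running _ _) e ne r≡ = ne refl
    refuted n (halted out?) e ne r≡ = ne refl
    refuted n (halted out0) e ne r≡ = correct (ones n) .proj₂ (budget n , e) (n , refl , cong decision-of r≡)
    refuted n (halted out1) e ne r≡ with correct (ones n) .proj₁ (budget n , e)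
    ... | m , o≡ , a≡ with ones-injective o≡
    ...   | refl with () ← trans (sym a≡) (cong decision-of r≡)

    code-p : ∀ {n} → p < n → tl (at p (entries full n)) ≡ code M
    code-p p<n = trans (code-at full p<n) listed

    -- A hit would set the membership of `ones n` against the simulated answer, which is correct by
    -- assumption.
    never-hit : ∀ n → ¬ HitAt full p n
    never-hit n h@(hitAt hit) = refuted n _ refl (λ e → hit .reply≢ (trans r≡ e)) r≡
      where
      r≡ : response full n ≡ answer M (run M (ones n) (budget n))
      r≡ = trans (hit .reply) (trans (cong (λ k → simD (k · tl (env full n))) (code-p (hit-inside full h))) (sim-M n))

    untagged : ∀ {n} → p < n → tag full p n ≡ leaf
    untagged {suc n} (s≤s p≤n) with m≤n⇒m<n∨m≡n p≤n
    ... | inj₂ e    = trans (cong (λ k → hd (at k (entries full (suc n)))) e) (cong hd (at-new full n))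
    ... | inj₁ p<n with tag-step full p<n
    ...   | inj₁ h = ⊥-elim (never-hit n h)
    ...   | inj₂ e = trans e (untagged p<n)

    silent : ∀ {n} → p < n → Passive (env full n) (at p (entries full n)) →
             answer M (run M (ones n) (budget n)) ≡ leaf
    silent {n} p<n (inj₁ d) = ⊥-elim (d (cong (λ t → dead t (level n)) (untagged p<n)))
    silent {n} p<n (inj₂ e) = trans (sym (sim-M n)) (trans (cong (λ k → simD (k · tl (env full n))) (sym (code-p p<n))) e)

    -- With no hit before `p` the scan reaches entry `p`. It is not hit itself, and a hit further on
    -- certifies that it was passed over, which for an untagged entry means that the simulation gave
    -- no answer.
    undecided : ∀ {n} → p < n → (∀ q → q < p → ¬ HitAt full q n) → answer M (run M (ones n) (budget n)) ≡ leaf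
    undecided {n} p<n quiet with scan-event (scanning full n .proj₂ .proj₁)
    ... | inj₁ (_ , _ , passive) = silent p<n (passive p (subst (p <_) (sym (entries-length full n)) p<n))
    ... | inj₂ (q , hit) with <-cmp q p
    ...   | tri< q<p _ _  = ⊥-elim (quiet q q<p (hitAt hit))
    ...   | tri≈ _ refl _ = ⊥-elim (never-hit n (hitAt hit))
    ...   | tri> _ _ p<q  = silent p<n (hit .before p p<q)

    avoids-listed : ∀ {b J} → RunsInTime b M → (∀ j → J ≤ j → b < c j) →
             ¬ ¬ (∃[ N ] ∀ n → N ≤ n → J ≤ lenD (level n) → ¬ Dom M (ones n))
    avoids-listed {b} {J} (d , fast) above ¬s = settle-all full p λ (N , quiet) →
      -- From `N` on the entries before `p` are no longer hit, `suc p` ensures that the code is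
      -- listed, and from `d` on one more factor `suc n` absorbs the constant of the running time.
      ¬s (N + (suc p + d) , λ n N≤n J≤ dom →
        let p<n = ≤-trans (≤-trans (m≤m+n (suc p) d) (m≤n+m _ N)) N≤n
            d≤n = ≤-trans (≤-trans (m≤n+m d (suc p)) (m≤n+m _ N)) N≤n
            (t , t≤ , o , e) = fast (ones n)
            e' = run-mono M (ones n) (≤-trans t≤ (enough n d≤n (above (lenD (level n)) J≤))) e
            leaf≡ = trans (cong (answer M) (sym e')) (undecided p<n (λ q → quiet n q (≤-trans (m≤m+n N _) N≤n)))
        in contradicts n o {t} e leaf≡ dom)
      where
      enough : ∀ n → d ≤ n → b < c (lenD (level n)) → d * len (ones n) ^ b ≤ budget n
      enough n d≤n b<c = begin
        d * len (ones n) ^ b   ≡⟨ cong (λ k → d * k ^ b) (length-ones n) ⟩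
        d * suc n ^ b                                ≤⟨ *-monoˡ-≤ (suc n ^ b) (m≤n⇒m≤1+n d≤n) ⟩
        suc n ^ suc b                                ≤⟨ ^-monoʳ-≤ (suc n) b<c ⟩
        suc n ^ c (lenD (level n))                   ≡⟨ cong (_^ c (lenD (level n))) (lenD-input n) ⟨
        lenD (input n) ^ c (lenD (level n))          ≡⟨ lenD-clock (c (lenD (level n))) (input n) ⟨
        budget n                                       ∎
        where open ≤-Reasoning
      contradicts : ∀ n o {t} → run M (ones n) t ≡ halted o → answer M (halted o) ≡ leaf → ¬ Dom M (ones n)
      contradicts n out? {t} e _ (inj₁ (s , e')) with () ← output-unique M (ones n) {t} {s} e e'
      contradicts n out? {t} e _ (inj₂ (s , e')) with () ← output-unique M (ones n) {t} {s} e e'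

  avoids : ∀ M → IsPartialDecision A M → ∀ {b J} → RunsInTime b M → (∀ j → J ≤ j → b < c j) →
           ¬ ¬ (∃[ N ] ∀ n → N ≤ n → J ≤ lenD (level n) → ¬ Dom M (ones n))
  avoids M correct = let (p , listed) = code-listed (code M) in avoids-listed M correct p listed

-- Input and output of tree programs

bits : Str → List Bool
bits = List⁺.toList

cell : Bool → List Bool
cell b = true ∷ ser (encSym (bit b))

pushCell : Bool → Prog (5 + r) ⊤
pushCell false = push false 0F ⨾ push false 0F ⨾ push true 0F ⨾ push true 0F
pushCell true  = push false 0F ⨾ push false 0F ⨾ push true 0F ⨾ push false 0F ⨾ push true 0F ⨾ push true 0F

toTree : Prog (5 + r) ⊤
toTree = pour 0F 2F ⨾ push false 0F ⨾ drain 2F pushCell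

fromAnswer : Maybe Bool → Out ⊎ ⊤
fromAnswer (just true) = inj₂ tt
fromAnswer _           = inj₁ out?

fromSign : Maybe Bool → Out ⊎ ⊤
fromSign (just true) = inj₁ out1
fromSign _           = inj₁ out0

-- On the three possible results the first bit separates `leaf` from the tags, the second is the
-- left leaf of a tag, and the third separates `tag₀` from `tag₁`.
output : Prog (5 + r) Out
output = bind (pop 0F) fromAnswer id (pop 0F ⨾ loop (pop 0F) fromSign)

outOf : D → Out
outOf leaf          = out?
outOf (_ · leaf)    = out0
outOf (_ · (_ · _)) = out1

data Ternary : D → Set where
  is-leaf : Ternary leaf
  is-tag₀ : Ternary tag₀
  is-tag₁ : Ternary tag₁

⌊encCells⌋ : ∀ l → ⌊ encCells (map bit l) ⌋ ≤ 1 + 6 * length l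
⌊encCells⌋ []       = ≤-refl
⌊encCells⌋ (b ∷ l) = ≤-trans (s≤s (+-mono-≤ (cells b) (⌊encCells⌋ l))) (≤-reflexive (identity (length l)))
  where
  cells : ∀ b → ⌊ encSym (bit b) ⌋ ≤ 5
  cells false = s≤s (s≤s (s≤s z≤n))
  cells true  = ≤-refl
  identity : ∀ n → suc (5 + (1 + 6 * n)) ≡ 1 + 6 * suc n
  identity = solve-∀

length-ʳ++-[] : ∀ (l : List Bool) → length (l ʳ++ []) ≡ length l
length-ʳ++-[] l = trans (length-ʳ++ l) (+-identityʳ _)

module _ {us : Vec Tape r} where

  exec-pour₀₂ : ∀ l → Exec (pour 0F 2F) us (idle l) tt ([] ∷ [] ∷ (l ʳ++ []) ∷ [] ∷ [] ∷ []) (suc (3 * length l))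
  exec-pour₀₂ l = exec-drain (λ _ → us) (λ l a → l ∷ [] ∷ a ∷ [] ∷ [] ∷ []) 0F (λ _ _ → refl) (λ _ _ _ → refl)
    (λ b l a → exec-push b 2F) l []

  exec-pushCell : ∀ b l m → Exec (pushCell b) us (m ∷ [] ∷ l ∷ [] ∷ [] ∷ []) tt ((cell b ++ m) ∷ [] ∷ l ∷ [] ∷ [] ∷ []) 12
  exec-pushCell false l m = weaken (≤-slack {8} 4 refl)
    (exec-push false 0F ⨟ exec-push false 0F ⨟ exec-push true 0F ⨟ exec-push true 0F)
  exec-pushCell true  l m =
    exec-push false 0F ⨟ exec-push false 0F ⨟ exec-push true 0F ⨟ exec-push false 0F ⨟ exec-push true 0F ⨟ exec-push true 0F

  exec-toTree : ∀ l → Exec toTree us (idle l) tt (idle (ser (encCells (map bit l)))) (16 * length l + 4)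
  exec-toTree l = weaken (≤-reflexive (cost (length l) (length-ʳ++-[] l)))
    (landing (cong idle (trans (reverse-foldl (λ m b → cell b ++ m) (false ∷ []) l) (serialised l)))
      (exec-pour₀₂ l ⨟ exec-push false 0F ⨟
       exec-drain (λ _ → us) (λ l m → m ∷ [] ∷ l ∷ [] ∷ [] ∷ []) 2F (λ _ _ → refl) (λ _ _ _ → refl)
         exec-pushCell (l ʳ++ []) (false ∷ [])))
    where
    serialised : ∀ l → foldr (λ b m → cell b ++ m) (false ∷ []) l ≡ ser (encCells (map bit l))
    serialised []          = refl
    serialised (false ∷ l) = cong (cell false ++_) (serialised l)
    serialised (true ∷ l)  = cong (cell true ++_) (serialised l)
    cost : ∀ n {m} → m ≡ n → suc (3 * n) + (2 + suc (13 * m)) ≡ 16 * n + 4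
    cost n refl = identity n
      where
      identity : ∀ n → suc (3 * n) + (2 + suc (13 * n)) ≡ 16 * n + 4
      identity = solve-∀

  exec-output : ∀ {d} → Ternary d → ∃[ s ] Exec output us (idle (ser d)) (outOf d) s 3
  exec-output is-leaf = _ , weaken (s≤s z≤n) (exec-bind-exit (exec-pop 0F refl) refl)
  exec-output is-tag₀ = _ , exec-bind-next (exec-pop 0F refl) refl (exec-pop 0F refl ⨟ exec-loop-exit (exec-pop 0F refl) refl)
  exec-output is-tag₁ = _ , exec-bind-next (exec-pop 0F refl) refl (exec-pop 0F refl ⨟ exec-loop-exit (exec-pop 0F refl) refl)

-- The extra tapes may hold anything, since the decider is also started after another machine has
-- left its tapes in an arbitrary state.
record Decider (f : Str → Out) : Set₁ where
  no-eta-equality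
  field
    program : ∀ {r} → Prog (5 + r) Out
    cost    : Poly
    decides : ∀ {r} {us : Vec Tape r} x → ∃[ s ] Exec program us (idle (bits x)) (f x) s (eval cost (len x))

open Decider

treeDecider : ∀ {f} → PT f → (∀ x → Ternary (f (encStr x))) → Decider (outOf ∘ f ∘ encStr)
treeDecider {f} F ternary = record
  { program = toTree ⨾ F .prog ⨾ output
  ; cost = (con 16 ⊗ var ⊕ con 4) ⊕ (F .time ⟨ con 1 ⊕ con 6 ⊗ var ⟩ ⊕ con 3)
  ; decides = λ { x@(b ∷ bs) → let (s , e) = exec-output (ternary x) in s , weaken
      (+-monoʳ-≤ (16 * len x + 4) (+-monoˡ-≤ 3 (eval-at (F .time) (con 1 ⊕ con 6 ⊗ var) (⌊encCells⌋ (b ∷ bs)))))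
      (exec-toTree (b ∷ bs) ⨟
       starting (cong idle (sym (++-identityʳ _))) (landing (cong idle (++-identityʳ _)) (F .execs (encStr x) [])) ⨟ e) } }

cells-bits : ∀ l → Cells l (map bit l)
cells-bits []      = []
cells-bits (b ∷ l) = bit∷ (cells-bits l)

empty-stack : Stack [] (tape [] blank [])
empty-stack = [] , blank∷ []

decisionTM : ∀ {f} → Decider f → TM
decisionTM Δ = machine ⟦ Δ .program {0} ⟧

run-decisionTM : ∀ {f} (Δ : Decider f) x → ∃[ t ] t ≤ eval (Δ .cost) (len x) × run (decisionTM Δ) x t ≡ halted (f x)
run-decisionTM Δ x@(b ∷ bs) with Δ .decides {us = []} x
... | s , e with e .runs (initTapes (decisionTM Δ) x)
                 (([] , cells-bits (b ∷ bs)) , empty-stack , empty-stack , empty-stack , empty-stack , refl)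
...   | ts , t , t≤ , r , _ = t , t≤ , run-machine ⟦ Δ .program {0} ⟧ {x = x} r

-- Running a machine and, if it does not answer, a decider

fallback : Out → Out ⊎ ⊤
fallback out0 = inj₁ out0
fallback out1 = inj₁ out1
fallback out? = inj₂ tt

combine : Out → Out → Out
combine out0 _ = out0
combine out1 _ = out1
combine out? o = o

copyInput : Prog (5 + suc r) ⊤
copyInput = pour 0F 2F ⨾ drain 2F (λ b → push b 0F ⨾ pushAt b (5 ↑ʳ 0F))

-- Pushing onto a blank tape yields exactly this tape, without stray blanks, so it coincides with
-- the initial input tape of the machine to be run.
inputTape : List Bool → Tape
inputTape []      = tape [] blank []
inputTape (b ∷ l) = tape [] (bit b) (map bit l)

exec-copyInput : ∀ (us : Vec Tape r) l → Steps copyInput (tape [] blank [] ∷ us) (idle l) tt (inputTape l ∷ us) (idle l) (8 * length l + 2)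
exec-copyInput us l = weaken (≤-reflexive (cost′ (length l) (length-ʳ++-[] l)))
  (exec-pour₀₂ l ⨟ subst (λ (m , t) → Steps (drain 2F λ b → push b 0F ⨾ pushAt b (5 ↑ʳ 0F)) (tape [] blank [] ∷ us) ([] ∷ [] ∷ (l ʳ++ []) ∷ [] ∷ [] ∷ []) tt
                             (t ∷ us) (idle m) (suc (5 * length (l ʳ++ [])))) copied
    (exec-drain (λ (m , t) → t ∷ us) (λ l (m , t) → m ∷ [] ∷ l ∷ [] ∷ [] ∷ []) 2F (λ _ _ → refl) (λ _ _ _ → refl)
      (λ b l (m , t) → exec-push b 0F ⨟ exec-pushAt b 0F) (l ʳ++ []) ([] , tape [] blank [])))
  where
  both : List Bool × Tape → Bool → List Bool × Tape
  both (m , t) b = b ∷ m , pushTape b t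
  pushed : ∀ l → foldr (flip both) ([] , tape [] blank []) l ≡ (l , inputTape l)
  pushed []           = refl
  pushed (b ∷ [])     = refl
  pushed (b ∷ c ∷ l)  = cong (λ p → both p b) (pushed (c ∷ l))
  copied : foldl both ([] , tape [] blank []) (l ʳ++ []) ≡ (l , inputTape l)
  copied = trans (reverse-foldl both ([] , tape [] blank []) l) (pushed l)
  cost′ : ∀ n {m} → m ≡ n → suc (3 * n) + suc (5 * m) ≡ 8 * n + 2
  cost′ n refl = identity n
    where
    identity : ∀ n → suc (3 * n) + suc (5 * n) ≡ 8 * n + 2
    identity = solve-∀

module _ {f : Str → Out} (M : TM) (Δ : Decider f) where

  withFallback : Frag (5 + suc (TM.tapes M)) Out
  withFallback = bindᶠ (embed M) fallback id ⟦ Δ .program ⟧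

  orElse : Frag (5 + suc (TM.tapes M)) Out
  orElse = bindᶠ ⟦ copyInput ⟧ (λ _ → inj₂ tt) id withFallback

  run-withFallback : ∀ x t o → run M x t ≡ halted o → ∀ ts → Stacks (idle (bits x)) (initTapes M x) ts →
                     ∃[ ts' ] ∃[ t' ] t' ≤ t + eval (Δ .cost) (len x) × Run withFallback (inj₁ zero) ts (combine o (f x)) ts' t'
  run-withFallback x t o eq (t₀ ∷ t₁ ∷ t₂ ∷ t₃ ∷ t₄ ∷ _) (p₀ , p₁ , p₂ , p₃ , p₄ , refl) =
    let (us , u , u≤ , r) = run-embed M t zero (initTapes M x) eq in go o us u u≤ r
    where
    go : ∀ o us u → u ≤ t → Run (embed M) zero (t₀ ∷ t₁ ∷ t₂ ∷ t₃ ∷ t₄ ∷ initTapes M x) o (t₀ ∷ t₁ ∷ t₂ ∷ t₃ ∷ t₄ ∷ us) u →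
         ∃[ ts' ] ∃[ t' ] t' ≤ t + eval (Δ .cost) (len x) ×
           Run withFallback (inj₁ zero) (t₀ ∷ t₁ ∷ t₂ ∷ t₃ ∷ t₄ ∷ initTapes M x) (combine o (f x)) ts' t'
    go out0 us u u≤ r = _ , u , ≤-trans u≤ (m≤m+n t _) , run-bind-exit r refl
    go out1 us u u≤ r = _ , u , ≤-trans u≤ (m≤m+n t _) , run-bind-exit r refl
    go out? us u u≤ r =
      let (_ , v , v≤ , r' , _) = Δ .decides {us = us} x .proj₂ .runs (t₀ ∷ t₁ ∷ t₂ ∷ t₃ ∷ t₄ ∷ us) (p₀ , p₁ , p₂ , p₃ , p₄ , refl)
      in _ , u + v , +-mono-≤ u≤ v≤ , run-bind-next r refl r'

  run-orElse : ∀ x t o → run M x t ≡ halted o →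
               ∃[ t' ] t' ≤ 8 * len x + 2 + (t + eval (Δ .cost) (len x)) ×
                       run (machine orElse) x t' ≡ halted (combine o (f x))
  run-orElse x@(b ∷ bs) t o eq =
    let (ts , s , s≤ , copyRun , p) = exec-copyInput (replicate (TM.tapes M) (tape [] blank [])) (b ∷ bs) .runs
          (initTapes (machine orElse) x)
          (([] , cells-bits (b ∷ bs)) , empty-stack , empty-stack , empty-stack , empty-stack , refl)
        (_ , u , u≤ , r) = run-withFallback x t o eq ts p
    in s + u , +-mono-≤ s≤ u≤ , run-machine orElse {x = x} (run-bind-next copyRun refl r)

-- Slices

module Slices (A : Pred) {f : Str → Out} (Δ : Decider f) (e : ℕ) (1≤e : 1 ≤ e) (degree≤ : degree (Δ .cost) ≤ e)
              (f-yes : ∀ x → f x ≡ out1 → A x) (f-no : ∀ x → f x ≡ out0 → ¬ A x) where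

  cost-bound : ∀ n → 1 ≤ n → eval (Δ .cost) n ≤ coeff (Δ .cost) * n ^ e
  cost-bound n@(suc _) 1≤n = ≤-trans (eval-≤ (Δ .cost) n 1≤n)
    (*-monoʳ-≤ (coeff (Δ .cost)) (^-monoʳ-≤ n degree≤))

  U : TM
  U = decisionTM Δ

  U-outputs : ∀ x → Outputs U x (f x)
  U-outputs x = let (t , _ , e) = run-decisionTM Δ x in t , e

  U-output : ∀ {x o} → Outputs U x o → f x ≡ o
  U-output {x} (s , e) = let (t , e') = U-outputs x in output-unique U x {t} {s} e' e

  U-approx : IsApprox (e) A U
  U-approx = (λ x → f-yes x ∘ U-output , f-no x ∘ U-output) ,
    coeff (Δ .cost) , λ { x@(_ ∷ _) → let (t , t≤ , e) = run-decisionTM Δ x in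
      t , ≤-trans t≤ (cost-bound (len x) (s≤s z≤n)) , f x , e }

  dom-U : ∀ x → f x ≢ out? → Dom U x
  dom-U x ne = go (f x) ne (U-outputs x)
    where
    go : ∀ o → o ≢ out? → Outputs U x o → Dom U x
    go out0 _  e = inj₁ e
    go out1 _  e = inj₂ e
    go out? ne _ = ⊥-elim (ne refl)

  outside-U : ∀ x → ¬ Dom U x → f x ≡ out?
  outside-U x ∉U = go (f x) (U-outputs x)
    where
    go : ∀ o → Outputs U x o → o ≡ out?
    go out0 e = ⊥-elim (∉U (inj₁ e))
    go out1 e = ⊥-elim (∉U (inj₂ e))
    go out? _ = refl

  module _ (M : TM) (approx : IsApprox (e) A M) where

    W : TM
    W = machine (orElse M Δ)

    result : ∀ x → ∃[ o ] Outputs M x o × Outputs W x (combine o (f x))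
    result x = let (t , _ , o , e) = approx .proj₂ .proj₂ x
                   (t' , _ , e') = run-orElse M Δ x t o e in o , (t , e) , (t' , e')

    W-cases : ∀ {x o} → Outputs W x o → o ≢ out? → Outputs M x o ⊎ f x ≡ o
    W-cases {x} {o} (s , e) ne =
      let (o' , outM , (t , e')) = result x in go o' outM (output-unique W x {t} {s} e' e)
      where
      go : ∀ o' → Outputs M x o' → combine o' (f x) ≡ o → Outputs M x o ⊎ f x ≡ o
      go out0 outM refl = inj₁ outM
      go out1 outM refl = inj₁ outM
      go out? outM e    = inj₂ e

    W-approx : IsApprox (e) A W
    W-approx = (λ x →
        (λ h → [ approx .proj₁ x .proj₁ , f-yes x ]′ (W-cases h λ ())) ,
        (λ h → [ approx .proj₁ x .proj₂ , f-no x ]′ (W-cases h λ ()))) ,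
      -- Copying takes 8m + 2 steps, and `1≤e` bounds this by 10 times m to the power `e`.
      10 + (d + k′) , fast
      where
      d k′ : ℕ
      d = approx .proj₂ .proj₁
      k′ = coeff (Δ .cost)
      fast : ∀ x → ∃[ t ] t ≤ (10 + (d + k′)) * len x ^ e × HaltsWithin W x t
      fast x@(_ ∷ _) =
        let (t , t≤ , o , eq) = approx .proj₂ .proj₂ x
            (t' , t'≤ , e') = run-orElse M Δ x t o eq
        in t' , ≤-trans t'≤ (bound t t≤) , combine o (f x) , e'
        where
        m p : ℕ
        m = len x
        p = m ^ e
        open ≤-Reasoning
        m≤p : m ≤ p
        m≤p = ≤-trans (≤-reflexive (sym (*-identityʳ m))) (^-monoʳ-≤ m {1} {e} 1≤e)
        bound : ∀ t → t ≤ d * p → 8 * m + 2 + (t + eval (Δ .cost) m) ≤ (10 + (d + k′)) * p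
        bound t t≤ = begin
          8 * m + 2 + (t + eval (Δ .cost) m)
            ≤⟨ +-mono-≤ (+-mono-≤ (*-monoʳ-≤ 8 m≤p) (*-monoʳ-≤ 2 (≤-trans (s≤s z≤n) m≤p))) (+-mono-≤ t≤ (cost-bound m (s≤s z≤n))) ⟩
          8 * p + 2 * p + (d * p + k′ * p)
            ≡⟨ identity p d k′ ⟩
          (10 + (d + k′)) * p ∎
          where
          identity : ∀ p d k → 8 * p + 2 * p + (d * p + k * p) ≡ (10 + (d + k)) * p
          identity = solve-∀

    dom-W : (λ x → Dom M x ⊎ Dom U x) ≐ Dom W
    dom-W x = to , from
      where
      to : Dom M x ⊎ Dom U x → Dom W x
      to h = let (o' , (t , e) , outW) = result x in go t o' e outW h
        where
        go : ∀ t o' → run M x t ≡ halted o' → Outputs W x (combine o' (f x)) → Dom M x ⊎ Dom U x → Dom W x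
        go t out0 e outW _ = inj₁ outW
        go t out1 e outW _ = inj₂ outW
        go t out? e outW (inj₁ (inj₁ (s , e'))) = case output-unique M x {t} {s} e e' of λ ()
        go t out? e outW (inj₁ (inj₂ (s , e'))) = case output-unique M x {t} {s} e e' of λ ()
        go t out? e outW (inj₂ (inj₁ h)) = inj₁ (subst (Outputs W x) (U-output h) outW)
        go t out? e outW (inj₂ (inj₂ h)) = inj₂ (subst (Outputs W x) (U-output h) outW)
      from : Dom W x → Dom M x ⊎ Dom U x
      from (inj₁ h) = [ inj₁ ∘ inj₁ , (λ e → inj₂ (inj₁ (subst (Outputs U x) e (U-outputs x)))) ]′ (W-cases h λ ())
      from (inj₂ h) = [ inj₁ ∘ inj₂ , (λ e → inj₂ (inj₂ (subst (Outputs U x) e (U-outputs x)))) ]′ (W-cases h λ ())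

ternary-cond : ∀ T r u → Ternary (cond T (cond r (cond u tag₀ tag₁) tag₀) leaf)
ternary-cond leaf    r       u       = is-leaf
ternary-cond (_ · _) leaf    u       = is-tag₀
ternary-cond (_ · _) (_ · _) leaf    = is-tag₁
ternary-cond (_ · _) (_ · _) (_ · _) = is-tag₀

ternary-outcome : ∀ τ n → Ternary (outcome τ n)
ternary-outcome τ n = ternary-cond (τ (level n · input n)) (response τ n) (tl (response τ n))

decide-ternary : ∀ τ x → Ternary (decide τ (encStr x))
decide-ternary τ x with decide-other τ x
... | inj₁ (n , refl) = subst Ternary (sym (decide-ones τ n)) (ternary-outcome τ n)
... | inj₂ e          = subst Ternary (sym e) is-tag₀

-- The exponents

abstract
  deciderFor : ∀ cs → Decider (outOf ∘ decide (dispatch cs) ∘ encStr)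
  deciderFor cs = treeDecider (decideP (dispatchP cs)) (decide-ternary (dispatch cs))

-- More than the degree: the sum makes the exponents strictly increasing, and the leading successor
-- makes the time bound at least linear, which copying an input requires.
runtime : List ℕ → ℕ
runtime cs = suc (degree (deciderFor cs .cost)) + sum cs

-- Level J is clocked beyond the running time of the decider for the levels below J.
tower : ℕ → List ℕ
tower zero    = []
tower (suc J) = tower J ++ [ suc (runtime (tower J)) ]

exponent : ℕ → ℕ
exponent J = suc (runtime (tower J))

open Diagonal exponent

-- `Diagonal` takes the exponents as given, while each of them depends on the whole list of earlier
-- ones. So `tower` builds the lists first, and they are recognised here as those of `Diagonal`.
exponents-tower : ∀ J → exponents J ≡ tower J
exponents-tower zero    = refl
exponents-tower (suc J) = cong (_++ [ exponent J ]) (exponents-tower J)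

runtimeAt : ℕ → ℕ
runtimeAt J = runtime (exponents J)

exponent-runtime : ∀ J → exponent J ≡ suc (runtimeAt J)
exponent-runtime J = cong (λ cs → suc (runtime cs)) (sym (exponents-tower J))

exponent-step : ∀ J → exponent J < exponent (suc J)
exponent-step J = s≤s (begin
  exponent J                              ≤⟨ m≤n+m (exponent J) (sum (tower J)) ⟩
  sum (tower J) + exponent J              ≡⟨ cong (sum (tower J) +_) (+-identityʳ (exponent J)) ⟨
  sum (tower J) + sum [ exponent J ]      ≡⟨ sum-++ (tower J) [ exponent J ] ⟨
  sum (tower (suc J))                     ≤⟨ m≤n+m _ _ ⟩
  runtime (tower (suc J))                 ∎)
  where open ≤-Reasoning

exponent-mono : ∀ {i j} → i ≤ j → exponent i ≤ exponent j
exponent-mono {i} i≤j = subst (λ k → exponent i ≤ exponent k) (m+[n∸m]≡n i≤j) (go (_ ∸ i))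
  where
  go : ∀ d → exponent i ≤ exponent (i + d)
  go zero    = ≤-reflexive (cong exponent (sym (+-identityʳ i)))
  go (suc d) = ≤-trans (go d) (≤-trans (<⇒≤ (exponent-step (i + d))) (≤-reflexive (cong exponent (sym (+-suc i d)))))

exponent-> : ∀ J → J < exponent J
exponent-> zero    = s≤s z≤n
exponent-> (suc J) = ≤-trans (s≤s (exponent-> J)) (exponent-step J)

runtime-≥ : ∀ J → J ≤ runtimeAt J
runtime-≥ J = s≤s⁻¹ (subst (J <_) (exponent-runtime J) (exponent-> J))

runtime-< : ∀ {J j} → J ≤ j → runtimeAt J < exponent j
runtime-< {J} {j} J≤j = subst (_≤ exponent j) (exponent-runtime J) (exponent-mono J≤j)

-- The maximal slices

module _ (J : ℕ) where

  verdictAt : Str → Out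
  verdictAt x = outOf (decide (truncated J) (encStr x))

  decider : Decider verdictAt
  decider = deciderFor (exponents J)

  verdict-below : ∀ n → lenD (level n) < J → verdictAt (ones n) ≡ outOf (answered n)
  verdict-below n h = cong outOf (trans (decide-ones (truncated J) n) (outcome-below J n h))

  verdict-above : ∀ n → J ≤ lenD (level n) → verdictAt (ones n) ≡ out?
  verdict-above n h = cong outOf (trans (decide-ones (truncated J) n) (outcome-above J n h))

  answered-cases : ∀ n → answered n ≡ tag₀ ⊎ answered n ≡ tag₁
  answered-cases n = go (response full n) (tl (response full n))
    where
    go : ∀ r u → cond r (cond u tag₀ tag₁) tag₀ ≡ tag₀ ⊎ cond r (cond u tag₀ tag₁) tag₀ ≡ tag₁
    go leaf    u       = inj₁ refl
    go (_ · _) leaf    = inj₂ refl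
    go (_ · _) (_ · _) = inj₁ refl

  verdict-known : ∀ n → lenD (level n) < J → verdictAt (ones n) ≢ out?
  verdict-known n h e with answered-cases n
  ... | inj₁ a with () ← trans (sym e) (trans (verdict-below n h) (cong outOf a))
  ... | inj₂ a with () ← trans (sym e) (trans (verdict-below n h) (cong outOf a))

  verdict-unknown : ∀ x → verdictAt x ≡ out? → ∃[ n ] x ≡ ones n × J ≤ lenD (level n)
  verdict-unknown x e with decide-other (truncated J) x
  ... | inj₂ d with () ← trans (sym e) (cong outOf d)
  ... | inj₁ (n , refl) with lenD (level n) <? J
  ...   | yes h = ⊥-elim (verdict-known n h e)
  ...   | no ¬h = n , refl , ≮⇒≥ ¬h

  verdict-yes : ∀ x → verdictAt x ≡ out1 → A x
  verdict-yes x e with decide-other (truncated J) x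
  ... | inj₂ d with () ← trans (sym e) (cong outOf d)
  ... | inj₁ (n , refl) with lenD (level n) <? J
  ...   | no ¬h with () ← trans (sym e) (verdict-above n (≮⇒≥ ¬h))
  ...   | yes h with answered-cases n
  ...     | inj₂ a = n , refl , a
  ...     | inj₁ a with () ← trans (sym e) (trans (verdict-below n h) (cong outOf a))

  verdict-no : ∀ x → verdictAt x ≡ out0 → ¬ A x
  verdict-no x e (n , refl , a) with lenD (level n) <? J
  ... | yes h with () ← trans (sym e) (trans (verdict-below n h) (cong outOf a))
  ... | no ¬h with () ← trans (sym e) (verdict-above n (≮⇒≥ ¬h))

record LevelDecider (J : ℕ) : Set₁ where
  no-eta-equality
  field
    {answers} : Str → Out
    Δ       : Decider answers
    degree≤ : degree (Δ .cost) ≤ runtimeAt J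
    on-yes  : ∀ x → answers x ≡ out1 → A x
    on-no   : ∀ x → answers x ≡ out0 → ¬ A x
    known   : ∀ n → lenD (level n) < J → answers (ones n) ≢ out?
    unknown : ∀ x → answers x ≡ out? → ∃[ n ] x ≡ ones n × J ≤ lenD (level n)

open LevelDecider

abstract
  levelDecider : ∀ J → LevelDecider J
  levelDecider J = record
    { Δ = decider J ; degree≤ = m≤n⇒m≤1+n (m≤m+n (degree (decider J .cost)) (sum (exponents J)))
    ; on-yes = verdict-yes J ; on-no = verdict-no J ; known = verdict-known J ; unknown = verdict-unknown J }

module Level (J : ℕ) = Slices A (levelDecider J .Δ) (runtimeAt J) (s≤s z≤n) (levelDecider J .degree≤)
                              (levelDecider J .on-yes) (levelDecider J .on-no)

-- The two halves of the theorem

∈-length : ∀ {x L} → x ∈ L → len x ≤ sum (map len L)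
∈-length (here refl)         = m≤m+n _ _
∈-length {L = y ∷ _} (there x∈L) = ≤-trans (∈-length x∈L) (m≤n+m _ (len y))

-- A slice of time O(n^b) misses almost all words of level `b`, whereas the decider for the levels
-- below `suc b` answers on all of them.
A-levelable : PLevelable A
A-levelable (S , (M , (b , correct , fast) , S≐) , maximal) = avoids M correct fast above λ (N , silent) →
  let (L , covers) = maximal (Dom (Level.U (suc b))) (Level.U (suc b) , (runtimeAt (suc b) , Level.U-approx (suc b)) , λ x → id , id)
      -- Past `N` the machine is silent on level `b`, and a word longer than all lengths in `L`
      -- together cannot belong to `L`.
      (n , n≥ , level≡) = level-recurs b (N + sum (map len L))
      inside = covers (ones n)
        ( Level.dom-U (suc b) (ones n) (levelDecider (suc b) .known n (s≤s (≤-reflexive level≡)))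
        , λ s → silent n (≤-trans (m≤m+n N _) n≥) (≤-reflexive (sym level≡)) (S≐ (ones n) .proj₁ s))
  in <-irrefl refl (≤-trans (≤-reflexive (sym (length-ones n))) (≤-trans (∈-length inside) (≤-trans (m≤n+m _ N) n≥)))
  where
  above : ∀ j → b ≤ j → b < exponent j
  above j b≤j = ≤-<-trans b≤j (exponent-> j)

-- Once the domain of the decider is added to every slice, a difference of two slices contains only
-- words of level at least `J`. An O(n^e)-slice with e = `runtimeAt J` contains finitely many of
-- these.
not-mixing : ∀ J {Ω} (η : Parameterization Ω) → FPTnu (runtimeAt J) A η →
             ¬ (∀ (η' : Parameterization Ω) → η' ≼nu η → FPTnu (runtimeAt J) A η' → Imix η')
not-mixing J {Ω} η slices imix = avoids M correct fast (λ j → runtime-< {J} {j}) λ (N , silent) →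
  infinite (map ones (upTo N) , λ x (x∈ , x∉) → covered N silent x x∈ x∉)
  where
  open ParamSpace Ω
  open Parameterization
  η⁺ : Parameterization Ω
  η⁺ = record
    { rel = λ x k → rel η x k ⊎ Dom (Level.U J) x
    ; nonempty = λ x → let (k , h) = nonempty η x in k , inj₁ h
    ; upward = λ { (inj₁ h) k≼ → inj₁ (upward η h k≼) ; (inj₂ h) _ → inj₂ h } }
  slices⁺ : FPTnu (runtimeAt J) A η⁺
  slices⁺ k = let (M , approx , S≐) = slices k in Level.W J M approx , Level.W-approx J M approx , λ x →
    (λ { (inj₁ h) → Level.dom-W J M approx x .proj₁ (inj₁ (S≐ x .proj₁ h))
       ; (inj₂ h) → Level.dom-W J M approx x .proj₁ (inj₂ h) }) ,
    (λ h → [ inj₁ ∘ S≐ x .proj₂ , inj₂ ]′ (Level.dom-W J M approx x .proj₂ h))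
  mixing : Imix η⁺
  -- Enlarging the slices cannot increase μ, so the gap at `n` is at most `n`.
  mixing = imix η⁺ (λ n → n , λ { x (k , h , k≤) → k , inj₁ h , k≤ }) slices⁺
  k' : Carrier
  k' = mixing inhabited .proj₁
  infinite : Infinite (slice η⁺ k' ∖ slice η⁺ inhabited)
  infinite = mixing inhabited .proj₂
  M : TM
  M = slices k' .proj₁
  correct : IsPartialDecision A M
  correct = slices k' .proj₂ .proj₁ .proj₁
  fast : RunsInTime (runtimeAt J) M
  fast = slices k' .proj₂ .proj₁ .proj₂
  covered : ∀ N → (∀ n → N ≤ n → J ≤ lenD (level n) → ¬ Dom M (ones n)) →
            ∀ x → slice η⁺ k' x → ¬ slice η⁺ inhabited x → x ∈ map ones (upTo N)
  covered N silent x (inj₂ h) x∉ = ⊥-elim (x∉ (inj₂ h))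
  covered N silent x (inj₁ h) x∉ =
    let (n , x≡ , J≤) = levelDecider J .unknown x (Level.outside-U J x (x∉ ∘ inj₂)) in
    subst (_∈ map ones (upTo N)) (sym x≡) (∈-map⁺ ones (∈-upTo⁺ (≰⇒> λ N≤n →
      silent n N≤n J≤ (slices k' .proj₂ .proj₂ (ones n) .proj₁ (subst (λ z → rel η z k') x≡ h)))))

-- The proposed threshold is itself taken as the level `J`: the exponent `runtimeAt J` is at least
-- `J`, hence admissible.
A-not-levelable : ¬ FPTnuLevelable A
A-not-levelable (J , levelable) =
  let (Ω , η , slices , imix) = levelable (runtimeAt J) (runtime-≥ J) in not-mixing J η slices (imix Ω)

theorem4 : ∃[ A ] (PLevelable A × ¬ FPTnuLevelable A)
theorem4 = A , A-levelable , A-not-levelable
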